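{- Let $q\in\mathbb{C}$ with $|q|<1$, let $k$ be a non-negative integer, and let $b,x,y,z\in\mathbb{C}$ with $|xy|<1$, $|xz|<1$, $|by|<1$ and $|bz|<1$. Then \[ \sum_{n=0}^{\infty}\sum_{m=0}^{\infty}\Phi_{n+m}^{(q^k)}(b,x|q)\frac{y^n}{(q;q)_{n}}\frac{z^m}{(q;q)_{m}}=\frac{(q^{k}bz;q)_{\infty}}{(xy;q)_{\infty}(xz;q)_{\infty}(bz;q)_{\infty}}\;{}_{2}\varphi_{1}\left(\begin{array}{c} q^{k},\,xz\\ q^{k}bz\end{array};q,\,by\right). \]
   Context: For $a\in\mathbb{C}$ and integers $n\ge 0$, $(a;q)_n=\prod_{j=0}^{n-1}(1-q^j a)$ and $(a;q)_\infty=\prod_{j=0}^{\infty}(1-aq^j)$. The $q$-binomial coefficient is $\genfrac{[}{]}{0pt}{}{m}{j}_q=\frac{(q;q)_m}{(q;q)_j(q;q)_{m-j}}$. The homogeneous Hahn polynomials are $\Phi_{m}^{(\alpha)}(x,y|q)=\sum_{j=0}^{m}\genfrac{[}{]}{0pt}{}{m}{j}_{q}(\alpha;q)_{j}x^jy^{m-j}$; thus $\Phi_{m}^{(q^k)}(b,x|q)=\sum_{j=0}^{m}\genfrac{[}{]}{0pt}{}{m}{j}_{q}(q^k;q)_{j}b^jx^{m-j}$. The basic hypergeometric series is \[ {}_{2}\varphi_{1}\left(\begin{array}{c} a_1,a_2\\ b_1\end{array};q,w\right)=\sum_{l=0}^{\infty}\frac{(a_1;q)_l(a_2;q)_l}{(q;q)_l(b_1;q)_l}w^l,\qquad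 |w|<1. \] -}

module Defs where

open import Data.Nat.Base as ℕ using (ℕ; zero; suc; _∸_)
import Data.Nat.Properties as ℕₚ
open import Data.Nat.Coprimality as Coprime using (1-coprimeTo)
open import Data.Integer.Base as ℤ using (+_; -[1+_])
open import Data.Rational.Base as ℚ using (ℚ; mkℚ; 0ℚ; 1ℚ; ½)
import Data.Integer.Properties as ℤₚ
import Data.Rational.Properties as ℚₚ
open import Data.Rational.Solver using (module +-*-Solver)
open import Data.Product.Base using (∃; ∃-syntax; _×_; _,_; proj₁; proj₂)
open import Data.Sum.Base using (inj₁; inj₂)
open import Relation.Nullary using (Dec; yes; no; contradiction)
open import Relation.Binary.PropositionalEquality
  using (_≡_; refl; sym; trans; cong; cong₂; subst; subst₂)

open +-*-Solver using (solve; _:=_; _:+_; _:*_; _:-_; :-_; con)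

------------------------------------------------------------------------
-- Inequalities between rationals

0<1 : 0ℚ ℚ.< 1ℚ
0<1 = ℚₚ.positive⁻¹ 1ℚ

0<½ : 0ℚ ℚ.< ½
0<½ = ℚₚ.positive⁻¹ ½

0≤ᵈ : ∀ {p q} → p ℚ.≤ q → 0ℚ ℚ.≤ q ℚ.- p
0≤ᵈ {p} {q} h = subst (ℚ._≤ q ℚ.- p) (ℚₚ.+-inverseʳ p) (ℚₚ.+-monoˡ-≤ (ℚ.- p) h)

0<ᵈ : ∀ {p q} → p ℚ.< q → 0ℚ ℚ.< q ℚ.- p
0<ᵈ {p} {q} h = subst (ℚ._< q ℚ.- p) (ℚₚ.+-inverseʳ p) (ℚₚ.+-monoˡ-< (ℚ.- p) h)

p+d : ∀ p q → p ℚ.+ (q ℚ.- p) ≡ q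
p+d = solve 2 (λ p q → p :+ (q :- p) := q) refl

≤ᵈ : ∀ {p q} → 0ℚ ℚ.≤ q ℚ.- p → p ℚ.≤ q
≤ᵈ {p} {q} h = subst₂ ℚ._≤_ (ℚₚ.+-identityʳ p) (p+d p q) (ℚₚ.+-monoʳ-≤ p h)

<ᵈ : ∀ {p q} → 0ℚ ℚ.< q ℚ.- p → p ℚ.< q
<ᵈ {p} {q} h = subst₂ ℚ._<_ (ℚₚ.+-identityʳ p) (p+d p q) (ℚₚ.+-monoʳ-< p h)

-- p ≤ q because q - p equals the nonnegative number r (likewise for <)
≤-by : ∀ {p q r} → 0ℚ ℚ.≤ r → r ≡ q ℚ.- p → p ℚ.≤ q
≤-by h e = ≤ᵈ (subst (0ℚ ℚ.≤_) e h)

<-by : ∀ {p q r} → 0ℚ ℚ.< r → r ≡ q ℚ.- p → p ℚ.< q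
<-by h e = <ᵈ (subst (0ℚ ℚ.<_) e h)

0≤+ : ∀ {p q} → 0ℚ ℚ.≤ p → 0ℚ ℚ.≤ q → 0ℚ ℚ.≤ p ℚ.+ q
0≤+ = ℚₚ.+-mono-≤

0<+ : ∀ {p q} → 0ℚ ℚ.< p → 0ℚ ℚ.≤ q → 0ℚ ℚ.< p ℚ.+ q
0<+ = ℚₚ.+-mono-<-≤

0≤* : ∀ {p q} → 0ℚ ℚ.≤ p → 0ℚ ℚ.≤ q → 0ℚ ℚ.≤ p ℚ.* q
0≤* {p} {q} h k = subst (ℚ._≤ p ℚ.* q) (ℚₚ.*-zeroʳ p)
  (ℚₚ.*-monoˡ-≤-nonNeg p {{ℚ.nonNegative h}} k)

0<* : ∀ {p q} → 0ℚ ℚ.< p → 0ℚ ℚ.< q → 0ℚ ℚ.< p ℚ.* q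
0<* {p} {q} h k = subst (ℚ._< p ℚ.* q) (ℚₚ.*-zeroʳ p)
  (ℚₚ.*-monoʳ-<-pos p {{ℚ.positive h}} k)

0≤² : ∀ p → 0ℚ ℚ.≤ p ℚ.* p
0≤² p with ℚₚ.≤-total 0ℚ p
... | inj₁ 0≤p = 0≤* 0≤p 0≤p
... | inj₂ p≤0 = subst (0ℚ ℚ.≤_)
  (solve 1 (λ p → (:- p) :* (:- p) := p :* p) refl p)
  (0≤* (ℚₚ.neg-antimono-≤ p≤0) (ℚₚ.neg-antimono-≤ p≤0))

0<½* : ∀ {ε} → 0ℚ ℚ.< ε → 0ℚ ℚ.< ½ ℚ.* ε
0<½* = 0<* 0<½

half : ∀ ε → ½ ℚ.* ε ℚ.+ ½ ℚ.* ε ≡ ε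
half = solve 1 (λ e → con ½ :* e :+ con ½ :* e := e) refl

½*≤ : ∀ {ε} → 0ℚ ℚ.≤ ε → ½ ℚ.* ε ℚ.≤ ε
½*≤ {ε} h = ≤-by (0≤* (ℚₚ.<⇒≤ 0<½) h)
  (solve 1 (λ e → con ½ :* e := e :- con ½ :* e) refl ε)

p≤∣p∣ : ∀ p → p ℚ.≤ ℚ.∣ p ∣
p≤∣p∣ p with ℚₚ.≤-total 0ℚ p
... | inj₁ 0≤p = ℚₚ.≤-reflexive (sym (ℚₚ.0≤p⇒∣p∣≡p 0≤p))
... | inj₂ p≤0 = ℚₚ.≤-trans p≤0 (ℚₚ.0≤∣p∣ p)

∣∣<-intro : ∀ {p r} → p ℚ.< r → ℚ.- p ℚ.< r → ℚ.∣ p ∣ ℚ.< r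
∣∣<-intro {p} {r} h k with ℚₚ.∣p∣≡p∨∣p∣≡-p p
... | inj₁ e = subst (ℚ._< r) (sym e) h
... | inj₂ e = subst (ℚ._< r) (sym e) k

∣-∣-comm : ∀ p q → ℚ.∣ p ℚ.- q ∣ ≡ ℚ.∣ q ℚ.- p ∣
∣-∣-comm p q = trans (sym (ℚₚ.∣-p∣≡∣p∣ (p ℚ.- q)))
  (cong ℚ.∣_∣ (solve 2 (λ p q → :- (p :- q) := q :- p) refl p q))

------------------------------------------------------------------------
-- 2⁻ⁿ → 0

halve : ℕ → ℚ → ℚ
halve zero    p = p
halve (suc n) p = ½ ℚ.* halve n p

fromℕ : ℕ → ℚ
fromℕ zero    = 0ℚ
fromℕ (suc n) = 1ℚ ℚ.+ fromℕ n

0≤fromℕ : ∀ n → 0ℚ ℚ.≤ fromℕ n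
0≤fromℕ zero    = ℚₚ.≤-refl
0≤fromℕ (suc n) = 0≤+ (ℚₚ.<⇒≤ 0<1) (0≤fromℕ n)

fromℕ-mono : ∀ {m n} → m ℕ.≤ n → fromℕ m ℚ.≤ fromℕ n
fromℕ-mono {n = n} ℕ.z≤n = 0≤fromℕ n
fromℕ-mono (ℕ.s≤s h)     = ℚₚ.+-monoʳ-≤ 1ℚ (fromℕ-mono h)

0≤halve : ∀ n {p} → 0ℚ ℚ.≤ p → 0ℚ ℚ.≤ halve n p
0≤halve zero    h = h
0≤halve (suc n) h = 0≤* (ℚₚ.<⇒≤ 0<½) (0≤halve n h)

halve-fromℕ : ∀ n p → 0ℚ ℚ.≤ p → fromℕ n ℚ.* halve n p ℚ.≤ p
halve-fromℕ n p 0≤p = ℚₚ.≤-trans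
  (≤-by (0≤halve n 0≤p) (solve 2 (λ f h → h := (con 1ℚ :+ f) :* h :- f :* h) refl (fromℕ n) (halve n p)))
  (go n)
  where
  go : ∀ n → (1ℚ ℚ.+ fromℕ n) ℚ.* halve n p ℚ.≤ p
  go zero    = ℚₚ.≤-reflexive (solve 1 (λ p → (con 1ℚ :+ con 0ℚ) :* p := p) refl p)
  go (suc n) = ℚₚ.≤-trans
    (≤-by (0≤* (0≤* (ℚₚ.<⇒≤ 0<½) (0≤fromℕ n)) (0≤halve n 0≤p))
      (solve 2 (λ f h → con ½ :* f :* h :=
          (con 1ℚ :+ f) :* h :- (con 1ℚ :+ (con 1ℚ :+ f)) :* (con ½ :* h)) refl
        (fromℕ n) (halve n p)))
    (go n)

p<fromℕ : ∀ p → ∃[ n ] p ℚ.< fromℕ n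
p<fromℕ p@(mkℚ -[1+ _ ] _ _) = 0 , ℚₚ.negative⁻¹ p
p<fromℕ p@(mkℚ (+ n) d c) = suc n , ℚₚ.≤-<-trans p≤n n<1+n
  where
  int : ℕ → ℚ
  int n = mkℚ (+ n) 0 (Coprime.sym (1-coprimeTo n))

  fromℕ≡int : ∀ n → fromℕ n ≡ int n
  fromℕ≡int zero    = refl
  fromℕ≡int (suc n) = trans (cong (1ℚ ℚ.+_) (fromℕ≡int n))
    (trans (cong (λ i → (+ 1 ℤ.+ i) ℚ./ 1) (ℤₚ.*-identityʳ (+ n)))
           (ℚₚ.↥p/↧p≡p (int (suc n))))

  p≤n : p ℚ.≤ fromℕ n
  p≤n = subst (p ℚ.≤_) (sym (fromℕ≡int n))
    (ℚ.*≤* (ℤₚ.*-monoˡ-≤-nonNeg (+ n) (ℤ.+≤+ (ℕ.s≤s ℕ.z≤n))))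

  n<1+n : fromℕ n ℚ.< 1ℚ ℚ.+ fromℕ n
  n<1+n = <-by 0<1 (solve 1 (λ f → con 1ℚ := con 1ℚ :+ f :- f) refl (fromℕ n))

halve-small : ∀ B ε → 0ℚ ℚ.≤ B → 0ℚ ℚ.< ε → ∃[ N ] (∀ n → N ℕ.≤ n → halve n B ℚ.< ε)
halve-small B ε 0≤B 0<ε = N , λ n N≤n →
  ℚₚ.*-cancelˡ-<-nonNeg (fromℕ n) {{ℚ.nonNegative (0≤fromℕ n)}}
    (ℚₚ.≤-<-trans (halve-fromℕ n B 0≤B)
      (ℚₚ.<-≤-trans B<Nε (ℚₚ.*-monoʳ-≤-nonNeg ε {{ℚ.nonNegative (ℚₚ.<⇒≤ 0<ε)}} (fromℕ-mono N≤n))))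
  where
  instance
    ε>0 : ℚ.Positive ε
    ε>0 = ℚ.positive 0<ε
    ε≢0 : ℚ.NonZero ε
    ε≢0 = ℚₚ.pos⇒nonZero ε
  N = proj₁ (p<fromℕ (B ℚ.* ℚ.1/ ε))
  B<Nε : B ℚ.< fromℕ N ℚ.* ε
  B<Nε = subst (ℚ._< fromℕ N ℚ.* ε)
    (trans (ℚₚ.*-assoc B (ℚ.1/ ε) ε)
      (trans (cong (B ℚ.*_) (ℚₚ.*-inverseˡ ε)) (ℚₚ.*-identityʳ B)))
    (ℚₚ.*-monoˡ-<-pos ε (proj₂ (p<fromℕ (B ℚ.* ℚ.1/ ε))))

------------------------------------------------------------------------
-- Real numbers

Eventually : (ℕ → Set) → Set
Eventually P = ∃[ N ] (∀ n → N ℕ.≤ n → P n)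

both : ∀ {P Q R : ℕ → Set} → (∀ n → P n → Q n → R n) →
       Eventually P → Eventually Q → Eventually R
both f (M , h) (N , k) = M ℕ.⊔ N , λ n le →
  f n (h n (ℕₚ.m⊔n≤o⇒m≤o M N le)) (k n (ℕₚ.m⊔n≤o⇒n≤o M N le))

always : ∀ {P : ℕ → Set} → (∀ n → P n) → Eventually P
always h = 0 , λ n _ → h n

Cauchy : (ℕ → ℚ) → Set
Cauchy f = ∀ ε → 0ℚ ℚ.< ε →
  ∃[ N ] (∀ m n → N ℕ.≤ m → N ℕ.≤ n → ℚ.∣ f m ℚ.- f n ∣ ℚ.< ε)

-- Cauchy sequences, not classes of them: reals are compared with _≃ᵣ_, never with _≡_.
record ℝ : Set where
  constructor mkℝ
  field
    seq    : ℕ → ℚ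
    cauchy : Cauchy seq
open ℝ public

infix 4 _≃ᵣ_ _<ᵣ_

_≃ᵣ_ : ℝ → ℝ → Set
x ≃ᵣ y = ∀ ε → 0ℚ ℚ.< ε → Eventually λ n → ℚ.∣ seq x n ℚ.- seq y n ∣ ℚ.< ε

_<ᵣ_ : ℝ → ℝ → Set
x <ᵣ y = ∃[ δ ] (0ℚ ℚ.< δ × Eventually λ n → seq x n ℚ.+ δ ℚ.≤ seq y n)

abstract
  const-cauchy : ∀ p → Cauchy (λ _ → p)
  const-cauchy p ε 0<ε = 0 , λ _ _ _ _ → subst (ℚ._< ε) (sym (cong ℚ.∣_∣ (ℚₚ.+-inverseʳ p))) 0<ε

  +-cauchy : ∀ {f g} → Cauchy f → Cauchy g → Cauchy (λ n → f n ℚ.+ g n)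
  +-cauchy {f} {g} F G ε 0<ε with F (½ ℚ.* ε) (0<½* 0<ε) | G (½ ℚ.* ε) (0<½* 0<ε)
  ... | M , h | N , k = M ℕ.⊔ N , λ m n hm hn → ℚₚ.≤-<-trans
    (subst (λ t → ℚ.∣ t ∣ ℚ.≤ ℚ.∣ f m ℚ.- f n ∣ ℚ.+ ℚ.∣ g m ℚ.- g n ∣)
      (solve 4 (λ a b c d → (a :- b) :+ (c :- d) := (a :+ c) :- (b :+ d)) refl (f m) (f n) (g m) (g n))
      (ℚₚ.∣p+q∣≤∣p∣+∣q∣ (f m ℚ.- f n) (g m ℚ.- g n)))
    (subst (ℚ.∣ f m ℚ.- f n ∣ ℚ.+ ℚ.∣ g m ℚ.- g n ∣ ℚ.<_) (half ε)
      (ℚₚ.+-mono-< (h m n (ℕₚ.m⊔n≤o⇒m≤o M N hm) (ℕₚ.m⊔n≤o⇒m≤o M N hn))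
                   (k m n (ℕₚ.m⊔n≤o⇒n≤o M N hm) (ℕₚ.m⊔n≤o⇒n≤o M N hn))))

  neg-cauchy : ∀ {f} → Cauchy f → Cauchy (λ n → ℚ.- f n)
  neg-cauchy {f} F ε 0<ε with F ε 0<ε
  ... | N , h = N , λ m n hm hn → subst (λ t → ℚ.∣ t ∣ ℚ.< ε)
    (solve 2 (λ a b → a :- b := :- b :- :- a) refl (f n) (f m)) (h n m hn hm)

  -- an eventual bound on a Cauchy sequence
  bounded : ∀ {f} → Cauchy f → ∃[ B ] (0ℚ ℚ.< B × Eventually λ n → ℚ.∣ f n ∣ ℚ.≤ B)
  bounded {f} F with F 1ℚ 0<1
  ... | N , h = 1ℚ ℚ.+ ℚ.∣ f N ∣ , 0<+ 0<1 (ℚₚ.0≤∣p∣ (f N)) , N , λ n hn →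
    subst (λ t → ℚ.∣ t ∣ ℚ.≤ 1ℚ ℚ.+ ℚ.∣ f N ∣)
      (solve 2 (λ a b → (a :- b) :+ b := a) refl (f n) (f N))
      (ℚₚ.≤-trans (ℚₚ.∣p+q∣≤∣p∣+∣q∣ (f n ℚ.- f N) (f N))
        (ℚₚ.+-monoˡ-≤ ℚ.∣ f N ∣ (ℚₚ.<⇒≤ (h n N hn ℕₚ.≤-refl))))

  *-mono-∣∣ : ∀ {a b c d} → ℚ.∣ a ∣ ℚ.≤ b → ℚ.∣ c ∣ ℚ.≤ d → ℚ.∣ a ℚ.* c ∣ ℚ.≤ b ℚ.* d
  *-mono-∣∣ {a} {b} {c} {d} h k = subst (ℚ._≤ b ℚ.* d) (sym (ℚₚ.∣p*q∣≡∣p∣*∣q∣ a c))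
    (ℚₚ.≤-trans
      (ℚₚ.*-monoʳ-≤-nonNeg ℚ.∣ c ∣ {{ℚₚ.∣-∣-nonNeg c}} h)
      (ℚₚ.*-monoˡ-≤-nonNeg b {{ℚ.nonNegative (ℚₚ.≤-trans (ℚₚ.0≤∣p∣ a) h)}} k))

  -- η with B * η = ε
  divide : ∀ {B ε} → 0ℚ ℚ.< B → 0ℚ ℚ.< ε → ∃[ η ] (0ℚ ℚ.< η × B ℚ.* η ≡ ε)
  divide {B} {ε} 0<B 0<ε = ℚ.1/ B ℚ.* ε ,
    0<* (ℚₚ.positive⁻¹ (ℚ.1/ B) {{ℚₚ.1/pos⇒pos B}}) 0<ε ,
    trans (sym (ℚₚ.*-assoc B (ℚ.1/ B) ε))
      (trans (cong (ℚ._* ε) (ℚₚ.*-inverseʳ B)) (ℚₚ.*-identityˡ ε))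
    where
    instance
      B>0 : ℚ.Positive B
      B>0 = ℚ.positive 0<B
      B≢0 : ℚ.NonZero B
      B≢0 = ℚₚ.pos⇒nonZero B

  *-step : ∀ a b c d {B C ε η θ} → ℚ.∣ a ∣ ℚ.≤ B → ℚ.∣ d ∣ ℚ.≤ C → 0ℚ ℚ.< B → 0ℚ ℚ.< C →
    B ℚ.* η ≡ ½ ℚ.* ε → C ℚ.* θ ≡ ½ ℚ.* ε →
    ℚ.∣ a ℚ.- b ∣ ℚ.< θ → ℚ.∣ c ℚ.- d ∣ ℚ.< η →
    ℚ.∣ a ℚ.* c ℚ.- b ℚ.* d ∣ ℚ.< ε
  *-step a b c d {B} {C} {ε} {η} {θ} aB dC 0<B 0<C Bη Cθ h k = begin-strict
    ℚ.∣ a ℚ.* c ℚ.- b ℚ.* d ∣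
      ≡⟨ cong ℚ.∣_∣ (split a b c d) ⟩
    ℚ.∣ a ℚ.* (c ℚ.- d) ℚ.+ d ℚ.* (a ℚ.- b) ∣
      ≤⟨ ℚₚ.∣p+q∣≤∣p∣+∣q∣ (a ℚ.* (c ℚ.- d)) (d ℚ.* (a ℚ.- b)) ⟩
    ℚ.∣ a ℚ.* (c ℚ.- d) ∣ ℚ.+ ℚ.∣ d ℚ.* (a ℚ.- b) ∣
      ≤⟨ ℚₚ.+-mono-≤ (*-mono-∣∣ {a} {B} {c ℚ.- d} aB ℚₚ.≤-refl)
                     (*-mono-∣∣ {d} {C} {a ℚ.- b} dC ℚₚ.≤-refl) ⟩
    B ℚ.* ℚ.∣ c ℚ.- d ∣ ℚ.+ C ℚ.* ℚ.∣ a ℚ.- b ∣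
      <⟨ ℚₚ.+-mono-< (ℚₚ.*-monoʳ-<-pos B {{ℚ.positive 0<B}} k)
                     (ℚₚ.*-monoʳ-<-pos C {{ℚ.positive 0<C}} h) ⟩
    B ℚ.* η ℚ.+ C ℚ.* θ      ≡⟨ cong₂ ℚ._+_ Bη Cθ ⟩
    ½ ℚ.* ε ℚ.+ ½ ℚ.* ε      ≡⟨ half ε ⟩
    ε                        ∎
    where
    open ℚₚ.≤-Reasoning
    split : ∀ a b c d → a ℚ.* c ℚ.- b ℚ.* d ≡ a ℚ.* (c ℚ.- d) ℚ.+ d ℚ.* (a ℚ.- b)
    split = solve 4 (λ a b c d → a :* c :- b :* d := a :* (c :- d) :+ d :* (a :- b)) refl

  *-cauchy : ∀ {f g} → Cauchy f → Cauchy g → Cauchy (λ n → f n ℚ.* g n)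
  *-cauchy {f} {g} F G ε 0<ε =
    let B , 0<B , M , fB = bounded F
        C , 0<C , N , gC = bounded G
        η , 0<η , Bη     = divide 0<B (0<½* 0<ε)
        θ , 0<θ , Cθ     = divide 0<C (0<½* 0<ε)
        M′ , h           = F θ 0<θ
        N′ , k           = G η 0<η
        Z                = (M ℕ.⊔ N) ℕ.⊔ (M′ ℕ.⊔ N′)
        M⊔N≤  = λ {m} (hm : Z ℕ.≤ m) → ℕₚ.m⊔n≤o⇒m≤o (M ℕ.⊔ N) (M′ ℕ.⊔ N′) hm
        M′⊔N′≤ = λ {m} (hm : Z ℕ.≤ m) → ℕₚ.m⊔n≤o⇒n≤o (M ℕ.⊔ N) (M′ ℕ.⊔ N′) hm
    in Z , λ m n hm hn →
      *-step (f m) (f n) (g m) (g n)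
        (fB m (ℕₚ.m⊔n≤o⇒m≤o M N (M⊔N≤ hm))) (gC n (ℕₚ.m⊔n≤o⇒n≤o M N (M⊔N≤ hn)))
        0<B 0<C Bη Cθ
        (h m n (ℕₚ.m⊔n≤o⇒m≤o M′ N′ (M′⊔N′≤ hm)) (ℕₚ.m⊔n≤o⇒m≤o M′ N′ (M′⊔N′≤ hn)))
        (k m n (ℕₚ.m⊔n≤o⇒n≤o M′ N′ (M′⊔N′≤ hm)) (ℕₚ.m⊔n≤o⇒n≤o M′ N′ (M′⊔N′≤ hn)))

0ᵣ 1ᵣ : ℝ
0ᵣ = mkℝ (λ _ → 0ℚ) (const-cauchy 0ℚ)
1ᵣ = mkℝ (λ _ → 1ℚ) (const-cauchy 1ℚ)

infixl 6 _+ᵣ_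
infixl 7 _*ᵣ_
infix  8 -ᵣ_

_+ᵣ_ _*ᵣ_ : ℝ → ℝ → ℝ
x +ᵣ y = mkℝ (λ n → seq x n ℚ.+ seq y n) (+-cauchy {seq x} {seq y} (cauchy x) (cauchy y))
x *ᵣ y = mkℝ (λ n → seq x n ℚ.* seq y n) (*-cauchy {seq x} {seq y} (cauchy x) (cauchy y))

-ᵣ_ : ℝ → ℝ
-ᵣ x = mkℝ (λ n → ℚ.- seq x n) (neg-cauchy {seq x} (cauchy x))

-- The value at 0 is irrelevant: a sequence with positive limit is eventually positive.
recip : ℚ → ℚ
recip p with p ℚₚ.≟ 0ℚ
... | yes _  = 0ℚ
... | no p≢0 = ℚ.1/_ p {{ℚ.≢-nonZero p≢0}}

abstract
  recip-inverse : ∀ p → 0ℚ ℚ.< p → p ℚ.* recip p ≡ 1ℚ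
  recip-inverse p 0<p with p ℚₚ.≟ 0ℚ
  ... | yes p≡0 = contradiction (sym p≡0) (ℚₚ.<⇒≢ 0<p)
  ... | no p≢0  = ℚₚ.*-inverseʳ p {{ℚ.≢-nonZero p≢0}}

  recip-pos : ∀ p → 0ℚ ℚ.< p → 0ℚ ℚ.< recip p
  recip-pos p 0<p with p ℚₚ.≟ 0ℚ
  ... | yes p≡0 = contradiction (sym p≡0) (ℚₚ.<⇒≢ 0<p)
  ... | no p≢0  = ℚₚ.positive⁻¹ (ℚ.1/_ p {{ℚ.≢-nonZero p≢0}})
                    {{ℚₚ.1/pos⇒pos p {{ℚ.positive 0<p}}}}

  recip-∣∣ : ∀ {δ p} → 0ℚ ℚ.< δ → δ ℚ.≤ p → ℚ.∣ recip p ∣ ℚ.≤ recip δ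
  recip-∣∣ {δ} {p} 0<δ δ≤p = subst (ℚ._≤ recip δ) (sym (ℚₚ.0≤p⇒∣p∣≡p (ℚₚ.<⇒≤ 0<rp)))
    (≤-by (0≤* (0≤ᵈ δ≤p) (0≤* (ℚₚ.<⇒≤ 0<rp) (ℚₚ.<⇒≤ (recip-pos δ 0<δ)))) diff)
    where
    0<p : 0ℚ ℚ.< p
    0<p = ℚₚ.<-≤-trans 0<δ δ≤p
    0<rp : 0ℚ ℚ.< recip p
    0<rp = recip-pos p 0<p
    ring : ∀ p d r s → (p ℚ.- d) ℚ.* (r ℚ.* s) ≡ (p ℚ.* r) ℚ.* s ℚ.- (d ℚ.* s) ℚ.* r
    ring = solve 4 (λ p d r s → (p :- d) :* (r :* s) := (p :* r) :* s :- (d :* s) :* r) refl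

    diff : (p ℚ.- δ) ℚ.* (recip p ℚ.* recip δ) ≡ recip δ ℚ.- recip p
    diff = trans (ring p δ (recip p) (recip δ))
      (trans (cong₂ (λ u v → u ℚ.* recip δ ℚ.- v ℚ.* recip p)
               (recip-inverse p 0<p) (recip-inverse δ 0<δ))
        (cong₂ ℚ._-_ (ℚₚ.*-identityˡ (recip δ)) (ℚₚ.*-identityˡ (recip p))))

  recip-step : ∀ a b {δ η ε} → 0ℚ ℚ.< δ → δ ℚ.≤ a → δ ℚ.≤ b →
    (recip δ ℚ.* recip δ) ℚ.* η ≡ ε → ℚ.∣ a ℚ.- b ∣ ℚ.< η →
    ℚ.∣ recip a ℚ.- recip b ∣ ℚ.< ε
  recip-step a b {δ} {η} {ε} 0<δ δ≤a δ≤b eq h = begin-strict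
    ℚ.∣ recip a ℚ.- recip b ∣
      ≡⟨ cong ℚ.∣_∣ diff ⟩
    ℚ.∣ (recip a ℚ.* recip b) ℚ.* (b ℚ.- a) ∣
      ≤⟨ *-mono-∣∣ {recip a ℚ.* recip b} {recip δ ℚ.* recip δ} {b ℚ.- a}
           (*-mono-∣∣ {recip a} {recip δ} {recip b} (recip-∣∣ 0<δ δ≤a) (recip-∣∣ 0<δ δ≤b))
           (ℚₚ.≤-reflexive (∣-∣-comm b a)) ⟩
    (recip δ ℚ.* recip δ) ℚ.* ℚ.∣ a ℚ.- b ∣
      <⟨ ℚₚ.*-monoʳ-<-pos (recip δ ℚ.* recip δ)
           {{ℚ.positive (0<* (recip-pos δ 0<δ) (recip-pos δ 0<δ))}} h ⟩
    (recip δ ℚ.* recip δ) ℚ.* η   ≡⟨ eq ⟩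
    ε                             ∎
    where
    open ℚₚ.≤-Reasoning
    ring : ∀ a b r s → (r ℚ.* s) ℚ.* (b ℚ.- a) ≡ (b ℚ.* s) ℚ.* r ℚ.- (a ℚ.* r) ℚ.* s
    ring = solve 4 (λ a b r s → (r :* s) :* (b :- a) := (b :* s) :* r :- (a :* r) :* s) refl

    diff : recip a ℚ.- recip b ≡ (recip a ℚ.* recip b) ℚ.* (b ℚ.- a)
    diff = sym (trans (ring a b (recip a) (recip b))
      (trans (cong₂ (λ u v → u ℚ.* recip a ℚ.- v ℚ.* recip b)
               (recip-inverse b (ℚₚ.<-≤-trans 0<δ δ≤b)) (recip-inverse a (ℚₚ.<-≤-trans 0<δ δ≤a)))
        (cong₂ ℚ._-_ (ℚₚ.*-identityˡ (recip a)) (ℚₚ.*-identityˡ (recip b)))))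

  recip-cauchy : ∀ x → 0ᵣ <ᵣ x → Cauchy (λ n → recip (seq x n))
  recip-cauchy x (δ , 0<δ , M , δ≤) ε 0<ε =
    let η , 0<η , eq = divide (0<* (recip-pos δ 0<δ) (recip-pos δ 0<δ)) 0<ε
        N , h        = cauchy x η 0<η
        δ≤x = λ n hn → subst (ℚ._≤ seq x n) (ℚₚ.+-identityˡ δ) (δ≤ n (ℕₚ.m⊔n≤o⇒m≤o M N hn))
    in M ℕ.⊔ N , λ m n hm hn →
      recip-step (seq x m) (seq x n) 0<δ (δ≤x m hm) (δ≤x n hn) eq
        (h m n (ℕₚ.m⊔n≤o⇒n≤o M N hm) (ℕₚ.m⊔n≤o⇒n≤o M N hn))

invᵣ : (x : ℝ) → 0ᵣ <ᵣ x → ℝ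
invᵣ x 0<x = mkℝ (λ n → recip (seq x n)) (recip-cauchy x 0<x)

------------------------------------------------------------------------
-- Square roots, by bisection

-- √ p lies between lower n p and lower n p + halve n (1 + p), for p ≥ 0.
lower : ℕ → ℚ → ℚ
bisect : (l m : ℚ) {P : Set} → Dec P → ℚ
lower zero    p = 0ℚ
lower (suc n) p = bisect l m (m ℚ.* m ℚₚ.≤? p)
  where
  l = lower n p
  m = l ℚ.+ halve (suc n) (1ℚ ℚ.+ p)
bisect l m (yes _) = m
bisect l m (no _)  = l

abstract
  halve-mono : ∀ n {p q} → p ℚ.≤ q → halve n p ℚ.≤ halve n q
  halve-mono zero    h = h
  halve-mono (suc n) h = ℚₚ.*-monoˡ-≤-nonNeg ½ (halve-mono n h)

  sq-mono : ∀ {p q} → 0ℚ ℚ.≤ p → p ℚ.≤ q → p ℚ.* p ℚ.≤ q ℚ.* q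
  sq-mono {p} {q} 0≤p p≤q = ≤-by (0≤* (0≤ᵈ p≤q) (0≤+ 0≤p (ℚₚ.≤-trans 0≤p p≤q))) (ring p q)
    where
    ring : ∀ p q → (q ℚ.- p) ℚ.* (p ℚ.+ q) ≡ q ℚ.* q ℚ.- p ℚ.* p
    ring = solve 2 (λ p q → (q :- p) :* (p :+ q) := q :* q :- p :* p) refl

  record Bracket (p l d : ℚ) : Set where
    field
      nonneg : 0ℚ ℚ.≤ l
      below  : l ℚ.* l ℚ.≤ p
      above  : p ℚ.< (l ℚ.+ d) ℚ.* (l ℚ.+ d)

  bracket : ∀ n {p} → 0ℚ ℚ.≤ p → Bracket p (lower n p) (halve n (1ℚ ℚ.+ p))
  bracket zero {p} 0≤p = record
    { nonneg = ℚₚ.≤-refl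
    ; below  = subst (ℚ._≤ p) (sym (ℚₚ.*-zeroˡ 0ℚ)) 0≤p
    ; above  = <-by (0<+ 0<1 (0≤+ 0≤p (0≤² p))) (ring p) }
    where
    ring : ∀ p → 1ℚ ℚ.+ (p ℚ.+ p ℚ.* p) ≡ (0ℚ ℚ.+ (1ℚ ℚ.+ p)) ℚ.* (0ℚ ℚ.+ (1ℚ ℚ.+ p)) ℚ.- p
    ring = solve 1 (λ p → con 1ℚ :+ (p :+ p :* p) :=
      (con 0ℚ :+ (con 1ℚ :+ p)) :* (con 0ℚ :+ (con 1ℚ :+ p)) :- p) refl
  bracket (suc n) {p} 0≤p = step (m ℚ.* m ℚₚ.≤? p)
    where
    l d m : ℚ
    l = lower n p
    d = halve n (1ℚ ℚ.+ p)
    m = l ℚ.+ ½ ℚ.* d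
    open Bracket (bracket n 0≤p)
    0≤½d : 0ℚ ℚ.≤ ½ ℚ.* d
    0≤½d = 0≤halve (suc n) (0≤+ (ℚₚ.<⇒≤ 0<1) 0≤p)
    ring : ∀ l d → l ℚ.+ d ≡ l ℚ.+ ½ ℚ.* d ℚ.+ ½ ℚ.* d
    ring = solve 2 (λ l d → l :+ d := l :+ con ½ :* d :+ con ½ :* d) refl

    step : (b : Dec (m ℚ.* m ℚ.≤ p)) → Bracket p (bisect l m b) (½ ℚ.* d)
    step (yes m²≤p) = record
      { nonneg = 0≤+ nonneg 0≤½d
      ; below  = m²≤p
      ; above  = subst (λ h → p ℚ.< h ℚ.* h) (ring l d) above }
    step (no m²≰p)  = record { nonneg = nonneg ; below = below ; above = ℚₚ.≰⇒> m²≰p }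

  root-step : ∀ {p p′ s t e ε} → s ℚ.* s ℚ.≤ p → p′ ℚ.< (t ℚ.+ e) ℚ.* (t ℚ.+ e) →
    0ℚ ℚ.≤ t → 0ℚ ℚ.≤ e → 0ℚ ℚ.< ε → e ℚ.< ½ ℚ.* ε →
    ℚ.∣ p ℚ.- p′ ∣ ℚ.< (½ ℚ.* ε) ℚ.* (½ ℚ.* ε) → s ℚ.- t ℚ.< ε
  root-step {p} {p′} {s} {t} {e} {ε} s²≤p p′<u² 0≤t 0≤e 0<ε e<η h = ℚₚ.≰⇒> λ ε≤s-t →
    ℚₚ.<-irrefl refl (begin-strict
      p                                        ≡⟨ sym (p+d p′ p) ⟩
      p′ ℚ.+ (p ℚ.- p′)                        ≤⟨ ℚₚ.+-monoʳ-≤ p′ (p≤∣p∣ (p ℚ.- p′)) ⟩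
      p′ ℚ.+ ℚ.∣ p ℚ.- p′ ∣                    <⟨ ℚₚ.+-mono-< p′<u² h ⟩
      u ℚ.* u ℚ.+ η ℚ.* η                      ≤⟨ ≤-by (0≤+ (0≤* 0≤u 0≤η) (0≤* 0≤u 0≤η)) (ring₁ u η) ⟩
      (u ℚ.+ η) ℚ.* (u ℚ.+ η)                  ≤⟨ sq-mono (0≤+ 0≤u 0≤η) (u+η≤s ε≤s-t) ⟩
      s ℚ.* s                                  ≤⟨ s²≤p ⟩
      p                                        ∎)
    where
    open ℚₚ.≤-Reasoning
    η u : ℚ
    η = ½ ℚ.* ε
    u = t ℚ.+ e
    0≤η : 0ℚ ℚ.≤ η
    0≤η = ℚₚ.<⇒≤ (0<½* 0<ε)
    0≤u : 0ℚ ℚ.≤ u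
    0≤u = 0≤+ 0≤t 0≤e
    ring₁ : ∀ u η → u ℚ.* η ℚ.+ u ℚ.* η ≡ (u ℚ.+ η) ℚ.* (u ℚ.+ η) ℚ.- (u ℚ.* u ℚ.+ η ℚ.* η)
    ring₁ = solve 2 (λ u η → u :* η :+ u :* η := (u :+ η) :* (u :+ η) :- (u :* u :+ η :* η)) refl
    ring₂ : ∀ s t e ε → ((s ℚ.- t) ℚ.- ε) ℚ.+ (½ ℚ.* ε ℚ.- e) ≡ s ℚ.- (t ℚ.+ e ℚ.+ ½ ℚ.* ε)
    ring₂ = solve 4 (λ s t e ε → ((s :- t) :- ε) :+ (con ½ :* ε :- e) :=
      s :- (t :+ e :+ con ½ :* ε)) refl
    u+η≤s : ε ℚ.≤ s ℚ.- t → u ℚ.+ η ℚ.≤ s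
    u+η≤s h = ≤-by (0≤+ (0≤ᵈ h) (0≤ᵈ (ℚₚ.<⇒≤ e<η))) (ring₂ s t e ε)

  -- the width of the bracket of a Cauchy sequence tends to 0
  width : ∀ (x : ℝ) → (∀ n → 0ℚ ℚ.≤ seq x n) → ∀ ε → 0ℚ ℚ.< ε →
    Eventually λ n → halve n (1ℚ ℚ.+ seq x n) ℚ.< ε
  width x 0≤x ε 0<ε =
    let B , 0<B , M , xB = bounded (cauchy x)
        N , h = halve-small (1ℚ ℚ.+ B) ε (ℚₚ.<⇒≤ (0<+ 0<1 (ℚₚ.<⇒≤ 0<B))) 0<ε
    in both (λ n x≤B hB → ℚₚ.≤-<-trans
          (halve-mono n (ℚₚ.+-monoʳ-≤ 1ℚ (ℚₚ.≤-trans (p≤∣p∣ (seq x n)) x≤B))) hB)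
        (M , xB) (N , h)

  lower-cauchy : ∀ x → (∀ n → 0ℚ ℚ.≤ seq x n) → Cauchy (λ n → lower n (seq x n))
  lower-cauchy x 0≤x ε 0<ε =
    let M , w = width x 0≤x (½ ℚ.* ε) (0<½* 0<ε)
        N , h = cauchy x ((½ ℚ.* ε) ℚ.* (½ ℚ.* ε)) (0<* (0<½* 0<ε) (0<½* 0<ε))
        close = λ m n (hm : M ℕ.⊔ N ℕ.≤ m) (hn : M ℕ.⊔ N ℕ.≤ n) →
          root-step {seq x m} {seq x n} {root m} {root n} {halve n (1ℚ ℚ.+ seq x n)} {ε}
            (Bracket.below (bracket m (0≤x m))) (Bracket.above (bracket n (0≤x n)))
            (Bracket.nonneg (bracket n (0≤x n)))
            (0≤halve n (0≤+ (ℚₚ.<⇒≤ 0<1) (0≤x n)))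
            0<ε (w n (ℕₚ.m⊔n≤o⇒m≤o M N hn))
            (h m n (ℕₚ.m⊔n≤o⇒n≤o M N hm) (ℕₚ.m⊔n≤o⇒n≤o M N hn))
    in M ℕ.⊔ N , λ m n hm hn → ∣∣<-intro {root m ℚ.- root n} {ε} (close m n hm hn)
      (subst (ℚ._< ε) (neg-diff (root n) (root m)) (close n m hn hm))
    where
    root : ℕ → ℚ
    root n = lower n (seq x n)
    neg-diff : ∀ a b → a ℚ.- b ≡ ℚ.- (b ℚ.- a)
    neg-diff = solve 2 (λ a b → a :- b := :- (b :- a)) refl

√ : (x : ℝ) → (∀ n → 0ℚ ℚ.≤ seq x n) → ℝ
√ x 0≤x = mkℝ (λ n → lower n (seq x n)) (lower-cauchy x 0≤x)

------------------------------------------------------------------------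
-- Complex numbers

infix 4 _≃_

record ℂ : Set where
  constructor _+i_
  field
    re im : ℝ
open ℂ public

_≃_ : ℂ → ℂ → Set
z ≃ w = re z ≃ᵣ re w × im z ≃ᵣ im w

infixl 6 _+_ _-_
infixl 7 _*_
infixr 8 _^_

0ℂ 1ℂ : ℂ
0ℂ = 0ᵣ +i 0ᵣ
1ℂ = 1ᵣ +i 0ᵣ

_+_ _-_ _*_ : ℂ → ℂ → ℂ
z + w = (re z +ᵣ re w) +i (im z +ᵣ im w)
z - w = (re z +ᵣ -ᵣ re w) +i (im z +ᵣ -ᵣ im w)
z * w = (re z *ᵣ re w +ᵣ -ᵣ (im z *ᵣ im w)) +i (re z *ᵣ im w +ᵣ im z *ᵣ re w)

_^_ : ℂ → ℕ → ℂ
z ^ zero  = 1ℂ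
z ^ suc n = z * z ^ n

normSq : ℂ → ℝ
normSq z = re z *ᵣ re z +ᵣ im z *ᵣ im z

0≤normSq : ∀ z n → 0ℚ ℚ.≤ seq (normSq z) n
0≤normSq z n = 0≤+ (0≤² (seq (re z) n)) (0≤² (seq (im z) n))

∣_∣ : ℂ → ℝ
∣ z ∣ = √ (normSq z) (0≤normSq z)

-- z ≠ 0, in the positive form that division requires
NonZero : ℂ → Set
NonZero z = 0ᵣ <ᵣ normSq z

infixl 7 _/_⟨_⟩

_/_⟨_⟩ : ℂ → (w : ℂ) → NonZero w → ℂ
z / w ⟨ w≢0 ⟩ = z * ((re w *ᵣ r) +i (-ᵣ im w *ᵣ r))
  where r = invᵣ (normSq w) w≢0

abstract
  1-nonZero : NonZero 1ℂ
  1-nonZero = 1ℚ , 0<1 , always λ _ → ℚₚ.≤-refl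

  normSq-* : ∀ z w n → seq (normSq (z * w)) n ≡ seq (normSq z) n ℚ.* seq (normSq w) n
  normSq-* z w n = ring (seq (re z) n) (seq (im z) n) (seq (re w) n) (seq (im w) n)
    where
    ring : ∀ a b c d →
      (a ℚ.* c ℚ.+ ℚ.- (b ℚ.* d)) ℚ.* (a ℚ.* c ℚ.+ ℚ.- (b ℚ.* d)) ℚ.+
      (a ℚ.* d ℚ.+ b ℚ.* c) ℚ.* (a ℚ.* d ℚ.+ b ℚ.* c) ≡
      (a ℚ.* a ℚ.+ b ℚ.* b) ℚ.* (c ℚ.* c ℚ.+ d ℚ.* d)
    ring = solve 4 (λ a b c d →
      (a :* c :+ :- (b :* d)) :* (a :* c :+ :- (b :* d)) :+
      (a :* d :+ b :* c) :* (a :* d :+ b :* c) :=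
      (a :* a :+ b :* b) :* (c :* c :+ d :* d)) refl

  *-nonZero : ∀ z w → NonZero z → NonZero w → NonZero (z * w)
  *-nonZero z w (δ , 0<δ , h) (η , 0<η , k) = δ ℚ.* η , 0<* 0<δ 0<η ,
    both {Q = λ n → 0ℚ ℚ.+ η ℚ.≤ seq (normSq w) n}
      (λ n hn kn → subst (0ℚ ℚ.+ δ ℚ.* η ℚ.≤_) (sym (normSq-* z w n))
        (mul (seq (normSq z) n) (seq (normSq w) n) hn kn)) h k
    where
    ring : ∀ p q → (p ℚ.- (0ℚ ℚ.+ δ)) ℚ.* q ℚ.+ δ ℚ.* (q ℚ.- (0ℚ ℚ.+ η)) ≡ p ℚ.* q ℚ.- (0ℚ ℚ.+ δ ℚ.* η)
    ring p q = solve 4 (λ p q d e → (p :- (con 0ℚ :+ d)) :* q :+ d :* (q :- (con 0ℚ :+ e)) :=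
      p :* q :- (con 0ℚ :+ d :* e)) refl p q δ η

    mul : ∀ p q → 0ℚ ℚ.+ δ ℚ.≤ p → 0ℚ ℚ.+ η ℚ.≤ q → 0ℚ ℚ.+ δ ℚ.* η ℚ.≤ p ℚ.* q
    mul p q hp hq = ≤-by
      (0≤+ (0≤* (0≤ᵈ hp) (ℚₚ.≤-trans (0≤+ ℚₚ.≤-refl (ℚₚ.<⇒≤ 0<η)) hq))
           (0≤* (ℚₚ.<⇒≤ 0<δ) (0≤ᵈ hq)))
      (ring p q)

  sq<1 : ∀ {p l d δ} → Bracket p l d → 0ℚ ℚ.≤ p → 0ℚ ℚ.< δ → l ℚ.+ δ ℚ.≤ 1ℚ → 0ℚ ℚ.≤ d → d ℚ.≤ ½ ℚ.* δ →
    p ℚ.+ ½ ℚ.* δ ℚ.≤ 1ℚ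
  sq<1 {p} {l} {d} {δ} br 0≤p 0<δ l+δ≤1 0≤d d≤η = begin
    p ℚ.+ η                  ≤⟨ ℚₚ.+-monoˡ-≤ η (ℚₚ.<⇒≤ above) ⟩
    u ℚ.* u ℚ.+ η            ≤⟨ ℚₚ.+-monoˡ-≤ η {u ℚ.* u} {u} (≤-by {u ℚ.* u} {u} (0≤* 0≤u (0≤ᵈ u≤1)) (ring₁ u)) ⟩
    u ℚ.+ η                  ≤⟨ u+η≤1 ⟩
    1ℚ                       ∎
    where
    open ℚₚ.≤-Reasoning
    open Bracket br
    u η : ℚ
    u = l ℚ.+ d
    η = ½ ℚ.* δ
    0≤u : 0ℚ ℚ.≤ u
    0≤u = 0≤+ nonneg 0≤d
    ring₁ : ∀ u → u ℚ.* (1ℚ ℚ.- u) ≡ u ℚ.- u ℚ.* u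
    ring₁ = solve 1 (λ u → u :* (con 1ℚ :- u) := u :- u :* u) refl
    ring₂ : ∀ l d δ → (1ℚ ℚ.- (l ℚ.+ δ)) ℚ.+ (½ ℚ.* δ ℚ.- d) ≡ 1ℚ ℚ.- (l ℚ.+ d ℚ.+ ½ ℚ.* δ)
    ring₂ = solve 3 (λ l d e → (con 1ℚ :- (l :+ e)) :+ (con ½ :* e :- d) :=
      con 1ℚ :- (l :+ d :+ con ½ :* e)) refl
    u+η≤1 : u ℚ.+ η ℚ.≤ 1ℚ
    u+η≤1 = ≤-by (0≤+ (0≤ᵈ l+δ≤1) (0≤ᵈ d≤η)) (ring₂ l d δ)
    u≤1 : u ℚ.≤ 1ℚ
    u≤1 = ℚₚ.≤-trans (≤-by (ℚₚ.<⇒≤ (0<½* 0<δ)) (ring₃ u η)) u+η≤1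
      where
      ring₃ : ∀ u η → η ≡ u ℚ.+ η ℚ.- u
      ring₃ = solve 2 (λ u η → η := u :+ η :- u) refl

  root<1 : ∀ {p l d δ} → Bracket p l d → 0ℚ ℚ.≤ p → 0ℚ ℚ.< δ → p ℚ.+ δ ℚ.≤ 1ℚ → l ℚ.+ ½ ℚ.* δ ℚ.≤ 1ℚ
  root<1 {p} {l} {d} {δ} br 0≤p 0<δ p+δ≤1 = ℚₚ.≮⇒≥ λ 1<l+η →
    ℚₚ.<-irrefl refl (begin-strict
      1ℚ ℚ.- δ                 <⟨ <-by (0<* (0<½* 0<δ) (0<½* 0<δ)) (ring₁ δ) ⟩
      v ℚ.* v                  ≤⟨ sq-mono 0≤v (v≤l 1<l+η) ⟩
      l ℚ.* l                  ≤⟨ below ⟩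
      p                        ≤⟨ ≤-by (0≤ᵈ p+δ≤1) (ring₂ p δ) ⟩
      1ℚ ℚ.- δ                 ∎)
    where
    open ℚₚ.≤-Reasoning
    open Bracket br
    v : ℚ
    v = 1ℚ ℚ.- ½ ℚ.* δ
    ring₁ : ∀ δ → (½ ℚ.* δ) ℚ.* (½ ℚ.* δ) ≡
      (1ℚ ℚ.- ½ ℚ.* δ) ℚ.* (1ℚ ℚ.- ½ ℚ.* δ) ℚ.- (1ℚ ℚ.- δ)
    ring₁ = solve 1 (λ e → (con ½ :* e) :* (con ½ :* e) :=
      (con 1ℚ :- con ½ :* e) :* (con 1ℚ :- con ½ :* e) :- (con 1ℚ :- e)) refl
    ring₂ : ∀ p δ → 1ℚ ℚ.- (p ℚ.+ δ) ≡ 1ℚ ℚ.- δ ℚ.- p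
    ring₂ = solve 2 (λ p e → con 1ℚ :- (p :+ e) := con 1ℚ :- e :- p) refl
    ring₃ : ∀ p δ → (1ℚ ℚ.- (p ℚ.+ δ)) ℚ.+ (p ℚ.+ ½ ℚ.* δ) ≡ 1ℚ ℚ.- ½ ℚ.* δ
    ring₃ = solve 2 (λ p e → (con 1ℚ :- (p :+ e)) :+ (p :+ con ½ :* e) := con 1ℚ :- con ½ :* e) refl
    ring₄ : ∀ l δ → l ℚ.+ ½ ℚ.* δ ℚ.- 1ℚ ≡ l ℚ.- (1ℚ ℚ.- ½ ℚ.* δ)
    ring₄ = solve 2 (λ l e → l :+ con ½ :* e :- con 1ℚ := l :- (con 1ℚ :- con ½ :* e)) refl
    0≤v : 0ℚ ℚ.≤ v
    0≤v = subst (0ℚ ℚ.≤_) (ring₃ p δ) (0≤+ (0≤ᵈ p+δ≤1) (0≤+ 0≤p (ℚₚ.<⇒≤ (0<½* 0<δ))))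
    v≤l : 1ℚ ℚ.< l ℚ.+ ½ ℚ.* δ → v ℚ.≤ l
    v≤l h = ≤-by (0≤ᵈ (ℚₚ.<⇒≤ h)) (ring₄ l δ)

  ∣∣<1⇒normSq<1 : ∀ z → ∣ z ∣ <ᵣ 1ᵣ → normSq z <ᵣ 1ᵣ
  ∣∣<1⇒normSq<1 z (δ , 0<δ , h) = ½ ℚ.* δ , 0<½* 0<δ ,
    both {Q = λ n → halve n (1ℚ ℚ.+ seq (normSq z) n) ℚ.< ½ ℚ.* δ}
      (λ n hn wn → sq<1 (bracket n (0≤normSq z n)) (0≤normSq z n) 0<δ hn
        (0≤halve n (0≤+ (ℚₚ.<⇒≤ 0<1) (0≤normSq z n))) (ℚₚ.<⇒≤ wn))
      h (width (normSq z) (0≤normSq z) (½ ℚ.* δ) (0<½* 0<δ))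

  normSq<1⇒∣∣<1 : ∀ z → normSq z <ᵣ 1ᵣ → ∣ z ∣ <ᵣ 1ᵣ
  normSq<1⇒∣∣<1 z (δ , 0<δ , N , h) = ½ ℚ.* δ , 0<½* 0<δ , N , λ n hn →
    root<1 (bracket n (0≤normSq z n)) (0≤normSq z n) 0<δ (h n hn)

  normSq-^*<1 : ∀ q c → normSq q <ᵣ 1ᵣ → normSq c <ᵣ 1ᵣ → ∀ k → normSq (q ^ k * c) <ᵣ 1ᵣ
  normSq-^*<1 q c (η , 0<η , k) (δ , 0<δ , h) j =
    δ , 0<δ , both {Q = λ n → seq (normSq c) n ℚ.+ δ ℚ.≤ 1ℚ}
      (λ n wn hn → subst (λ t → t ℚ.+ δ ℚ.≤ 1ℚ) (sym (normSq-* (q ^ j) c n))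
        (ℚₚ.≤-trans (ℚₚ.+-monoˡ-≤ δ (shrink (seq (normSq (q ^ j)) n) (seq (normSq c) n) wn (0≤normSq c n))) hn))
      (weak j) h
    where
    ring : ∀ p q → (1ℚ ℚ.- p) ℚ.* q ≡ q ℚ.- p ℚ.* q
    ring = solve 2 (λ p q → (con 1ℚ :- p) :* q := q :- p :* q) refl

    shrink : ∀ p q → p ℚ.≤ 1ℚ → 0ℚ ℚ.≤ q → p ℚ.* q ℚ.≤ q
    shrink p q hp hq = ≤-by (0≤* (0≤ᵈ hp) hq) (ring p q)

    below : ∀ p → p ℚ.+ η ℚ.≤ 1ℚ → p ℚ.≤ 1ℚ
    below p = ℚₚ.≤-trans
      (≤-by (ℚₚ.<⇒≤ 0<η) (solve 2 (λ p e → e := p :+ e :- p) refl p η))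

    weak : ∀ j → Eventually λ n → seq (normSq (q ^ j)) n ℚ.≤ 1ℚ
    weak zero    = always λ _ → ℚₚ.≤-refl
    weak (suc j) = both {Q = λ n → seq (normSq (q ^ j)) n ℚ.≤ 1ℚ}
      (λ n qn wn → subst (ℚ._≤ 1ℚ) (sym (normSq-* q (q ^ j) n))
        (ℚₚ.≤-trans (shrink (seq (normSq q) n) (seq (normSq (q ^ j)) n) (below (seq (normSq q) n) qn) (0≤normSq (q ^ j) n)) wn))
      k (weak j)

  ∣q^k*c∣<1 : ∀ q c → ∣ q ∣ <ᵣ 1ᵣ → ∣ c ∣ <ᵣ 1ᵣ → ∀ k → ∣ q ^ k * c ∣ <ᵣ 1ᵣ
  ∣q^k*c∣<1 q c h k n = normSq<1⇒∣∣<1 (q ^ n * c)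
    (normSq-^*<1 q c (∣∣<1⇒normSq<1 q h) (∣∣<1⇒normSq<1 c k) n)

  1-z-nonZero : ∀ z → ∣ z ∣ <ᵣ 1ᵣ → NonZero (1ℂ - z)
  1-z-nonZero z ∣z∣<1 =
    let δ , 0<δ , N , h = ∣∣<1⇒normSq<1 z ∣z∣<1
    in (½ ℚ.* δ) ℚ.* (½ ℚ.* δ) , 0<* (0<½* 0<δ) (0<½* 0<δ) , N , λ n hn →
      bound (seq (re z) n) (seq (im z) n) δ 0<δ (h n hn)
    where
    -- (1 - a)² + b² ≥ (δ/2)², because 2 (1 - a - δ/2) ≥ (1 - a)² + b² ≥ 0
    ring₁ : ∀ a b δ → ½ ℚ.* ((1ℚ ℚ.- a) ℚ.* (1ℚ ℚ.- a) ℚ.+ b ℚ.* b) ℚ.+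
        ½ ℚ.* (1ℚ ℚ.- (a ℚ.* a ℚ.+ b ℚ.* b ℚ.+ δ)) ≡ (1ℚ ℚ.- a) ℚ.- ½ ℚ.* δ
    ring₁ = solve 3 (λ a b e → con ½ :* ((con 1ℚ :- a) :* (con 1ℚ :- a) :+ b :* b) :+
        con ½ :* (con 1ℚ :- (a :* a :+ b :* b :+ e)) := (con 1ℚ :- a) :- con ½ :* e) refl

    ring₂ : ∀ p b s → (p ℚ.* p ℚ.- s) ℚ.+ (0ℚ ℚ.+ ℚ.- b) ℚ.* (0ℚ ℚ.+ ℚ.- b) ≡
      p ℚ.* p ℚ.+ (0ℚ ℚ.+ ℚ.- b) ℚ.* (0ℚ ℚ.+ ℚ.- b) ℚ.- (0ℚ ℚ.+ s)
    ring₂ = solve 3 (λ p b s → (p :* p :- s) :+ (con 0ℚ :+ :- b) :* (con 0ℚ :+ :- b) :=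
      p :* p :+ (con 0ℚ :+ :- b) :* (con 0ℚ :+ :- b) :- (con 0ℚ :+ s)) refl

    bound : ∀ a b δ → 0ℚ ℚ.< δ → a ℚ.* a ℚ.+ b ℚ.* b ℚ.+ δ ℚ.≤ 1ℚ →
      0ℚ ℚ.+ (½ ℚ.* δ) ℚ.* (½ ℚ.* δ) ℚ.≤
      (1ℚ ℚ.- a) ℚ.* (1ℚ ℚ.- a) ℚ.+ (0ℚ ℚ.+ ℚ.- b) ℚ.* (0ℚ ℚ.+ ℚ.- b)
    bound a b δ 0<δ h = ≤-by
      (0≤+ (0≤ᵈ (sq-mono (ℚₚ.<⇒≤ (0<½* 0<δ)) δ/2≤1-a)) (0≤² (0ℚ ℚ.+ ℚ.- b)))
      (ring₂ (1ℚ ℚ.- a) b ((½ ℚ.* δ) ℚ.* (½ ℚ.* δ)))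
      where
      δ/2≤1-a : ½ ℚ.* δ ℚ.≤ 1ℚ ℚ.- a
      δ/2≤1-a = ≤-by
        (0≤+ (0≤* (ℚₚ.<⇒≤ 0<½) (0≤+ (0≤² (1ℚ ℚ.- a)) (0≤² b))) (0≤* (ℚₚ.<⇒≤ 0<½) (0≤ᵈ h)))
        (ring₁ a b δ)

------------------------------------------------------------------------
-- Finite and infinite sums and products

∑ ∏ : ℕ → (ℕ → ℂ) → ℂ
∑ zero    f = 0ℂ
∑ (suc n) f = ∑ n f + f n
∏ zero    f = 1ℂ
∏ (suc n) f = ∏ n f * f n

infix 5 ∑ ∏
syntax ∑ n (λ j → t) = ∑[ j < n ] t
syntax ∏ n (λ j → t) = ∏[ j < n ] t

infix 4 _⟶_

_⟶_ : (ℕ → ℂ) → ℂ → Set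
f ⟶ L = ∀ ε → 0ᵣ <ᵣ ε → Eventually λ n → ∣ f n - L ∣ <ᵣ ε

-- The series (product) converges, with the given value.
HasSum HasProd : (ℕ → ℂ) → ℂ → Set
HasSum  f S = (λ N → ∑[ n < N ] f n) ⟶ S
HasProd f P = (λ N → ∏[ n < N ] f n) ⟶ P

-- The iterated series ∑ₙ ∑ₘ f n m
HasDoubleSum : (ℕ → ℕ → ℂ) → ℂ → Set
HasDoubleSum f S = ∃[ s ] (∀ n → HasSum (f n) (s n)) × HasSum s S

------------------------------------------------------------------------
-- q-series

qPoch : ℂ → ℂ → ℕ → ℂ
qPoch a q n = ∏[ j < n ] (1ℂ - q ^ j * a)

HasqPoch∞ : ℂ → ℂ → ℂ → Set
HasqPoch∞ a q P = HasProd (λ j → 1ℂ - a * q ^ j) P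

qPoch-nonZero : ∀ a q → ∣ q ∣ <ᵣ 1ᵣ → ∣ a ∣ <ᵣ 1ᵣ → ∀ n → NonZero (qPoch a q n)
qPoch-nonZero a q h k zero = 1-nonZero
qPoch-nonZero a q h k (suc n) =
  *-nonZero (qPoch a q n) (1ℂ - q ^ n * a) (qPoch-nonZero a q h k n)
    (1-z-nonZero (q ^ n * a) (∣q^k*c∣<1 q a h k n))

module _ (q : ℂ) (∣q∣<1 : ∣ q ∣ <ᵣ 1ᵣ) where

  qPoch-q-nonZero : ∀ n → NonZero (qPoch q q n)
  qPoch-q-nonZero = qPoch-nonZero q q ∣q∣<1 ∣q∣<1

  -- used for j ≤ m only
  qBinomial : ℕ → ℕ → ℂ
  qBinomial m j = qPoch q q m / (qPoch q q j * qPoch q q (m ∸ j))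
    ⟨ *-nonZero (qPoch q q j) (qPoch q q (m ∸ j)) (qPoch-q-nonZero j) (qPoch-q-nonZero (m ∸ j)) ⟩

  Hahn : ℂ → ℂ → ℂ → ℕ → ℂ
  Hahn α x y m = ∑[ j < suc m ] (qBinomial m j * qPoch α q j * x ^ j * y ^ (m ∸ j))

  Has₂φ₁ : (a₁ a₂ b₁ : ℂ) → (∀ l → NonZero (qPoch b₁ q l)) → (w : ℂ) → ℂ → Set
  Has₂φ₁ a₁ a₂ b₁ b₁≢0 w S = HasSum term S
    where
    term : ℕ → ℂ
    term l = qPoch a₁ q l * qPoch a₂ q l / (qPoch q q l * qPoch b₁ q l)
      ⟨ *-nonZero (qPoch q q l) (qPoch b₁ q l) (qPoch-q-nonZero l) (b₁≢0 l) ⟩ * w ^ l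

{-# OPTIONS --safe #-}

-- Write (t)ₙ = (t;q)ₙ. Since the weight 1 - qⁿ is a twisted derivation for Cauchy products,
-- induction gives Φ_{n+m}/(q)ₙ = ∑ₗ x^(n-l)/(q)_{n-l} · bˡ/(q)ₗ · H m l, where H m l/(q)ₘ is the
-- Cauchy product of the sequences (qˡx)ⁱ/(q)ᵢ and (q^k)_{l+j} bʲ/(q)ⱼ. By Euler's identity
-- ∑ tⁱ/(q)ᵢ = 1/(t)_∞ and the q-binomial theorem ∑ (q^K)ⱼ tʲ/(q)ⱼ = 1/(t)_K, the sum over m of
-- H m l zᵐ/(q)ₘ is (q^k)ₗ (xz)ₗ/((xz)_∞ (bz)_{k+l}); the sum over n is then the Cauchy product of
-- Euler's series in xy with a multiple of the ₂φ₁.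
--
-- All the convergence involved is geometric: |∑_{n<N} - S| = O(ρᴺ) for some ρ < 1. This notion is
-- closed under linear combinations and Cauchy products, and survives multiplication by factors such
-- as (a)ₙ and 1/(a)ₙ, which are O(σⁿ) for every σ > 1. An infinite product (t)_∞ is obtained as
-- the inverse of the sum S of Euler's series, because (t)ₗ S = ∑ (qˡt)ⁱ/(q)ᵢ = 1 + O(qˡ).
module Submission where

open import Defs
open import Algebra.Bundles using (CommutativeRing)
open import Algebra.Solver.Ring.AlmostCommutativeRing
  using (AlmostCommutativeRing; fromCommutativeRing; _-Raw-AlmostCommutative⟶_)
open import Algebra.Structures using (IsCommutativeRing)
open import Data.Maybe.Base using (Maybe; just; nothing)
open import Data.Nat.Base as ℕ using (ℕ; zero; suc) renaming (_+_ to _+ℕ_)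
import Data.Nat.Properties as ℕₚ
open import Data.Product.Base using (Σ; ∃-syntax; _×_; _,_; proj₁; proj₂)
open import Data.Rational.Base as ℚ using (ℚ; 0ℚ; 1ℚ; ½)
import Data.Rational.Properties as ℚₚ
open import Data.Rational.Solver using (module +-*-Solver)
open import Data.Sum.Base using (inj₁; inj₂)
open import Level using (0ℓ)
import Relation.Binary.Reasoning.Setoid as SetoidReasoning
open import Relation.Binary.PropositionalEquality
  using (_≡_; refl; sym; trans; cong; cong₂; subst; subst₂)
open import Relation.Nullary using (yes; no)
open import Algebra.Properties.CommutativeSemiring.Exp
  (CommutativeRing.commutativeSemiring ℚₚ.+-*-commutativeRing)
  using () renaming (_^_ to _↑_; ^-homo-* to ↑-homo; ^-distrib-* to ↑-distrib)

open +-*-Solver using (solve; _:=_; _:+_; _:*_; _:-_; :-_; con)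

-- Powers of rationals

-- The double sum is iterated, over m and then over n. For fixed n the index l runs over a finite
-- range, so the sum over m passes inside by linearity alone (`conv-Sums`), and what remains is one
-- Cauchy product in n. That k is an integer enters through the q-binomial theorem: with upper
-- parameter q^K its sum is the reciprocal of a finite product, so it follows by induction on K from
-- a first-order difference equation. The array `H` is forced by the induction: removing a factor 1
-- - q^(n+1) replaces x by q x and shifts the index of (q^k;q), so the Hahn polynomials, which form
-- the column l = 0, are not closed under the recursion. The modulus of the statement is a bisected
-- square root of a Cauchy real. Estimates are therefore made on squared norms, with rational radii
-- (`_≼_`), and are carried over to the modulus only when a limit is asserted.

opaque
  0≤1 : 0ℚ ℚ.≤ 1ℚ
  0≤1 = ℚₚ.<⇒≤ 0<1

  *-mono : ∀ {a b c d} → 0ℚ ℚ.≤ a → 0ℚ ℚ.≤ c → a ℚ.≤ b → c ℚ.≤ d → a ℚ.* c ℚ.≤ b ℚ.* d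
  *-mono {a} {b} {c} {d} 0≤a 0≤c a≤b c≤d =
    ℚₚ.≤-trans (ℚₚ.*-monoʳ-≤-nonNeg c {{ℚ.nonNegative 0≤c}} a≤b)
      (ℚₚ.*-monoˡ-≤-nonNeg b {{ℚ.nonNegative (ℚₚ.≤-trans 0≤a a≤b)}} c≤d)

  *-mono-< : ∀ {a b c} → 0ℚ ℚ.< c → a ℚ.< b → c ℚ.* a ℚ.< c ℚ.* b
  *-mono-< {c = c} 0<c = ℚₚ.*-monoʳ-<-pos c {{ℚ.positive 0<c}}

  sq-cancel : ∀ {p q} → 0ℚ ℚ.≤ q → p ℚ.* p ℚ.≤ q ℚ.* q → p ℚ.≤ q
  sq-cancel {p} {q} 0≤q h = ℚₚ.≮⇒≥ λ q<p → ℚₚ.<-irrefl refl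
    (ℚₚ.<-≤-trans (<-by (0<* (0<ᵈ q<p) (0<+ (ℚₚ.≤-<-trans 0≤q q<p) 0≤q)) (ring p q)) h)
    where
    ring : ∀ p q → (p ℚ.- q) ℚ.* (p ℚ.+ q) ≡ p ℚ.* p ℚ.- q ℚ.* q
    ring = solve 2 (λ p q → (p :- q) :* (p :+ q) := p :* p :- q :* q) refl

  ↑-nonNeg : ∀ {p} n → 0ℚ ℚ.≤ p → 0ℚ ℚ.≤ p ↑ n
  ↑-nonNeg zero    h = 0≤1
  ↑-nonNeg (suc n) h = 0≤* h (↑-nonNeg n h)

  ↑-pos : ∀ {p} n → 0ℚ ℚ.< p → 0ℚ ℚ.< p ↑ n
  ↑-pos zero    h = 0<1
  ↑-pos (suc n) h = 0<* h (↑-pos n h)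

  ↑-mono : ∀ {p q} n → 0ℚ ℚ.≤ p → p ℚ.≤ q → p ↑ n ℚ.≤ q ↑ n
  ↑-mono zero    h k = ℚₚ.≤-refl
  ↑-mono (suc n) h k = *-mono h (↑-nonNeg n h) k (↑-mono n h k)

  ↑-≤1 : ∀ {p} n → 0ℚ ℚ.≤ p → p ℚ.≤ 1ℚ → p ↑ n ℚ.≤ 1ℚ
  ↑-≤1 zero    h k = ℚₚ.≤-refl
  ↑-≤1 (suc n) h k = *-mono h (↑-nonNeg n h) k (↑-≤1 n h k)

  ↑-anti : ∀ {p m n} → 0ℚ ℚ.≤ p → p ℚ.≤ 1ℚ → m ℕ.≤ n → p ↑ n ℚ.≤ p ↑ m
  ↑-anti {n = n} h k ℕ.z≤n = ↑-≤1 n h k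
  ↑-anti {m = suc m} {suc n} h k (ℕ.s≤s l) = *-mono h (↑-nonNeg n h) ℚₚ.≤-refl (↑-anti {m = m} h k l)

  -- A homogeneous form of Bernoulli's inequality. The convexity bound has n p^(n-1); since p ≤ 1 it
  -- may be weakened to n pⁿ, which avoids the predecessor. With q = 1 it shows pⁿ → 0, with p < q <
  -- 1 it absorbs the factor n of a Cauchy product.
  bernoulli : ∀ {p q} n → 0ℚ ℚ.≤ p → p ℚ.≤ q → p ℚ.≤ 1ℚ →
    p ↑ n ℚ.+ (q ℚ.- p) ℚ.* (fromℕ n ℚ.* p ↑ n) ℚ.≤ q ↑ n
  bernoulli {p} {q} zero h k l = ℚₚ.≤-reflexive
    (solve 2 (λ p q → con 1ℚ :+ (q :- p) :* (con 0ℚ :* con 1ℚ) := con 1ℚ) refl p q)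
  bernoulli {p} {q} (suc n) h k l = ≤-by
    (0≤+ (0≤+ (0≤* (ℚₚ.≤-trans h k) (0≤ᵈ (bernoulli n h k l)))
              (0≤* (0≤* (0≤ᵈ k) (0≤ᵈ k)) (0≤* (0≤fromℕ n) (↑-nonNeg n h))))
         (0≤* (0≤* (0≤ᵈ k) (↑-nonNeg n h)) (0≤ᵈ l)))
    (solve 5 (λ p q N P Q →
        q :* (Q :- (P :+ (q :- p) :* (N :* P))) :+ (q :- p) :* (q :- p) :* (N :* P)
          :+ (q :- p) :* P :* (con 1ℚ :- p)
        := q :* Q :- (p :* P :+ (q :- p) :* ((con 1ℚ :+ N) :* (p :* P))))
      refl p q (fromℕ n) (p ↑ n) (q ↑ n))

  -- If ε ≤ pⁿ, then `bernoulli` with q = 1 gives (1 - p) ε n ≤ 1, which fails as soon as n exceeds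
  -- η = 1/((1 - p) ε).
  ↑-small : ∀ {p ε} → 0ℚ ℚ.≤ p → p ℚ.< 1ℚ → 0ℚ ℚ.< ε → Eventually λ n → p ↑ n ℚ.< ε
  ↑-small {p} {ε} 0≤p p<1 0<ε =
    let 0<B          = 0<* (0<ᵈ p<1) 0<ε
        η , 0<η , Bη = divide 0<B 0<1
        N , η<N      = p<fromℕ η
    in N , λ n N≤n → ℚₚ.≰⇒> λ ε≤pⁿ → ℚₚ.<-irrefl refl (begin-strict
      1ℚ                                                   ≡⟨ sym Bη ⟩
      ((1ℚ ℚ.- p) ℚ.* ε) ℚ.* η                             <⟨ *-mono-< 0<B η<N ⟩
      ((1ℚ ℚ.- p) ℚ.* ε) ℚ.* fromℕ N                       ≤⟨ *-mono (ℚₚ.<⇒≤ 0<B) (0≤fromℕ N)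
                                                               (*-mono (0≤ᵈ (ℚₚ.<⇒≤ p<1)) (ℚₚ.<⇒≤ 0<ε) ℚₚ.≤-refl ε≤pⁿ)
                                                               (fromℕ-mono N≤n) ⟩
      ((1ℚ ℚ.- p) ℚ.* p ↑ n) ℚ.* fromℕ n                   ≤⟨ ≤-by (↑-nonNeg n 0≤p) (ring p (p ↑ n) (fromℕ n)) ⟩
      p ↑ n ℚ.+ (1ℚ ℚ.- p) ℚ.* (fromℕ n ℚ.* p ↑ n)         ≤⟨ bernoulli n 0≤p (ℚₚ.<⇒≤ p<1) (ℚₚ.<⇒≤ p<1) ⟩
      1ℚ ↑ n                                               ≤⟨ ↑-≤1 n 0≤1 ℚₚ.≤-refl ⟩
      1ℚ                                                   ∎)
    where
    open ℚₚ.≤-Reasoning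
    ring : ∀ p P N → P ≡ P ℚ.+ (1ℚ ℚ.- p) ℚ.* (N ℚ.* P) ℚ.- ((1ℚ ℚ.- p) ℚ.* P) ℚ.* N
    ring = solve 3 (λ p P N → P := P :+ (con 1ℚ :- p) :* (N :* P) :- ((con 1ℚ :- p) :* P) :* N) refl

  *↑-small : ∀ {C p ε} → 0ℚ ℚ.≤ C → 0ℚ ℚ.≤ p → p ℚ.< 1ℚ → 0ℚ ℚ.< ε → Eventually λ n → C ℚ.* p ↑ n ℚ.< ε
  *↑-small {C} {p} {ε} 0≤C 0≤p p<1 0<ε =
    -- C may be 0, so the division is by 1 + C.
    let 0<1+C        = 0<+ 0<1 0≤C
        η , 0<η , Cη = divide 0<1+C 0<ε
        N , h        = ↑-small 0≤p p<1 0<η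
    in N , λ n N≤n → ℚₚ.≤-<-trans
      (≤-by (↑-nonNeg n 0≤p) (ring C (p ↑ n)))
      (subst ((1ℚ ℚ.+ C) ℚ.* p ↑ n ℚ.<_) Cη (*-mono-< 0<1+C (h n N≤n)))
    where
    ring : ∀ C P → P ≡ (1ℚ ℚ.+ C) ℚ.* P ℚ.- C ℚ.* P
    ring = solve 2 (λ C P → P := (con 1ℚ :+ C) :* P :- C :* P) refl

-- The ring of complex numbers

infix 4 _≈_

-- Finer than _≃_; every algebraic identity needed here already holds for _≈_.
record _≈_ (z w : ℂ) : Set where
  constructor agree
  field at : Eventually λ t → seq (re z) t ≡ seq (re w) t × seq (im z) t ≡ seq (im w) t

-ℂ_ : ℂ → ℂ
-ℂ z = (-ᵣ re z) +i (-ᵣ im z)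

ι : ℚ → ℂ
ι p = mkℝ (λ _ → p) (const-cauchy p) +i 0ᵣ

opaque
  pointwise : ∀ {z w} → (∀ t → seq (re z) t ≡ seq (re w) t) → (∀ t → seq (im z) t ≡ seq (im w) t) → z ≈ w
  pointwise h k = agree (always λ t → h t , k t)

  ≈-refl : ∀ {z} → z ≈ z
  ≈-refl {z} = pointwise {z} {z} (λ _ → refl) (λ _ → refl)

  ≈-sym : ∀ {z w} → z ≈ w → w ≈ z
  ≈-sym (agree (N , h)) = agree (N , λ t le → sym (proj₁ (h t le)) , sym (proj₂ (h t le)))

  ≈-trans : ∀ {z w v} → z ≈ w → w ≈ v → z ≈ v
  ≈-trans {z} {w} {v} (agree h) (agree k) = agree
    (both (λ t → λ { (a , b) (c , d) → trans a c , trans b d }) h k)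

  +-cong : ∀ {z z′ w w′} → z ≈ z′ → w ≈ w′ → z + w ≈ z′ + w′
  +-cong (agree h) (agree k) = agree
    (both (λ t → λ { (a , b) (c , d) → cong₂ ℚ._+_ a c , cong₂ ℚ._+_ b d }) h k)

  *-cong : ∀ {z z′ w w′} → z ≈ z′ → w ≈ w′ → z * w ≈ z′ * w′
  *-cong (agree h) (agree k) = agree
    (both (λ t → λ { (a , b) (c , d) →
      cong₂ ℚ._-_ (cong₂ ℚ._*_ a c) (cong₂ ℚ._*_ b d) ,
      cong₂ ℚ._+_ (cong₂ ℚ._*_ a d) (cong₂ ℚ._*_ b c) }) h k)

  neg-cong : ∀ {z z′} → z ≈ z′ → -ℂ z ≈ -ℂ z′
  neg-cong (agree (N , h)) = agree (N , λ t le → cong (ℚ.-_) (proj₁ (h t le)) , cong (ℚ.-_) (proj₂ (h t le)))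

  +-*-isCommutativeRing : IsCommutativeRing _≈_ _+_ _*_ -ℂ_ 0ℂ 1ℂ
  +-*-isCommutativeRing = record
    { isRing = record
      { +-isAbelianGroup = record
        { isGroup = record
          { isMonoid = record
            { isSemigroup = record
              { isMagma = record
                { isEquivalence = record { refl = ≈-refl ; sym = ≈-sym ; trans = ≈-trans }
                ; ∙-cong = +-cong }
              ; assoc = λ z w v → pointwise
                  (λ t → ℚₚ.+-assoc (x z t) (x w t) (x v t)) (λ t → ℚₚ.+-assoc (y z t) (y w t) (y v t)) }
            ; identity = (λ z → pointwise (λ t → ℚₚ.+-identityˡ (x z t)) (λ t → ℚₚ.+-identityˡ (y z t)))
                       , (λ z → pointwise (λ t → ℚₚ.+-identityʳ (x z t)) (λ t → ℚₚ.+-identityʳ (y z t))) }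
          ; inverse = (λ z → pointwise (λ t → ℚₚ.+-inverseˡ (x z t)) (λ t → ℚₚ.+-inverseˡ (y z t)))
                    , (λ z → pointwise (λ t → ℚₚ.+-inverseʳ (x z t)) (λ t → ℚₚ.+-inverseʳ (y z t)))
          ; ⁻¹-cong = neg-cong }
        ; comm = λ z w → pointwise (λ t → ℚₚ.+-comm (x z t) (x w t)) (λ t → ℚₚ.+-comm (y z t) (y w t)) }
      ; *-cong = *-cong
      ; *-assoc = λ z w v → pointwise
          (λ t → assoc-re (x z t) (y z t) (x w t) (y w t) (x v t) (y v t))
          (λ t → assoc-im (x z t) (y z t) (x w t) (y w t) (x v t) (y v t))
      ; *-identity = (λ z → pointwise (λ t → one-re (x z t) (y z t)) (λ t → one-im (x z t) (y z t)))
                   , (λ z → ≈-trans (comm z 1ℂ)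
                       (pointwise (λ t → one-re (x z t) (y z t)) (λ t → one-im (x z t) (y z t))))
      ; distrib = distribˡ
                , λ z w v → ≈-trans (comm (w + v) z)
                    (≈-trans (distribˡ z w v) (+-cong (comm z w) (comm z v)))
      }
    ; *-comm = comm
    }
    where
    x y : ℂ → ℕ → ℚ
    x z = seq (re z)
    y z = seq (im z)

    assoc-re : ∀ a b c d e f →
      (a ℚ.* c ℚ.- b ℚ.* d) ℚ.* e ℚ.- (a ℚ.* d ℚ.+ b ℚ.* c) ℚ.* f ≡
      a ℚ.* (c ℚ.* e ℚ.- d ℚ.* f) ℚ.- b ℚ.* (c ℚ.* f ℚ.+ d ℚ.* e)
    assoc-re = solve 6 (λ a b c d e f →
      (a :* c :- b :* d) :* e :- (a :* d :+ b :* c) :* f :=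
      a :* (c :* e :- d :* f) :- b :* (c :* f :+ d :* e)) refl

    assoc-im : ∀ a b c d e f →
      (a ℚ.* c ℚ.- b ℚ.* d) ℚ.* f ℚ.+ (a ℚ.* d ℚ.+ b ℚ.* c) ℚ.* e ≡
      a ℚ.* (c ℚ.* f ℚ.+ d ℚ.* e) ℚ.+ b ℚ.* (c ℚ.* e ℚ.- d ℚ.* f)
    assoc-im = solve 6 (λ a b c d e f →
      (a :* c :- b :* d) :* f :+ (a :* d :+ b :* c) :* e :=
      a :* (c :* f :+ d :* e) :+ b :* (c :* e :- d :* f)) refl

    one-re : ∀ a b → 1ℚ ℚ.* a ℚ.- 0ℚ ℚ.* b ≡ a
    one-re = solve 2 (λ a b → con 1ℚ :* a :- con 0ℚ :* b := a) refl

    one-im : ∀ a b → 1ℚ ℚ.* b ℚ.+ 0ℚ ℚ.* a ≡ b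
    one-im = solve 2 (λ a b → con 1ℚ :* b :+ con 0ℚ :* a := b) refl

    comm : ∀ z w → z * w ≈ w * z
    comm z w = pointwise
      (λ t → solve 4 (λ a b c d → a :* c :- b :* d := c :* a :- d :* b) refl (x z t) (y z t) (x w t) (y w t))
      (λ t → solve 4 (λ a b c d → a :* d :+ b :* c := c :* b :+ d :* a) refl (x z t) (y z t) (x w t) (y w t))

    distribˡ : ∀ z w v → z * (w + v) ≈ z * w + z * v
    distribˡ z w v = pointwise
      (λ t → solve 6 (λ a b c d e f → a :* (c :+ e) :- b :* (d :+ f) :=
        (a :* c :- b :* d) :+ (a :* e :- b :* f)) refl (x z t) (y z t) (x w t) (y w t) (x v t) (y v t))
      (λ t → solve 6 (λ a b c d e f → a :* (d :+ f) :+ b :* (c :+ e) :=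
        (a :* d :+ b :* c) :+ (a :* f :+ b :* e)) refl (x z t) (y z t) (x w t) (y w t) (x v t) (y v t))

  neg-sub : ∀ z w → -ℂ (z - w) ≈ w - z
  neg-sub z w = pointwise (λ t → flip (seq (re z) t) (seq (re w) t)) (λ t → flip (seq (im z) t) (seq (im w) t))
    where
    flip : ∀ a b → ℚ.- (a ℚ.- b) ≡ b ℚ.- a
    flip = solve 2 (λ a b → :- (a :- b) := b :- a) refl

+-*-commutativeRing : CommutativeRing 0ℓ 0ℓ
+-*-commutativeRing = record { isCommutativeRing = +-*-isCommutativeRing }

ℂ-ring : AlmostCommutativeRing 0ℓ 0ℓ
ℂ-ring = fromCommutativeRing +-*-commutativeRing

ι-homomorphism : CommutativeRing.rawRing ℚₚ.+-*-commutativeRing -Raw-AlmostCommutative⟶ ℂ-ring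
ι-homomorphism = record
  { ⟦_⟧    = ι
  ; +-homo = λ p q → pointwise (λ _ → refl) (λ _ → refl)
  ; *-homo = λ p q → pointwise
      (λ _ → solve 2 (λ p q → p :* q := p :* q :- con 0ℚ :* con 0ℚ) refl p q)
      (λ _ → solve 2 (λ p q → con 0ℚ := p :* con 0ℚ :+ con 0ℚ :* q) refl p q)
  ; -‿homo = λ p → pointwise (λ _ → refl) (λ _ → refl)
  ; 0-homo = ≈-refl
  ; 1-homo = ≈-refl
  }

ι-≟ : ∀ p q → Maybe (ι p ≈ ι q)
ι-≟ p q with p ℚₚ.≟ q
... | yes refl = just ≈-refl
... | no  _    = nothing

import Algebra.Solver.Ring (CommutativeRing.rawRing ℚₚ.+-*-commutativeRing) ℂ-ring ι-homomorphism ι-≟ as ℂ-Solver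
open ℂ-Solver using () renaming (solve to ring; _:=_ to _⩵_; _:+_ to _⊕_; _:*_ to _⊗_; _:-_ to _⊖_; con to ⟪_⟫)

module ≈-Reasoning = SetoidReasoning (CommutativeRing.setoid +-*-commutativeRing)

-- Bounds on complex numbers

infix 4 _≼_

-- An eventual bound |z| ≤ r, stated so that it is preserved by _≈_ (though not by _≃_).
record _≼_ (z : ℂ) (r : ℚ) : Set where
  constructor within
  field
    radius≥0 : 0ℚ ℚ.≤ r
    bound    : Eventually λ t → seq (normSq z) t ℚ.≤ r ℚ.* r
open _≼_

opaque
  ∣p∣*∣p∣ : ∀ p → ℚ.∣ p ∣ ℚ.* ℚ.∣ p ∣ ≡ p ℚ.* p
  ∣p∣*∣p∣ p = trans (sym (ℚₚ.∣p*q∣≡∣p∣*∣q∣ p p)) (ℚₚ.0≤p⇒∣p∣≡p (0≤² p))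

  ∣∣≤-from-sq : ∀ {p q r} → 0ℚ ℚ.≤ r → p ℚ.* p ℚ.+ q ℚ.* q ℚ.≤ r ℚ.* r → ℚ.∣ p ∣ ℚ.≤ r
  ∣∣≤-from-sq {p} {q} {r} 0≤r h = sq-cancel {ℚ.∣ p ∣} {r} 0≤r (subst (ℚ._≤ r ℚ.* r) (sym (∣p∣*∣p∣ p))
    (ℚₚ.≤-trans (≤-by (0≤² q) (solve 2 (λ p q → q := p :+ q :- p) refl (p ℚ.* p) (q ℚ.* q))) h))

  -- Cauchy–Schwarz gives a c + b d ≤ r s.
  sq-triangle : ∀ a b c d {r s} → 0ℚ ℚ.≤ r → 0ℚ ℚ.≤ s →
    a ℚ.* a ℚ.+ b ℚ.* b ℚ.≤ r ℚ.* r → c ℚ.* c ℚ.+ d ℚ.* d ℚ.≤ s ℚ.* s →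
    (a ℚ.+ c) ℚ.* (a ℚ.+ c) ℚ.+ (b ℚ.+ d) ℚ.* (b ℚ.+ d) ℚ.≤ (r ℚ.+ s) ℚ.* (r ℚ.+ s)
  sq-triangle a b c d {r} {s} 0≤r 0≤s h k =
    ≤-by (0≤+ (0≤+ (0≤ᵈ h) (0≤ᵈ k)) (0≤+ (0≤ᵈ cs) (0≤ᵈ cs)))
      (solve 6 (λ a b c d r s →
        (r :* r :- (a :* a :+ b :* b)) :+ (s :* s :- (c :* c :+ d :* d))
          :+ ((r :* s :- (a :* c :+ b :* d)) :+ (r :* s :- (a :* c :+ b :* d)))
        := (r :+ s) :* (r :+ s) :- ((a :+ c) :* (a :+ c) :+ (b :+ d) :* (b :+ d))) refl a b c d r s)
    where
    open ℚₚ.≤-Reasoning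
    cs : a ℚ.* c ℚ.+ b ℚ.* d ℚ.≤ r ℚ.* s
    cs = sq-cancel (0≤* 0≤r 0≤s) (begin
      (a ℚ.* c ℚ.+ b ℚ.* d) ℚ.* (a ℚ.* c ℚ.+ b ℚ.* d)
        ≤⟨ ≤-by (0≤² (a ℚ.* d ℚ.- b ℚ.* c))
             (solve 4 (λ a b c d → (a :* d :- b :* c) :* (a :* d :- b :* c) :=
               (a :* a :+ b :* b) :* (c :* c :+ d :* d) :- (a :* c :+ b :* d) :* (a :* c :+ b :* d)) refl a b c d) ⟩
      (a ℚ.* a ℚ.+ b ℚ.* b) ℚ.* (c ℚ.* c ℚ.+ d ℚ.* d)
        ≤⟨ *-mono (0≤+ (0≤² a) (0≤² b)) (0≤+ (0≤² c) (0≤² d)) h k ⟩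
      (r ℚ.* r) ℚ.* (s ℚ.* s)
        ≡⟨ solve 2 (λ r s → (r :* r) :* (s :* s) := (r :* s) :* (r :* s)) refl r s ⟩
      (r ℚ.* s) ℚ.* (r ℚ.* s) ∎)

  ≼-cong : ∀ {z w r} → z ≈ w → z ≼ r → w ≼ r
  ≼-cong {z} {w} {r} (agree e) (within 0≤r h) = within 0≤r
    (both (λ t → λ { (a , b) → subst (ℚ._≤ r ℚ.* r) (cong₂ ℚ._+_ (cong₂ ℚ._*_ a a) (cong₂ ℚ._*_ b b)) }) e h)

  ≼-mono : ∀ {z r s} → r ℚ.≤ s → z ≼ r → z ≼ s
  ≼-mono r≤s (within 0≤r (N , h)) = within (ℚₚ.≤-trans 0≤r r≤s)
    (N , λ t le → ℚₚ.≤-trans (h t le) (sq-mono 0≤r r≤s))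

  0≼ : ∀ {r} → 0ℚ ℚ.≤ r → 0ℂ ≼ r
  0≼ {r} 0≤r = within 0≤r (always λ _ → 0≤² r)

  1≼1 : 1ℂ ≼ 1ℚ
  1≼1 = within 0≤1 (always λ _ → ℚₚ.≤-refl)

  ≼-+ : ∀ {z w r s} → z ≼ r → w ≼ s → z + w ≼ r ℚ.+ s
  ≼-+ {z} {w} {r} {s} (within 0≤r h) (within 0≤s k) = within (0≤+ 0≤r 0≤s)
    (both {Q = λ t → seq (normSq w) t ℚ.≤ s ℚ.* s} (λ t → sq-triangle (seq (re z) t) (seq (im z) t) (seq (re w) t) (seq (im w) t) 0≤r 0≤s) h k)

  ≼-* : ∀ {z w r s} → z ≼ r → w ≼ s → z * w ≼ r ℚ.* s
  ≼-* {z} {w} {r} {s} (within 0≤r h) (within 0≤s k) = within (0≤* 0≤r 0≤s)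
    (both {Q = λ t → seq (normSq w) t ℚ.≤ s ℚ.* s}
      (λ t a b → subst₂ ℚ._≤_ (sym (normSq-* z w t))
        (solve 2 (λ r s → (r :* r) :* (s :* s) := (r :* s) :* (r :* s)) refl r s)
        (*-mono (0≤normSq z t) (0≤normSq w t) a b)) h k)

  ≼-neg : ∀ {z r} → z ≼ r → -ℂ z ≼ r
  ≼-neg {z} {r} (within 0≤r (N , h)) = within 0≤r (N , λ t le → subst (ℚ._≤ r ℚ.* r)
    (solve 2 (λ a b → a :* a :+ b :* b := (:- a) :* (:- a) :+ (:- b) :* (:- b)) refl (seq (re z) t) (seq (im z) t))
    (h t le))

  ≼-sub : ∀ {z w r s} → z ≼ r → w ≼ s → z - w ≼ r ℚ.+ s
  ≼-sub {z} {w} h k = ≼-+ {z} { -ℂ w} h (≼-neg k)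

  ≼-^ : ∀ {z r} n → z ≼ r → z ^ n ≼ r ↑ n
  ≼-^ zero    h = 1≼1
  ≼-^ (suc n) h = ≼-* h (≼-^ n h)

  ≼-re : ∀ {z r} → z ≼ r → Eventually λ t → ℚ.∣ seq (re z) t ∣ ℚ.≤ r
  ≼-re {z} {r} (within 0≤r (N , h)) = N , λ t le → ∣∣≤-from-sq {seq (re z) t} {seq (im z) t} {r} 0≤r (h t le)

  ≼-im : ∀ {z r} → z ≼ r → Eventually λ t → ℚ.∣ seq (im z) t ∣ ℚ.≤ r
  ≼-im {z} {r} (within 0≤r (N , h)) = N , λ t le → ∣∣≤-from-sq {seq (im z) t} {seq (re z) t} {r} 0≤r
    (subst (ℚ._≤ r ℚ.* r) (ℚₚ.+-comm (seq (re z) t ℚ.* seq (re z) t) (seq (im z) t ℚ.* seq (im z) t)) (h t le))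

  ≼-components : ∀ {z r} → 0ℚ ℚ.≤ r →
    Eventually (λ t → ℚ.∣ seq (re z) t ∣ ℚ.≤ r) → Eventually (λ t → ℚ.∣ seq (im z) t ∣ ℚ.≤ r) → z ≼ r ℚ.+ r
  ≼-components {z} {r} 0≤r h k = within (0≤+ 0≤r 0≤r)
    (both {Q = λ t → ℚ.∣ seq (im z) t ∣ ℚ.≤ r} (λ t a b → ℚₚ.≤-trans
      (ℚₚ.+-mono-≤ (sq≤ {seq (re z) t} a) (sq≤ {seq (im z) t} b))
      (≤-by (0≤+ (0≤² r) (0≤² r)) (solve 1 (λ r → r :* r :+ r :* r := (r :+ r) :* (r :+ r) :- (r :* r :+ r :* r)) refl r))) h k)
    where
    sq≤ : ∀ {p} → ℚ.∣ p ∣ ℚ.≤ r → p ℚ.* p ℚ.≤ r ℚ.* r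
    sq≤ {p} h = subst (ℚ._≤ r ℚ.* r) (∣p∣*∣p∣ p) (sq-mono (ℚₚ.0≤∣p∣ p) h)

  bounded-ℂ : ∀ z → ∃[ r ] (0ℚ ℚ.< r × z ≼ r)
  bounded-ℂ z =
    let B , 0<B , h = bounded (cauchy (re z))
        C , 0<C , k = bounded (cauchy (im z))
    in (B ℚ.+ C) ℚ.+ (B ℚ.+ C) ,
       0<+ (0<+ 0<B (ℚₚ.<⇒≤ 0<C)) (0≤+ (ℚₚ.<⇒≤ 0<B) (ℚₚ.<⇒≤ 0<C)) ,
       ≼-components {z} {B ℚ.+ C} (0≤+ (ℚₚ.<⇒≤ 0<B) (ℚₚ.<⇒≤ 0<C))
         (proj₁ h , λ t le → ℚₚ.≤-trans (proj₂ h t le)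
           (≤-by (ℚₚ.<⇒≤ 0<C) (solve 2 (λ B C → C := B :+ C :- B) refl B C)))
         (proj₁ k , λ t le → ℚₚ.≤-trans (proj₂ k t le)
           (≤-by (ℚₚ.<⇒≤ 0<B) (solve 2 (λ B C → B := B :+ C :- C) refl B C)))

  -- 1 - δ ≤ (1 - δ/2)²
  radius<1 : ∀ z → ∣ z ∣ <ᵣ 1ᵣ → ∃[ r ] (0ℚ ℚ.< r × r ℚ.< 1ℚ × z ≼ r)
  radius<1 z ∣z∣<1 with ∣∣<1⇒normSq<1 z ∣z∣<1
  ... | δ , 0<δ , N , h = r , 0<r , r<1 ,
    within (ℚₚ.<⇒≤ 0<r) (N , λ t le → ≤-by (0≤+ (0≤ᵈ (h t le)) (0≤² (½ ℚ.* δ)))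
      (solve 2 (λ p d → (con 1ℚ :- (p :+ d)) :+ (con ½ :* d) :* (con ½ :* d) :=
        (con 1ℚ :- con ½ :* d) :* (con 1ℚ :- con ½ :* d) :- p) refl (seq (normSq z) t) δ))
    where
    r : ℚ
    r = 1ℚ ℚ.- ½ ℚ.* δ
    δ≤1 : δ ℚ.≤ 1ℚ
    δ≤1 = ℚₚ.≤-trans (≤-by (0≤normSq z N)
      (solve 2 (λ p d → p := p :+ d :- d) refl (seq (normSq z) N) δ)) (h N ℕₚ.≤-refl)
    0<r : 0ℚ ℚ.< r
    0<r = subst (0ℚ ℚ.<_) (solve 1 (λ d → con ½ :+ con ½ :* (con 1ℚ :- d) := con 1ℚ :- con ½ :* d) refl δ)
      (0<+ 0<½ (0≤* (ℚₚ.<⇒≤ 0<½) (0≤ᵈ δ≤1)))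
    r<1 : r ℚ.< 1ℚ
    r<1 = <-by (0<½* 0<δ) (solve 1 (λ d → con ½ :* d := con 1ℚ :- (con 1ℚ :- con ½ :* d)) refl δ)

  -- The real part suffices: 1 - Re z ≥ 1 - r ≥ 0, and the imaginary part only adds a square.
  1-z-lower : ∀ {z r} → r ℚ.≤ 1ℚ → z ≼ r →
    Eventually λ t → (1ℚ ℚ.- r) ℚ.* (1ℚ ℚ.- r) ℚ.≤ seq (normSq (1ℂ - z)) t
  1-z-lower {z} {r} r≤1 h = let N , k = ≼-re {z} {r} h in N , λ t le →
    ℚₚ.≤-trans
      (sq-mono {1ℚ ℚ.- r} {1ℚ ℚ.- seq (re z) t} (0≤ᵈ r≤1) (≤-by (0≤ᵈ (ℚₚ.≤-trans (p≤∣p∣ (seq (re z) t)) (k t le)))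
        (solve 2 (λ a r → r :- a := (con 1ℚ :- a) :- (con 1ℚ :- r)) refl (seq (re z) t) r)))
      (≤-by (0≤² (0ℚ ℚ.- seq (im z) t)) (solve 2 (λ p s → s := p :+ s :- p) refl
        ((1ℚ ℚ.- seq (re z) t) ℚ.* (1ℚ ℚ.- seq (re z) t)) ((0ℚ ℚ.- seq (im z) t) ℚ.* (0ℚ ℚ.- seq (im z) t))))

  -- R is 1/l for a lower bound l on |w|, and |u|² |w|² = 1.
  ≼-inverse : ∀ {u w l R} → 0ℚ ℚ.≤ R → R ℚ.* l ≡ 1ℚ → u * w ≈ 1ℂ →
    Eventually (λ t → l ℚ.* l ℚ.≤ seq (normSq w) t) → u ≼ R
  ≼-inverse {u} {w} {l} {R} 0≤R Rl≡1 (agree e) h = within 0≤R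
    (both {Q = λ t → l ℚ.* l ℚ.≤ seq (normSq w) t} (λ t → λ { (a , b) k → begin
      seq (normSq u) t
        ≡⟨ sym (trans (cong (λ x → seq (normSq u) t ℚ.* (x ℚ.* x)) Rl≡1)
             (solve 1 (λ p → p :* (con 1ℚ :* con 1ℚ) := p) refl (seq (normSq u) t))) ⟩
      seq (normSq u) t ℚ.* ((R ℚ.* l) ℚ.* (R ℚ.* l))
        ≡⟨ solve 3 (λ p R l → p :* ((R :* l) :* (R :* l)) := (R :* R) :* (p :* (l :* l))) refl (seq (normSq u) t) R l ⟩
      (R ℚ.* R) ℚ.* (seq (normSq u) t ℚ.* (l ℚ.* l))
        ≤⟨ *-mono (0≤² R) (0≤* (0≤normSq u t) (0≤² l)) ℚₚ.≤-refl (*-mono (0≤normSq u t) (0≤² l) ℚₚ.≤-refl k) ⟩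
      (R ℚ.* R) ℚ.* (seq (normSq u) t ℚ.* seq (normSq w) t)
        ≡⟨ cong ((R ℚ.* R) ℚ.*_) (trans (sym (normSq-* u w t))
             (cong₂ ℚ._+_ (cong₂ ℚ._*_ a a) (cong₂ ℚ._*_ b b))) ⟩
      (R ℚ.* R) ℚ.* (1ℚ ℚ.* 1ℚ ℚ.+ 0ℚ ℚ.* 0ℚ)
        ≡⟨ solve 1 (λ R → R :* (con 1ℚ :* con 1ℚ :+ con 0ℚ :* con 0ℚ) := R) refl (R ℚ.* R) ⟩
      R ℚ.* R ∎ }) e h)
    where open ℚₚ.≤-Reasoning

  nonZero-from-1 : ∀ {z r} → r ℚ.< 1ℚ → 1ℂ - z ≼ r → NonZero z
  nonZero-from-1 {z} {r} r<1 h = (1ℚ ℚ.- r) ℚ.* (1ℚ ℚ.- r) , 0<* (0<ᵈ r<1) (0<ᵈ r<1) ,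
    let N , k = 1-z-lower {1ℂ - z} {r} (ℚₚ.<⇒≤ r<1) h in N , λ t le →
      subst₂ ℚ._≤_ (sym (ℚₚ.+-identityˡ ((1ℚ ℚ.- r) ℚ.* (1ℚ ℚ.- r))))
        (solve 2 (λ a b → (con 1ℚ :- (con 1ℚ :- a)) :* (con 1ℚ :- (con 1ℚ :- a)) :+
            (con 0ℚ :- (con 0ℚ :- b)) :* (con 0ℚ :- (con 0ℚ :- b)) := a :* a :+ b :* b) refl
          (seq (re z) t) (seq (im z) t))
        (k t le)

  -- Every w has an eventual bound R, so |z|² ≥ δ/R². Positivity of a norm can thus be read off from
  -- a product.
  nonZero-factor : ∀ {z w} → NonZero (z * w) → NonZero z
  nonZero-factor {z} {w} (δ , 0<δ , h) =
    let R , 0<R , w≼R  = bounded-ℂ w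
        η , 0<η , RRη = divide (0<* 0<R 0<R) 0<δ
    in η , 0<η , both {Q = λ t → seq (normSq w) t ℚ.≤ R ℚ.* R}
      (λ t a b → lower-bound (seq (normSq z) t) (seq (normSq w) t) (0≤normSq z t) (0≤normSq w t) 0<R RRη
        (subst (0ℚ ℚ.+ δ ℚ.≤_) (normSq-* z w t) a) b)
      h (bound w≼R)
    where
    open ℚₚ.≤-Reasoning
    lower-bound : ∀ p q {R η} → 0ℚ ℚ.≤ p → 0ℚ ℚ.≤ q → 0ℚ ℚ.< R → (R ℚ.* R) ℚ.* η ≡ δ →
      0ℚ ℚ.+ δ ℚ.≤ p ℚ.* q → q ℚ.≤ R ℚ.* R → 0ℚ ℚ.+ η ℚ.≤ p
    lower-bound p q {R} {η} 0≤p 0≤q 0<R RRη a b = subst (ℚ._≤ p) (sym (ℚₚ.+-identityˡ η))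
      (ℚₚ.≮⇒≥ λ p<η → ℚₚ.<-irrefl refl (begin-strict
        p ℚ.* q            ≤⟨ *-mono {p} {p} {q} {R ℚ.* R} 0≤p 0≤q ℚₚ.≤-refl b ⟩
        p ℚ.* (R ℚ.* R)    ≡⟨ ℚₚ.*-comm p (R ℚ.* R) ⟩
        (R ℚ.* R) ℚ.* p    <⟨ *-mono-< {p} {η} {R ℚ.* R} (0<* 0<R 0<R) p<η ⟩
        (R ℚ.* R) ℚ.* η    ≡⟨ RRη ⟩
        δ                  ≡⟨ sym (ℚₚ.+-identityˡ δ) ⟩
        0ℚ ℚ.+ δ           ≤⟨ a ⟩
        p ℚ.* q            ∎))

  -- The way back to the modulus: the bisected value `lower t` has square at most |z|² ≤ r², hence
  -- is at most r, and the gap δ - r witnesses the strict inequality.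
  ≼⇒∣∣< : ∀ {z r δ ε} → z ≼ r → r ℚ.< δ → (Eventually λ t → 0ℚ ℚ.+ δ ℚ.≤ seq ε t) → ∣ z ∣ <ᵣ ε
  ≼⇒∣∣< {z} {r} {δ} {ε} (within 0≤r h) r<δ k = δ ℚ.- r , 0<ᵈ r<δ ,
    both {Q = λ t → 0ℚ ℚ.+ δ ℚ.≤ seq ε t} (λ t a b → ℚₚ.≤-trans
      (≤-by (0≤ᵈ (sq-cancel 0≤r (ℚₚ.≤-trans (Bracket.below (bracket t (0≤normSq z t))) a)))
        (solve 3 (λ l r d → r :- l := (con 0ℚ :+ d) :- (l :+ (d :- r))) refl (lower t (seq (normSq z) t)) r δ)) b) h k

  -- `recip` is a true inverse from the index on at which the squared norm of w stays above δ. For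
  -- this reason `_≈_` asks for agreement only eventually.
  /-* : ∀ z w (w≢0 : NonZero w) → (z / w ⟨ w≢0 ⟩) * w ≈ z
  /-* z w w≢0@(δ , 0<δ , N , h) = agree (N , λ t le →
    let a = seq (re z) t ; b = seq (im z) t ; c = seq (re w) t ; d = seq (im w) t
        p = c ℚ.* c ℚ.+ d ℚ.* d ; r = recip p
        pr≡1 = recip-inverse p (ℚₚ.<-≤-trans (subst (0ℚ ℚ.<_) (sym (ℚₚ.+-identityˡ δ)) 0<δ) (h t le))
    in trans (solve 5 (λ a b c d r →
           (a :* (c :* r) :- b :* ((:- d) :* r)) :* c :- (a :* ((:- d) :* r) :+ b :* (c :* r)) :* d :=
           ((c :* c :+ d :* d) :* r) :* a) refl a b c d r)
         (trans (cong (ℚ._* a) pr≡1) (ℚₚ.*-identityˡ a)) ,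
       trans (solve 5 (λ a b c d r →
           (a :* (c :* r) :- b :* ((:- d) :* r)) :* d :+ (a :* ((:- d) :* r) :+ b :* (c :* r)) :* c :=
           ((c :* c :+ d :* d) :* r) :* b) refl a b c d r)
         (trans (cong (ℚ._* b) pr≡1) (ℚₚ.*-identityˡ b)))

-- Completeness and geometric convergence

opaque
  ∣-∣-triangle : ∀ a b c → ℚ.∣ a ℚ.- c ∣ ℚ.≤ ℚ.∣ a ℚ.- b ∣ ℚ.+ ℚ.∣ b ℚ.- c ∣
  ∣-∣-triangle a b c = subst (λ p → ℚ.∣ p ∣ ℚ.≤ ℚ.∣ a ℚ.- b ∣ ℚ.+ ℚ.∣ b ℚ.- c ∣)
    (solve 3 (λ a b c → (a :- b) :+ (b :- c) := a :- c) refl a b c)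
    (ℚₚ.∣p+q∣≤∣p∣+∣q∣ (a ℚ.- b) (b ℚ.- c))

  -- The limit takes from the t-th real its entry at a time after which it moves by less than ρ ↑ t.
  complete-ℝ : (x : ℕ → ℝ) {C ρ : ℚ} → 0ℚ ℚ.≤ C → 0ℚ ℚ.< ρ → ρ ℚ.< 1ℚ →
    (∀ m n → m ℕ.≤ n → Eventually λ t → ℚ.∣ seq (x n) t ℚ.- seq (x m) t ∣ ℚ.≤ C ℚ.* ρ ↑ m) →
    ∃[ X ] (∀ m → Eventually λ t → ℚ.∣ seq X t ℚ.- seq (x m) t ∣ ℚ.≤ (C ℚ.+ (1ℚ ℚ.+ 1ℚ)) ℚ.* ρ ↑ m)
  complete-ℝ x {C} {ρ} 0≤C 0<ρ ρ<1 close =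
    mkℝ X X-cauchy , λ m → m ℕ.⊔ τ m , λ t le → near m t t (ℕₚ.m⊔n≤o⇒m≤o m (τ m) le) (ℕₚ.m⊔n≤o⇒n≤o m (τ m) le)
    where
    B : ℚ
    B = C ℚ.+ (1ℚ ℚ.+ 1ℚ)
    0≤B : 0ℚ ℚ.≤ B
    0≤B = 0≤+ 0≤C (0≤+ 0≤1 0≤1)

    modulus : ∀ m → ∃[ N ] (∀ s t → N ℕ.≤ s → N ℕ.≤ t → ℚ.∣ seq (x m) s ℚ.- seq (x m) t ∣ ℚ.< ρ ↑ m)
    modulus m = cauchy (x m) (ρ ↑ m) (↑-pos m 0<ρ)

    τ : ℕ → ℕ
    τ m = proj₁ (modulus m)

    X : ℕ → ℚ
    X t = seq (x t) (τ t)

    near : ∀ m t s → m ℕ.≤ t → τ m ℕ.≤ s → ℚ.∣ X t ℚ.- seq (x m) s ∣ ℚ.≤ B ℚ.* ρ ↑ m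
    near m t s m≤t τm≤s =
      let N , h = close m t m≤t
          -- A late time common to both reals. The path X t = x t (τ t), x t (u), x m (u), x m (s)
          -- costs ρ ↑ t ≤ ρ ↑ m, then C ρ ↑ m, then ρ ↑ m, whence the constant C + 2.
          u     = N ℕ.⊔ (τ t ℕ.⊔ τ m)
          τ≤u   = ℕₚ.m≤n⊔m N (τ t ℕ.⊔ τ m)
          τt≤u  = ℕₚ.m⊔n≤o⇒m≤o (τ t) (τ m) τ≤u
          τm≤u  = ℕₚ.m⊔n≤o⇒n≤o (τ t) (τ m) τ≤u
          p     = seq (x t) u
          r     = seq (x m) u
          c     = seq (x m) s
      in begin
      ℚ.∣ X t ℚ.- c ∣                                                  ≤⟨ ∣-∣-triangle (X t) p c ⟩
      ℚ.∣ X t ℚ.- p ∣ ℚ.+ ℚ.∣ p ℚ.- c ∣                                ≤⟨ ℚₚ.+-monoʳ-≤ ℚ.∣ X t ℚ.- p ∣ (∣-∣-triangle p r c) ⟩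
      ℚ.∣ X t ℚ.- p ∣ ℚ.+ (ℚ.∣ p ℚ.- r ∣ ℚ.+ ℚ.∣ r ℚ.- c ∣)
        ≤⟨ ℚₚ.+-mono-≤ (ℚₚ.≤-trans (ℚₚ.<⇒≤ (proj₂ (modulus t) (τ t) u ℕₚ.≤-refl τt≤u))
                          (↑-anti (ℚₚ.<⇒≤ 0<ρ) (ℚₚ.<⇒≤ ρ<1) m≤t))
             (ℚₚ.+-mono-≤ (h u (ℕₚ.m≤m⊔n N (τ t ℕ.⊔ τ m))) (ℚₚ.<⇒≤ (proj₂ (modulus m) u s τm≤u τm≤s))) ⟩
      ρ ↑ m ℚ.+ (C ℚ.* ρ ↑ m ℚ.+ ρ ↑ m)
        ≡⟨ solve 2 (λ C P → P :+ (C :* P :+ P) := (C :+ (con 1ℚ :+ con 1ℚ)) :* P) refl C (ρ ↑ m) ⟩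
      B ℚ.* ρ ↑ m ∎
      where open ℚₚ.≤-Reasoning

    X-cauchy : Cauchy X
    X-cauchy ε 0<ε =
      let N , h = *↑-small 0≤B (ℚₚ.<⇒≤ 0<ρ) ρ<1 (0<½* 0<ε)
          c     = seq (x N) (τ N)
      in N , λ m n N≤m N≤n → ℚₚ.≤-<-trans (∣-∣-triangle (X m) c (X n))
        (subst (ℚ.∣ X m ℚ.- c ∣ ℚ.+ ℚ.∣ c ℚ.- X n ∣ ℚ.<_) (half ε)
          (ℚₚ.+-mono-< (ℚₚ.≤-<-trans (near N m (τ N) N≤m ℕₚ.≤-refl) (h N ℕₚ.≤-refl))
            (ℚₚ.≤-<-trans (subst (ℚ._≤ B ℚ.* ρ ↑ N) (∣-∣-comm (X n) c) (near N n (τ N) N≤n ℕₚ.≤-refl)) (h N ℕₚ.≤-refl))))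

  complete-ℂ : (s : ℕ → ℂ) {C ρ : ℚ} → 0ℚ ℚ.≤ C → 0ℚ ℚ.< ρ → ρ ℚ.< 1ℚ →
    (∀ m n → m ℕ.≤ n → s n - s m ≼ C ℚ.* ρ ↑ m) →
    ∃[ S ] ∃[ B ] (0ℚ ℚ.≤ B × (∀ m → S - s m ≼ B ℚ.* ρ ↑ m))
  complete-ℂ s {C} {ρ} 0≤C 0<ρ ρ<1 close =
    let X , h = complete-ℝ (λ n → re (s n)) 0≤C 0<ρ ρ<1 (λ m n le → ≼-re (close m n le))
        Y , k = complete-ℝ (λ n → im (s n)) 0≤C 0<ρ ρ<1 (λ m n le → ≼-im (close m n le))
    in X +i Y , B ℚ.+ B , 0≤+ 0≤B 0≤B , λ m →
      subst ((X +i Y) - s m ≼_) (sym (ℚₚ.*-distribʳ-+ (ρ ↑ m) B B))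
        (≼-components (0≤* 0≤B (↑-nonNeg m (ℚₚ.<⇒≤ 0<ρ))) (h m) (k m))
    where
    B : ℚ
    B = C ℚ.+ (1ℚ ℚ.+ 1ℚ)
    0≤B : 0ℚ ℚ.≤ B
    0≤B = 0≤+ 0≤C (0≤+ 0≤1 0≤1)

-- Geometric decay and subexponential growth

record O (f : ℕ → ℂ) (ρ : ℚ) : Set where
  constructor O-by
  field
    scale  : ℚ
    scale≥0 : 0ℚ ℚ.≤ scale
    -- One constant serves all n, while the time from which `≼` holds may depend on n.
    bounds : ∀ n → f n ≼ scale ℚ.* ρ ↑ n

record Geometric (f : ℕ → ℂ) : Set where
  constructor geometric
  field
    {rate} : ℚ
    rate>0 : 0ℚ ℚ.< rate
    rate<1 : rate ℚ.< 1ℚ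
    isO    : O f rate

Subexponential : (ℕ → ℂ) → Set
Subexponential f = ∀ σ → 1ℚ ℚ.< σ → O f σ

opaque
  O-cong : ∀ {f g ρ} → (∀ n → f n ≈ g n) → O f ρ → O g ρ
  O-cong e (O-by C 0≤C h) = O-by C 0≤C (λ n → ≼-cong (e n) (h n))

  O-mono : ∀ {f ρ σ} → 0ℚ ℚ.≤ ρ → ρ ℚ.≤ σ → O f ρ → O f σ
  O-mono {ρ = ρ} {σ} 0≤ρ ρ≤σ (O-by C 0≤C h) = O-by C 0≤C
    (λ n → ≼-mono (*-mono {C} {C} {ρ ↑ n} {σ ↑ n} 0≤C (↑-nonNeg n 0≤ρ) ℚₚ.≤-refl (↑-mono n 0≤ρ ρ≤σ)) (h n))

  O-+ : ∀ {f g ρ} → O f ρ → O g ρ → O (λ n → f n + g n) ρ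
  O-+ {ρ = ρ} (O-by C 0≤C h) (O-by D 0≤D k) = O-by (C ℚ.+ D) (0≤+ 0≤C 0≤D)
    (λ n → subst (_ ≼_) (sym (ℚₚ.*-distribʳ-+ (ρ ↑ n) C D)) (≼-+ (h n) (k n)))

  O-* : ∀ {f g ρ σ} → O f ρ → O g σ → O (λ n → f n * g n) (ρ ℚ.* σ)
  O-* {ρ = ρ} {σ} (O-by C 0≤C h) (O-by D 0≤D k) = O-by (C ℚ.* D) (0≤* 0≤C 0≤D)
    (λ n → subst (_ ≼_)
      (trans (solve 4 (λ C D P Q → (C :* P) :* (D :* Q) := (C :* D) :* (P :* Q)) refl C D (ρ ↑ n) (σ ↑ n))
        (cong ((C ℚ.* D) ℚ.*_) (sym (↑-distrib ρ σ n))))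
      (≼-* (h n) (k n)))

  O-scale : ∀ {f ρ} c → O f ρ → O (λ n → c * f n) ρ
  O-scale {ρ = ρ} c (O-by C 0≤C h) =
    let r , 0<r , c≼r = bounded-ℂ c
    in O-by (r ℚ.* C) (0≤* (ℚₚ.<⇒≤ 0<r) 0≤C)
         (λ n → subst (_ ≼_) (sym (ℚₚ.*-assoc r C (ρ ↑ n))) (≼-* c≼r (h n)))

  O-pow : ∀ {z r} → z ≼ r → O (z ^_) r
  O-pow {r = r} h = O-by 1ℚ 0≤1 (λ n → subst (_ ≼_) (sym (ℚₚ.*-identityˡ (r ↑ n))) (≼-^ n h))

  -- Reindexing the tail costs a factor κ = 1/ρ, and r takes care of the initial term.
  O-cons : ∀ {f ρ} → 0ℚ ℚ.< ρ → O (λ n → f (suc n)) ρ → O f ρ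
  O-cons {f} {ρ} 0<ρ (O-by C 0≤C h) =
    let r , 0<r , f₀≼r = bounded-ℂ (f 0)
        κ , 0<κ , ρκ   = divide 0<ρ 0<1
        0≤Cκ           = 0≤* 0≤C (ℚₚ.<⇒≤ 0<κ)
        0≤D            = 0≤+ (ℚₚ.<⇒≤ 0<r) 0≤Cκ
    in O-by (r ℚ.+ C ℚ.* κ) 0≤D λ
      { zero    → ≼-mono (≤-by 0≤Cκ (solve 2 (λ r s → s := (r :+ s) :* con 1ℚ :- r) refl r (C ℚ.* κ))) f₀≼r
      ; (suc n) → ≼-mono (≤-by (0≤* (ℚₚ.<⇒≤ 0<r) (↑-nonNeg (suc n) (ℚₚ.<⇒≤ 0<ρ)))
          (trans (solve 5 (λ r C κ ρ P → r :* (ρ :* P) := (r :+ C :* κ) :* (ρ :* P) :- (C :* P) :* (ρ :* κ)) refl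
                   r C κ ρ (ρ ↑ n))
            (cong (λ x → (r ℚ.+ C ℚ.* κ) ℚ.* (ρ ℚ.* ρ ↑ n) ℚ.- x)
              (trans (cong ((C ℚ.* ρ ↑ n) ℚ.*_) ρκ) (ℚₚ.*-identityʳ (C ℚ.* ρ ↑ n)))))) (h n) }

  -- A ratio test. The first N ratios are arbitrary; they are peeled off one by one with `O-cons`,
  -- after which a plain induction applies.
  O-ratio : ∀ (f u : ℕ → ℂ) {σ} → 0ℚ ℚ.< σ → (∀ n → f (suc n) ≈ f n * u n) → (Eventually λ n → u n ≼ σ) → O f σ
  O-ratio f u {σ} 0<σ step (N , h) = from N f u step h
    where
    go : ∀ (f u : ℕ → ℂ) → (∀ n → f (suc n) ≈ f n * u n) → (∀ n → u n ≼ σ) →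
      ∀ {r} → f 0 ≼ r → ∀ n → f n ≼ r ℚ.* σ ↑ n
    go f u step h {r} k zero    = subst (f 0 ≼_) (sym (ℚₚ.*-identityʳ r)) k
    go f u step h {r} k (suc n) = ≼-cong (≈-sym (step n))
      (subst (f n * u n ≼_) (solve 3 (λ r P s → (r :* P) :* s := r :* (s :* P)) refl r (σ ↑ n) σ)
        (≼-* (go f u step h k n) (h n)))

    from : ∀ N (f u : ℕ → ℂ) → (∀ n → f (suc n) ≈ f n * u n) → (∀ n → N ℕ.≤ n → u n ≼ σ) → O f σ
    from zero    f u step h = let r , 0<r , f₀≼r = bounded-ℂ (f 0) in
      O-by r (ℚₚ.<⇒≤ 0<r) (go f u step (λ n → h n ℕ.z≤n) f₀≼r)
    from (suc N) f u step h = O-cons {f} 0<σ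
      (from N (λ n → f (suc n)) (λ n → u (suc n)) (λ n → step (suc n)) (λ n le → h (suc n) (ℕ.s≤s le)))

  Geometric-common : ∀ {f g} → Geometric f → Geometric g →
    ∃[ ρ ] (0ℚ ℚ.< ρ × ρ ℚ.< 1ℚ × O f ρ × O g ρ)
  Geometric-common (geometric {ρ} 0<ρ ρ<1 F) (geometric {σ} 0<σ σ<1 G) with ℚₚ.≤-total ρ σ
  ... | inj₁ ρ≤σ = σ , 0<σ , σ<1 , O-mono (ℚₚ.<⇒≤ 0<ρ) ρ≤σ F , G
  ... | inj₂ σ≤ρ = ρ , 0<ρ , ρ<1 , F , O-mono (ℚₚ.<⇒≤ 0<σ) σ≤ρ G

  Geometric-cong : ∀ {f g} → (∀ n → f n ≈ g n) → Geometric f → Geometric g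
  Geometric-cong e (geometric a b F) = geometric a b (O-cong e F)

  Geometric-+ : ∀ {f g} → Geometric f → Geometric g → Geometric (λ n → f n + g n)
  Geometric-+ F G = let ρ , 0<ρ , ρ<1 , F′ , G′ = Geometric-common F G in geometric 0<ρ ρ<1 (O-+ F′ G′)

  Geometric-scale : ∀ {f} c → Geometric f → Geometric (λ n → c * f n)
  Geometric-scale c (geometric a b F) = geometric a b (O-scale c F)

  Geometric-cons : ∀ {f} → Geometric (λ n → f (suc n)) → Geometric f
  Geometric-cons (geometric a b F) = geometric a b (O-cons a F)

  Geometric-drop : ∀ {f} k → Geometric f → Geometric (λ n → f (k +ℕ n))
  Geometric-drop k (geometric {ρ} 0<ρ ρ<1 (O-by C 0≤C h)) = geometric 0<ρ ρ<1
    (O-by (C ℚ.* ρ ↑ k) (0≤* 0≤C (↑-nonNeg k (ℚₚ.<⇒≤ 0<ρ)))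
      (λ n → subst (_ ≼_) (trans (cong (C ℚ.*_) (↑-homo ρ k n)) (sym (ℚₚ.*-assoc C (ρ ↑ k) (ρ ↑ n)))) (h (k +ℕ n))))

  -- The choice makes σ ρ the midpoint of ρ and 1. This gap absorbs a subexponential factor, or the
  -- factor n + 1 of a Cauchy product.
  room : ∀ {ρ} → 0ℚ ℚ.< ρ → ρ ℚ.< 1ℚ → ∃[ σ ] (1ℚ ℚ.< σ × 0ℚ ℚ.< σ ℚ.* ρ × σ ℚ.* ρ ℚ.< 1ℚ)
  room {ρ} 0<ρ ρ<1 =
    let κ , 0<κ , ρκ = divide 0<ρ (0<½* (0<ᵈ ρ<1))
        σρ           = trans (solve 2 (λ ρ κ → (con 1ℚ :+ κ) :* ρ := ρ :+ ρ :* κ) refl ρ κ) (cong (ρ ℚ.+_) ρκ)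
    in 1ℚ ℚ.+ κ ,
       <-by 0<κ (solve 1 (λ κ → κ := con 1ℚ :+ κ :- con 1ℚ) refl κ) ,
       0<* (0<+ 0<1 (ℚₚ.<⇒≤ 0<κ)) 0<ρ ,
       subst (ℚ._< 1ℚ) (sym σρ) (<-by (0<½* (0<ᵈ ρ<1))
         (solve 1 (λ ρ → con ½ :* (con 1ℚ :- ρ) := con 1ℚ :- (ρ :+ con ½ :* (con 1ℚ :- ρ))) refl ρ))

  Subexponential-*-Geometric : ∀ {f g} → Subexponential f → Geometric g → Geometric (λ n → f n * g n)
  Subexponential-*-Geometric F (geometric 0<ρ ρ<1 G) =
    let σ , 1<σ , 0<σρ , σρ<1 = room 0<ρ ρ<1 in geometric 0<σρ σρ<1 (O-* (F σ 1<σ) G)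

  Geometric⇒⟶ : ∀ {f L} → Geometric (λ n → f n - L) → f ⟶ L
  Geometric⇒⟶ (geometric 0<ρ ρ<1 (O-by C 0≤C h)) ε (δ , 0<δ , k) =
    let N , small = *↑-small 0≤C (ℚₚ.<⇒≤ 0<ρ) ρ<1 0<δ
    in N , λ n le → ≼⇒∣∣< {ε = ε} (h n) (small n le) k

-- Series and Cauchy products

≡⇒≈ : ∀ {z w} → z ≡ w → z ≈ w
≡⇒≈ refl = ≈-refl

-‿cong : ∀ {z z′ w w′} → z ≈ z′ → w ≈ w′ → z - w ≈ z′ - w′
-‿cong h k = +-cong h (neg-cong k)

-- The Cauchy product ∑ⱼ f (n - j) g j, written by shifting g so that no subtraction of indices
-- occurs.
conv : (ℕ → ℂ) → (ℕ → ℂ) → ℕ → ℂ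
conv f g zero    = f 0 * g 0
conv f g (suc n) = f (suc n) * g 0 + conv f (λ j → g (suc j)) n

Sums : (ℕ → ℂ) → ℂ → Set
Sums f S = Geometric (λ N → ∑ N f - S)

opaque
  ∑-cong : ∀ {f g} → (∀ n → f n ≈ g n) → ∀ N → ∑ N f ≈ ∑ N g
  ∑-cong e zero    = ≈-refl
  ∑-cong e (suc N) = +-cong (∑-cong e N) (e N)

  ∑-+ : ∀ (f g : ℕ → ℂ) N → ∑ N (λ n → f n + g n) ≈ ∑ N f + ∑ N g
  ∑-+ f g zero    = ring 0 (⟪ 0ℚ ⟫ ⩵ ⟪ 0ℚ ⟫ ⊕ ⟪ 0ℚ ⟫) ≈-refl
  ∑-+ f g (suc N) = ≈-trans (+-cong (∑-+ f g N) ≈-refl)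
    (ring 4 (λ a b c d → (a ⊕ b) ⊕ (c ⊕ d) ⩵ (a ⊕ c) ⊕ (b ⊕ d)) ≈-refl (∑ N f) (∑ N g) (f N) (g N))

  ∑-scale : ∀ c (f : ℕ → ℂ) N → ∑ N (λ n → c * f n) ≈ c * ∑ N f
  ∑-scale c f zero    = ring 1 (λ c → ⟪ 0ℚ ⟫ ⩵ c ⊗ ⟪ 0ℚ ⟫) ≈-refl c
  ∑-scale c f (suc N) = ≈-trans (+-cong (∑-scale c f N) ≈-refl)
    (ring 3 (λ c a b → c ⊗ a ⊕ c ⊗ b ⩵ c ⊗ (a ⊕ b)) ≈-refl c (∑ N f) (f N))

  ∑-split : ∀ (f : ℕ → ℂ) m k → ∑ (m +ℕ k) f ≈ ∑ m f + ∑ k (λ i → f (m +ℕ i))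
  ∑-split f m zero    = ≈-trans (≡⇒≈ (cong (λ n → ∑ n f) (ℕₚ.+-identityʳ m)))
    (ring 1 (λ a → a ⩵ a ⊕ ⟪ 0ℚ ⟫) ≈-refl (∑ m f))
  ∑-split f m (suc k) = ≈-trans (≡⇒≈ (cong (λ n → ∑ n f) (ℕₚ.+-suc m k)))
    (≈-trans (+-cong (∑-split f m k) ≈-refl)
      (ring 3 (λ a b c → (a ⊕ b) ⊕ c ⩵ a ⊕ (b ⊕ c)) ≈-refl (∑ m f) (∑ k (λ i → f (m +ℕ i))) (f (m +ℕ k))))

  -- Here v = 1/(1 - ρ). The induction carries the exact geometric sum C v (1 - ρᴺ), which is then
  -- bounded uniformly in N.
  ∑-≼ : ∀ {f C ρ v} → 0ℚ ℚ.≤ C → 0ℚ ℚ.< ρ → 0ℚ ℚ.≤ v → v ℚ.* (1ℚ ℚ.- ρ) ≡ 1ℚ →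
    (∀ n → f n ≼ C ℚ.* ρ ↑ n) → ∀ N → ∑ N f ≼ C ℚ.* v
  ∑-≼ {f} {C} {ρ} {v} 0≤C 0<ρ 0≤v v[1-ρ] h N = ≼-mono
    (≤-by (0≤* (0≤* 0≤C 0≤v) (↑-nonNeg N (ℚₚ.<⇒≤ 0<ρ)))
      (solve 3 (λ C v P → C :* v :* P := C :* v :- C :* v :* (con 1ℚ :- P)) refl C v (ρ ↑ N)))
    (partial N)
    where
    partial : ∀ N → ∑ N f ≼ C ℚ.* v ℚ.* (1ℚ ℚ.- ρ ↑ N)
    partial zero    = subst (0ℂ ≼_) (solve 1 (λ C → con 0ℚ := C :* (con 1ℚ :- con 1ℚ)) refl (C ℚ.* v)) (0≼ ℚₚ.≤-refl)
    partial (suc N) = subst (∑ (suc N) f ≼_)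
      (trans (cong (λ x → C ℚ.* v ℚ.* (1ℚ ℚ.- ρ ↑ N) ℚ.+ C ℚ.* x)
                (trans (sym (ℚₚ.*-identityˡ (ρ ↑ N))) (cong (ℚ._* ρ ↑ N) (sym v[1-ρ]))))
        (solve 4 (λ C v ρ P → C :* v :* (con 1ℚ :- P) :+ C :* (v :* (con 1ℚ :- ρ) :* P) :=
          C :* v :* (con 1ℚ :- ρ :* P)) refl C v ρ (ρ ↑ N)))
      (≼-+ (partial N) (h N))

  conv-cong : ∀ {f f′ g g′} → (∀ n → f n ≈ f′ n) → (∀ n → g n ≈ g′ n) → ∀ n → conv f g n ≈ conv f′ g′ n
  conv-cong h k zero    = *-cong (h 0) (k 0)
  conv-cong h k (suc n) = +-cong (*-cong (h (suc n)) (k 0)) (conv-cong h (λ j → k (suc j)) n)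

  conv-+ʳ : ∀ (f g h : ℕ → ℂ) n → conv f (λ j → g j + h j) n ≈ conv f g n + conv f h n
  conv-+ʳ f g h zero    = ring 3 (λ f g h → f ⊗ (g ⊕ h) ⩵ f ⊗ g ⊕ f ⊗ h) ≈-refl (f 0) (g 0) (h 0)
  conv-+ʳ f g h (suc n) = ≈-trans (+-cong ≈-refl (conv-+ʳ f (λ j → g (suc j)) (λ j → h (suc j)) n))
    (ring 5 (λ f g h a b → f ⊗ (g ⊕ h) ⊕ (a ⊕ b) ⩵ (f ⊗ g ⊕ a) ⊕ (f ⊗ h ⊕ b)) ≈-refl
      (f (suc n)) (g 0) (h 0) (conv f (λ j → g (suc j)) n) (conv f (λ j → h (suc j)) n))

  conv-+ˡ : ∀ (f g h : ℕ → ℂ) n → conv (λ j → f j + g j) h n ≈ conv f h n + conv g h n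
  conv-+ˡ f g h zero    = ring 3 (λ f g h → (f ⊕ g) ⊗ h ⩵ f ⊗ h ⊕ g ⊗ h) ≈-refl (f 0) (g 0) (h 0)
  conv-+ˡ f g h (suc n) = ≈-trans (+-cong ≈-refl (conv-+ˡ f g (λ j → h (suc j)) n))
    (ring 5 (λ f g h a b → (f ⊕ g) ⊗ h ⊕ (a ⊕ b) ⩵ (f ⊗ h ⊕ a) ⊕ (g ⊗ h ⊕ b)) ≈-refl
      (f (suc n)) (g (suc n)) (h 0) (conv f (λ j → h (suc j)) n) (conv g (λ j → h (suc j)) n))

  conv-scaleʳ : ∀ c (f g : ℕ → ℂ) n → conv f (λ j → c * g j) n ≈ c * conv f g n
  conv-scaleʳ c f g zero    = ring 3 (λ c f g → f ⊗ (c ⊗ g) ⩵ c ⊗ (f ⊗ g)) ≈-refl c (f 0) (g 0)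
  conv-scaleʳ c f g (suc n) = ≈-trans (+-cong ≈-refl (conv-scaleʳ c f (λ j → g (suc j)) n))
    (ring 4 (λ c f g a → f ⊗ (c ⊗ g) ⊕ c ⊗ a ⩵ c ⊗ (f ⊗ g ⊕ a)) ≈-refl
      c (f (suc n)) (g 0) (conv f (λ j → g (suc j)) n))

  conv-scaleˡ : ∀ c (f g : ℕ → ℂ) n → conv (λ j → c * f j) g n ≈ c * conv f g n
  conv-scaleˡ c f g zero    = ring 3 (λ c f g → (c ⊗ f) ⊗ g ⩵ c ⊗ (f ⊗ g)) ≈-refl c (f 0) (g 0)
  conv-scaleˡ c f g (suc n) = ≈-trans (+-cong ≈-refl (conv-scaleˡ c f (λ j → g (suc j)) n))
    (ring 4 (λ c f g a → (c ⊗ f) ⊗ g ⊕ c ⊗ a ⩵ c ⊗ (f ⊗ g ⊕ a)) ≈-refl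
      c (f (suc n)) (g 0) (conv f (λ j → g (suc j)) n))

  conv-sucˡ : ∀ (f g : ℕ → ℂ) n → conv f g (suc n) ≈ conv (λ i → f (suc i)) g n + f 0 * g (suc n)
  conv-sucˡ f g zero    = ≈-refl
  conv-sucˡ f g (suc n) = ≈-trans (+-cong ≈-refl (conv-sucˡ f (λ j → g (suc j)) n))
    (ring 3 (λ a b c → a ⊕ (b ⊕ c) ⩵ (a ⊕ b) ⊕ c) ≈-refl
      (f (suc (suc n)) * g 0) (conv (λ i → f (suc i)) (λ j → g (suc j)) n) (f 0 * g (suc (suc n))))

  conv-^ : ∀ s (f g : ℕ → ℂ) n → s ^ n * conv f g n ≈ conv (λ i → s ^ i * f i) (λ j → s ^ j * g j) n
  conv-^ s f g zero    = ring 2 (λ f g → ⟪ 1ℚ ⟫ ⊗ (f ⊗ g) ⩵ (⟪ 1ℚ ⟫ ⊗ f) ⊗ (⟪ 1ℚ ⟫ ⊗ g)) ≈-refl (f 0) (g 0)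
  conv-^ s f g (suc n) = begin
    s * s ^ n * (f (suc n) * g 0 + conv f g⁺ n)
      ≈⟨ ring 5 (λ s p f g a → s ⊗ p ⊗ (f ⊗ g ⊕ a) ⩵ (s ⊗ p ⊗ f) ⊗ (⟪ 1ℚ ⟫ ⊗ g) ⊕ s ⊗ (p ⊗ a)) ≈-refl
           s (s ^ n) (f (suc n)) (g 0) (conv f g⁺ n) ⟩
    s * s ^ n * f (suc n) * (1ℂ * g 0) + s * (s ^ n * conv f g⁺ n)
      ≈⟨ +-cong ≈-refl (*-cong ≈-refl (conv-^ s f g⁺ n)) ⟩
    s * s ^ n * f (suc n) * (1ℂ * g 0) + s * conv (λ i → s ^ i * f i) (λ j → s ^ j * g⁺ j) n
      ≈⟨ +-cong ≈-refl (≈-sym (conv-scaleʳ s (λ i → s ^ i * f i) (λ j → s ^ j * g⁺ j) n)) ⟩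
    s * s ^ n * f (suc n) * (1ℂ * g 0) + conv (λ i → s ^ i * f i) (λ j → s * (s ^ j * g⁺ j)) n
      ≈⟨ +-cong ≈-refl (conv-cong (λ _ → ≈-refl)
           (λ j → ring 3 (λ s p g → s ⊗ (p ⊗ g) ⩵ s ⊗ p ⊗ g) ≈-refl s (s ^ j) (g⁺ j)) n) ⟩
    s * s ^ n * f (suc n) * (1ℂ * g 0) + conv (λ i → s ^ i * f i) (λ j → s * s ^ j * g⁺ j) n ∎
    where
    open ≈-Reasoning
    g⁺ : ℕ → ℂ
    g⁺ j = g (suc j)

  -- In generating functions, partial sums are multiplication by 1/(1 - T), which may be applied to
  -- either factor.
  ∑-conv : ∀ (f g : ℕ → ℂ) N → ∑ N (conv f g) ≈ conv (λ M → ∑ M f) g N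
  ∑-conv f g zero    = ring 1 (λ a → ⟪ 0ℚ ⟫ ⩵ ⟪ 0ℚ ⟫ ⊗ a) ≈-refl (g 0)
  ∑-conv f g (suc N) = begin
    ∑ N (conv f g) + conv f g N                                  ≈⟨ +-cong (∑-conv f g N) ≈-refl ⟩
    conv (λ M → ∑ M f) g N + conv f g N                          ≈⟨ ≈-sym (conv-+ˡ (λ M → ∑ M f) f g N) ⟩
    conv (λ M → ∑ (suc M) f) g N
      -- The added zero is the empty sum `∑ 0 f` times `g (suc N)`, the end term that `conv-sucˡ`
      -- expects.
      ≈⟨ ring 2 (λ a b → a ⩵ a ⊕ ⟪ 0ℚ ⟫ ⊗ b) ≈-refl (conv (λ M → ∑ (suc M) f) g N) (g (suc N)) ⟩
    conv (λ M → ∑ (suc M) f) g N + 0ℂ * g (suc N)                ≈⟨ ≈-sym (conv-sucˡ (λ M → ∑ M f) g N) ⟩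
    conv (λ M → ∑ M f) g (suc N)                                 ∎
    where open ≈-Reasoning

  conv-1ˡ : ∀ c (g : ℕ → ℂ) n → conv (λ _ → c) g n ≈ c * ∑ (suc n) g
  conv-1ˡ c g zero    = ring 2 (λ c a → c ⊗ a ⩵ c ⊗ (⟪ 0ℚ ⟫ ⊕ a)) ≈-refl c (g 0)
  conv-1ˡ c g (suc n) = ≈-trans (conv-sucˡ (λ _ → c) g n) (≈-trans (+-cong (conv-1ˡ c g n) ≈-refl)
    (ring 3 (λ c a b → c ⊗ a ⊕ c ⊗ b ⩵ c ⊗ (a ⊕ b)) ≈-refl c (∑ (suc n) g) (g (suc n))))

  -- Each of the n + 1 terms is at most C D ρⁿ; in the recursion the shifted g has D ρ in place of
  -- D.
  conv-≼ : ∀ f g {C D ρ} → 0ℚ ℚ.≤ C → 0ℚ ℚ.≤ D → 0ℚ ℚ.≤ ρ →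
    (∀ n → f n ≼ C ℚ.* ρ ↑ n) → (∀ n → g n ≼ D ℚ.* ρ ↑ n) →
    ∀ n → conv f g n ≼ (1ℚ ℚ.+ fromℕ n) ℚ.* (C ℚ.* D ℚ.* ρ ↑ n)
  conv-≼ f g {C} {D} {ρ} 0≤C 0≤D 0≤ρ h k zero    = subst (f 0 * g 0 ≼_)
    (solve 2 (λ C D → (C :* con 1ℚ) :* (D :* con 1ℚ) := (con 1ℚ :+ con 0ℚ) :* (C :* D :* con 1ℚ)) refl C D)
    (≼-* (h 0) (k 0))
  conv-≼ f g {C} {D} {ρ} 0≤C 0≤D 0≤ρ h k (suc n) = subst (conv f g (suc n) ≼_)
    (solve 5 (λ C D r P N → (C :* (r :* P)) :* (D :* con 1ℚ) :+ (con 1ℚ :+ N) :* (C :* (D :* r) :* P) :=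
      (con 1ℚ :+ (con 1ℚ :+ N)) :* (C :* D :* (r :* P))) refl C D ρ (ρ ↑ n) (fromℕ n))
    (≼-+ (≼-* (h (suc n)) (k 0))
      (conv-≼ f (λ j → g (suc j)) 0≤C (0≤* 0≤D 0≤ρ) 0≤ρ h
        (λ j → subst (g (suc j) ≼_) (sym (ℚₚ.*-assoc D ρ (ρ ↑ j))) (k (suc j))) n))

  -- By Bernoulli's inequality, (n + 1) ρⁿ = O(σⁿ) for ρ < σ.
  Geometric-conv : ∀ {f g} → Geometric f → Geometric g → Geometric (conv f g)
  Geometric-conv {f} {g} F G with Geometric-common F G
  ... | ρ , 0<ρ , ρ<1 , O-by C 0≤C h , O-by D 0≤D k with room 0<ρ ρ<1
  ... | s , 1<s , 0<σ , σ<1 = geometric 0<σ σ<1 (O-by (C ℚ.* D ℚ.* (1ℚ ℚ.+ η)) (0≤* 0≤CD (0≤+ 0≤1 (ℚₚ.<⇒≤ 0<η)))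
      (λ n → ≼-mono (bound≤ n) (conv-≼ f g 0≤C 0≤D (ℚₚ.<⇒≤ 0<ρ) h k n)))
    where
    σ : ℚ
    σ = s ℚ.* ρ
    0≤CD : 0ℚ ℚ.≤ C ℚ.* D
    0≤CD = 0≤* 0≤C 0≤D
    ρ<σ : ρ ℚ.< σ
    ρ<σ = <-by (0<* (0<ᵈ 1<s) 0<ρ) (solve 2 (λ s ρ → (s :- con 1ℚ) :* ρ := s :* ρ :- ρ) refl s ρ)
    inverse : ∃[ η ] (0ℚ ℚ.< η × (σ ℚ.- ρ) ℚ.* η ≡ 1ℚ)
    inverse = divide (0<ᵈ ρ<σ) 0<1
    η : ℚ
    η = proj₁ inverse
    0<η : 0ℚ ℚ.< η
    0<η = proj₁ (proj₂ inverse)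

    bound≤ : ∀ n → (1ℚ ℚ.+ fromℕ n) ℚ.* (C ℚ.* D ℚ.* ρ ↑ n) ℚ.≤ C ℚ.* D ℚ.* (1ℚ ℚ.+ η) ℚ.* σ ↑ n
    bound≤ n = ≤-by (0≤* 0≤CD (0≤+
        (0≤ᵈ (↑-mono n (ℚₚ.<⇒≤ 0<ρ) (ℚₚ.<⇒≤ ρ<σ)))
        (0≤* (ℚₚ.<⇒≤ 0<η)
          (0≤+ (0≤ᵈ (bernoulli {ρ} {σ} n (ℚₚ.<⇒≤ 0<ρ) (ℚₚ.<⇒≤ ρ<σ) (ℚₚ.<⇒≤ ρ<1))) (↑-nonNeg n (ℚₚ.<⇒≤ 0<ρ))))))
      (trans (solve 7 (λ A η P Q N σ ρ →
          A :* ((Q :- P) :+ η :* ((Q :- (P :+ (σ :- ρ) :* (N :* P))) :+ P)) :=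
          A :* (Q :+ η :* Q :- P) :- A :* N :* P :* ((σ :- ρ) :* η)) refl
          (C ℚ.* D) η (ρ ↑ n) (σ ↑ n) (fromℕ n) σ ρ)
        (trans (cong (λ x → C ℚ.* D ℚ.* (σ ↑ n ℚ.+ η ℚ.* σ ↑ n ℚ.- ρ ↑ n) ℚ.- C ℚ.* D ℚ.* fromℕ n ℚ.* ρ ↑ n ℚ.* x)
                 (proj₂ (proj₂ inverse)))
          (solve 5 (λ A η P Q N → A :* (Q :+ η :* Q :- P) :- A :* N :* P :* con 1ℚ :=
            A :* (con 1ℚ :+ η) :* Q :- (con 1ℚ :+ N) :* (A :* P)) refl
            (C ℚ.* D) η (ρ ↑ n) (σ ↑ n) (fromℕ n))))

  Sums-cong : ∀ {f g S} → (∀ n → f n ≈ g n) → Sums f S → Sums g S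
  Sums-cong e = Geometric-cong (λ N → -‿cong (∑-cong e N) ≈-refl)

  Sums-resp : ∀ {f S T} → S ≈ T → Sums f S → Sums f T
  Sums-resp e = Geometric-cong (λ N → -‿cong ≈-refl e)

  Sums-+ : ∀ {f g S T} → Sums f S → Sums g T → Sums (λ n → f n + g n) (S + T)
  Sums-+ {f} {g} {S} {T} F G = Geometric-cong
    (λ N → ≈-trans (ring 4 (λ a b S T → (a ⊖ S) ⊕ (b ⊖ T) ⩵ (a ⊕ b) ⊖ (S ⊕ T)) ≈-refl (∑ N f) (∑ N g) S T)
      (-‿cong (≈-sym (∑-+ f g N)) ≈-refl))
    (Geometric-+ F G)

  Sums-scale : ∀ {f S} c → Sums f S → Sums (λ n → c * f n) (c * S)
  Sums-scale {f} {S} c F = Geometric-cong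
    (λ N → ≈-trans (ring 3 (λ c a S → c ⊗ (a ⊖ S) ⩵ c ⊗ a ⊖ c ⊗ S) ≈-refl c (∑ N f) S)
      (-‿cong (≈-sym (∑-scale c f N)) ≈-refl))
    (Geometric-scale c F)

  Sums⇒Geometric : ∀ {f S} → Sums f S → Geometric f
  Sums⇒Geometric {f} {S} F = Geometric-cong
    (λ N → ring 3 (λ a b S → ((a ⊕ b) ⊖ S) ⊕ ⟪ ℚ.- 1ℚ ⟫ ⊗ (a ⊖ S) ⩵ b) ≈-refl (∑ N f) (f N) S)
    (Geometric-+ (Geometric-drop 1 F) (Geometric-scale (ι (ℚ.- 1ℚ)) F))

  -- The block of terms from m onwards is at most C v ρᵐ with v = 1/(1 - ρ), so the partial sums
  -- meet the hypothesis of `complete-ℂ`.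
  summable : ∀ {f} → Geometric f → ∃[ S ] Sums f S
  summable {f} (geometric {ρ} 0<ρ ρ<1 (O-by C 0≤C h)) =
    let S , B , 0≤B , near = complete-ℂ (λ N → ∑ N f) (0≤* 0≤C 0≤v) 0<ρ ρ<1
          (λ m n m≤n → subst (λ n → ∑ n f - ∑ m f ≼ C ℚ.* v ℚ.* ρ ↑ m) (ℕₚ.m+[n∸m]≡n m≤n) (tail m (n ℕ.∸ m)))
    in S , geometric 0<ρ ρ<1 (O-by B 0≤B λ N → ≼-cong (neg-sub S (∑ N f)) (≼-neg (near N)))
    where
    inverse : ∃[ v ] (0ℚ ℚ.< v × (1ℚ ℚ.- ρ) ℚ.* v ≡ 1ℚ)
    inverse = divide (0<ᵈ ρ<1) 0<1
    v : ℚ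
    v = proj₁ inverse
    0≤v : 0ℚ ℚ.≤ v
    0≤v = ℚₚ.<⇒≤ (proj₁ (proj₂ inverse))

    tail : ∀ m k → ∑ (m +ℕ k) f - ∑ m f ≼ C ℚ.* v ℚ.* ρ ↑ m
    tail m k = ≼-cong
      (≈-trans (ring 2 (λ a b → b ⩵ (a ⊕ b) ⊖ a) ≈-refl (∑ m f) (∑ k (λ i → f (m +ℕ i))))
        (-‿cong (≈-sym (∑-split f m k)) ≈-refl))
      (subst (∑ k (λ i → f (m +ℕ i)) ≼_) (rearrange C (ρ ↑ m) v)
        (∑-≼ {λ i → f (m +ℕ i)} {C ℚ.* ρ ↑ m} {ρ} {v} (0≤* 0≤C (↑-nonNeg m (ℚₚ.<⇒≤ 0<ρ))) 0<ρ 0≤v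
          (trans (ℚₚ.*-comm v (1ℚ ℚ.- ρ)) (proj₂ (proj₂ inverse)))
          (λ i → subst (f (m +ℕ i) ≼_)
            (trans (cong (C ℚ.*_) (↑-homo ρ m i)) (sym (ℚₚ.*-assoc C (ρ ↑ m) (ρ ↑ i)))) (h (m +ℕ i))) k))
      where
      rearrange : ∀ C P v → (C ℚ.* P) ℚ.* v ≡ C ℚ.* v ℚ.* P
      rearrange = solve 3 (λ C P v → (C :* P) :* v := C :* v :* P) refl

  -- ∑ (f ⋆ g) = (∑ f) ⋆ g = (∑ f - S) ⋆ g + S ∑ g, and the first term decays geometrically.
  Sums-conv : ∀ {f g S T} → Sums f S → Sums g T → Sums (conv f g) (S * T)
  Sums-conv {f} {g} {S} {T} F G = Geometric-cong
    (λ N → begin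
      conv (λ M → ∑ M f - S) g N + S * (∑ (suc N) g - T)
        ≈⟨ ring 4 (λ a S b T → a ⊕ S ⊗ (b ⊖ T) ⩵ (a ⊕ S ⊗ b) ⊖ S ⊗ T) ≈-refl
             (conv (λ M → ∑ M f - S) g N) S (∑ (suc N) g) T ⟩
      conv (λ M → ∑ M f - S) g N + S * ∑ (suc N) g - S * T
        ≈⟨ -‿cong (+-cong ≈-refl (≈-sym (conv-1ˡ S g N))) ≈-refl ⟩
      conv (λ M → ∑ M f - S) g N + conv (λ _ → S) g N - S * T
        ≈⟨ -‿cong (≈-sym (conv-+ˡ (λ M → ∑ M f - S) (λ _ → S) g N)) ≈-refl ⟩
      conv (λ M → ∑ M f - S + S) g N - S * T
        ≈⟨ -‿cong (conv-cong (λ M → ring 2 (λ a S → a ⊖ S ⊕ S ⩵ a) ≈-refl (∑ M f) S) (λ _ → ≈-refl) N) ≈-refl ⟩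
      conv (λ M → ∑ M f) g N - S * T
        ≈⟨ -‿cong (≈-sym (∑-conv f g N)) ≈-refl ⟩
      ∑ N (conv f g) - S * T ∎)
    (Geometric-+ (Geometric-conv F (Sums⇒Geometric G)) (Geometric-scale S (Geometric-drop 1 G)))
    where open ≈-Reasoning

-- In generating functions h is (1 - u T) f, so at T = 1 the sum is multiplied by 1 - u. Euler's
-- series uses this forwards, the q-binomial theorem backwards.
module _ (f h : ℕ → ℂ) (u : ℂ) (h₀ : h 0 ≈ f 0) (h₊ : ∀ n → h (suc n) ≈ f (suc n) - u * f n) where

  opaque
    ∑-difference : ∀ N → ∑ (suc N) h ≈ (1ℂ - u) * ∑ N f + f N
    ∑-difference zero    = ≈-trans (+-cong ≈-refl h₀)
      (ring 2 (λ u a → ⟪ 0ℚ ⟫ ⊕ a ⩵ (⟪ 1ℚ ⟫ ⊖ u) ⊗ ⟪ 0ℚ ⟫ ⊕ a) ≈-refl u (f 0))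
    ∑-difference (suc N) = ≈-trans (+-cong (∑-difference N) (h₊ N))
      (ring 4 (λ u a b c → ((⟪ 1ℚ ⟫ ⊖ u) ⊗ a ⊕ b) ⊕ (c ⊖ u ⊗ b) ⩵ (⟪ 1ℚ ⟫ ⊖ u) ⊗ (a ⊕ b) ⊕ c) ≈-refl
        u (∑ N f) (f N) (f (suc N)))

    Sums-difference : ∀ {S} → Sums f S → Sums h ((1ℂ - u) * S)
    Sums-difference {S} F = Geometric-cons (Geometric-cong
      (λ N → ≈-trans
        (ring 4 (λ u a S b → (⟪ 1ℚ ⟫ ⊖ u) ⊗ (a ⊖ S) ⊕ b ⩵ ((⟪ 1ℚ ⟫ ⊖ u) ⊗ a ⊕ b) ⊖ (⟪ 1ℚ ⟫ ⊖ u) ⊗ S) ≈-refl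
          u (∑ N f) S (f N))
        (-‿cong (≈-sym (∑-difference N)) ≈-refl))
      (Geometric-+ (Geometric-scale (1ℂ - u) F) (Sums⇒Geometric F)))

    -- The partial sums of h and those of f, multiplied by 1 - u, differ by the boundary term f N;
    -- the decay assumed of f disposes of it.
    Sums-undifference : ∀ {S v} → v * (1ℂ - u) ≈ 1ℂ → Geometric f → Sums h S → Sums f (v * S)
    Sums-undifference {S} {v} v[1-u] F H = Geometric-cong
      (λ N → begin
        v * (∑ (suc N) h - S) + (0ℂ - v) * f N
          ≈⟨ +-cong (*-cong ≈-refl (-‿cong (∑-difference N) ≈-refl)) ≈-refl ⟩
        v * ((1ℂ - u) * ∑ N f + f N - S) + (0ℂ - v) * f N
          ≈⟨ ring 5 (λ v w a b S → v ⊗ (w ⊗ a ⊕ b ⊖ S) ⊕ (⟪ 0ℚ ⟫ ⊖ v) ⊗ b ⩵ v ⊗ w ⊗ a ⊖ v ⊗ S) ≈-refl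
               v (1ℂ - u) (∑ N f) (f N) S ⟩
        v * (1ℂ - u) * ∑ N f - v * S
          ≈⟨ -‿cong (*-cong v[1-u] ≈-refl) ≈-refl ⟩
        1ℂ * ∑ N f - v * S
          ≈⟨ ring 2 (λ a b → ⟪ 1ℚ ⟫ ⊗ a ⊖ b ⩵ a ⊖ b) ≈-refl (∑ N f) (v * S) ⟩
        ∑ N f - v * S ∎)
      (Geometric-+ (Geometric-scale v (Geometric-drop 1 H)) (Geometric-scale (0ℂ - v) F))
      where open ≈-Reasoning

-- Inverses, powers and finite combinations of series

opaque
  inverse : ∀ w → NonZero w → ℂ
  inverse w w≢0 = 1ℂ / w ⟨ w≢0 ⟩

  inverse-* : ∀ w w≢0 → inverse w w≢0 * w ≈ 1ℂ
  inverse-* = /-* 1ℂ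

  *-cancel : ∀ {u v w w′} → w′ * w ≈ 1ℂ → u * w ≈ v * w → u ≈ v
  *-cancel {u} {v} {w} {w′} e h = begin
    u               ≈⟨ ring 1 (λ u → u ⩵ u ⊗ ⟪ 1ℚ ⟫) ≈-refl u ⟩
    u * 1ℂ          ≈⟨ *-cong ≈-refl (≈-sym e) ⟩
    u * (w′ * w)    ≈⟨ ring 3 (λ u w w′ → u ⊗ (w′ ⊗ w) ⩵ (u ⊗ w) ⊗ w′) ≈-refl u w w′ ⟩
    u * w * w′      ≈⟨ *-cong h ≈-refl ⟩
    v * w * w′      ≈⟨ ring 3 (λ u w w′ → (u ⊗ w) ⊗ w′ ⩵ u ⊗ (w′ ⊗ w)) ≈-refl v w w′ ⟩
    v * (w′ * w)    ≈⟨ *-cong ≈-refl e ⟩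
    v * 1ℂ          ≈⟨ ring 1 (λ u → u ⊗ ⟪ 1ℚ ⟫ ⩵ u) ≈-refl v ⟩
    v               ∎
    where open ≈-Reasoning

  /-unique : ∀ {u z w} (w≢0 : NonZero w) → u * w ≈ z → u ≈ z / w ⟨ w≢0 ⟩
  /-unique {z = z} {w} w≢0 e = *-cancel (inverse-* w w≢0) (≈-trans e (≈-sym (/-* z w w≢0)))

  inverse-unique : ∀ {u v w} → u * w ≈ 1ℂ → v * w ≈ 1ℂ → u ≈ v
  inverse-unique e h = *-cancel e (≈-trans e (≈-sym h))

  nonZero-unit : ∀ {u w} → u * w ≈ 1ℂ → NonZero u
  nonZero-unit {u} {w} e = nonZero-factor {u} {w} (nonZero-from-1 {u * w} 0<1
    (≼-cong (≈-trans (ring 0 (⟪ 0ℚ ⟫ ⩵ ⟪ 1ℚ ⟫ ⊖ ⟪ 1ℚ ⟫) ≈-refl) (-‿cong ≈-refl (≈-sym e))) (0≼ ℚₚ.≤-refl)))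

  ^-cong : ∀ {z w} → z ≈ w → ∀ n → z ^ n ≈ w ^ n
  ^-cong e zero    = ≈-refl
  ^-cong e (suc n) = *-cong e (^-cong e n)

  ^-+ : ∀ z m n → z ^ (m +ℕ n) ≈ z ^ m * z ^ n
  ^-+ z zero    n = ring 1 (λ a → a ⩵ ⟪ 1ℚ ⟫ ⊗ a) ≈-refl (z ^ n)
  ^-+ z (suc m) n = ≈-trans (*-cong ≈-refl (^-+ z m n))
    (ring 3 (λ z a b → z ⊗ (a ⊗ b) ⩵ (z ⊗ a) ⊗ b) ≈-refl z (z ^ m) (z ^ n))

  ^-* : ∀ z w n → (z * w) ^ n ≈ z ^ n * w ^ n
  ^-* z w zero    = ring 0 (⟪ 1ℚ ⟫ ⩵ ⟪ 1ℚ ⟫ ⊗ ⟪ 1ℚ ⟫) ≈-refl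
  ^-* z w (suc n) = ≈-trans (*-cong ≈-refl (^-* z w n))
    (ring 4 (λ z w a b → (z ⊗ w) ⊗ (a ⊗ b) ⩵ (z ⊗ a) ⊗ (w ⊗ b)) ≈-refl z w (z ^ n) (w ^ n))

  ∏-cong : ∀ {f g} → (∀ n → f n ≈ g n) → ∀ N → ∏ N f ≈ ∏ N g
  ∏-cong e zero    = ≈-refl
  ∏-cong e (suc N) = *-cong (∏-cong e N) (e N)

  ∑-∸-conv : ∀ (f g : ℕ → ℂ) n → ∑ (suc n) (λ j → f (n ℕ.∸ j) * g j) ≈ conv f g n
  ∑-∸-conv f g zero    = ring 1 (λ a → ⟪ 0ℚ ⟫ ⊕ a ⩵ a) ≈-refl (f 0 * g 0)
  ∑-∸-conv f g (suc n) = ≈-trans (∑-split (λ j → f (suc n ℕ.∸ j) * g j) 1 (suc n))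
    (+-cong (ring 1 (λ a → ⟪ 0ℚ ⟫ ⊕ a ⩵ a) ≈-refl (f (suc n) * g 0)) (∑-∸-conv f (λ j → g (suc j)) n))

  Sums-scaleʳ : ∀ {f S} → Sums f S → ∀ c → Sums (λ n → f n * c) (S * c)
  Sums-scaleʳ {f} {S} F c = Sums-resp (comm c S) (Sums-cong (λ n → comm c (f n)) (Sums-scale c F))
    where
    comm : ∀ a b → a * b ≈ b * a
    comm = ring 2 (λ a b → a ⊗ b ⩵ b ⊗ a) ≈-refl

  -- The exchange of the sums over m and l: for each n only l ≤ n occur.
  conv-Sums : ∀ (g : ℕ → ℕ → ℂ) (K f : ℕ → ℂ) → (∀ l → Sums (g l) (K l)) →
    ∀ n → Sums (λ m → conv (λ l → g l m) f n) (conv K f n)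
  conv-Sums g K f h zero    = Sums-scaleʳ (h 0) (f 0)
  conv-Sums g K f h (suc n) = Sums-+ (Sums-scaleʳ (h (suc n)) (f 0)) (conv-Sums g K (λ j → f (suc j)) h n)

-- q-series

module _ (q : ℂ) where

  opaque
    qPoch-cong : ∀ {a b} → a ≈ b → ∀ n → qPoch a q n ≈ qPoch b q n
    qPoch-cong e = ∏-cong (λ j → -‿cong ≈-refl (*-cong ≈-refl e))

    qPoch-split : ∀ a m n → qPoch a q (m +ℕ n) ≈ qPoch a q m * qPoch (q ^ m * a) q n
    qPoch-split a m zero    = ≈-trans (≡⇒≈ (cong (qPoch a q) (ℕₚ.+-identityʳ m)))
      (ring 1 (λ a → a ⩵ a ⊗ ⟪ 1ℚ ⟫) ≈-refl (qPoch a q m))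
    qPoch-split a m (suc n) = ≈-trans (≡⇒≈ (cong (qPoch a q) (ℕₚ.+-suc m n)))
      (≈-trans (*-cong (qPoch-split a m n) (-‿cong ≈-refl (*-cong (^-+ q m n) ≈-refl)))
        (ring 5 (λ P Q u v a → (P ⊗ Q) ⊗ (⟪ 1ℚ ⟫ ⊖ (u ⊗ v) ⊗ a) ⩵ P ⊗ (Q ⊗ (⟪ 1ℚ ⟫ ⊖ v ⊗ (u ⊗ a)))) ≈-refl
          (qPoch a q m) (qPoch (q ^ m * a) q n) (q ^ m) (q ^ n) a))

    qPoch-first : ∀ a n → qPoch a q (suc n) ≈ (1ℂ - a) * qPoch (q * a) q n
    qPoch-first a n = ≈-trans (qPoch-split a 1 n) (*-cong
      (ring 1 (λ a → ⟪ 1ℚ ⟫ ⊗ (⟪ 1ℚ ⟫ ⊖ ⟪ 1ℚ ⟫ ⊗ a) ⩵ ⟪ 1ℚ ⟫ ⊖ a) ≈-refl a)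
      (qPoch-cong (ring 2 (λ q a → (q ⊗ ⟪ 1ℚ ⟫) ⊗ a ⩵ q ⊗ a) ≈-refl q a) n))

    -- The weight 1 - qⁿ is a twisted derivation: 1 - q^(i+j) = (1 - q^i) + q^i (1 - q^j).
    conv-leibniz : ∀ (f g f′ g′ : ℕ → ℂ) →
      (∀ n → (1ℂ - q ^ n * q) * f (suc n) ≈ f′ n) → (∀ n → (1ℂ - q ^ n * q) * g (suc n) ≈ g′ n) →
      ∀ n → (1ℂ - q ^ n * q) * conv f g (suc n) ≈ conv f′ g n + conv (λ i → q ^ i * f i) g′ n
    conv-leibniz f g f′ g′ hf hg n = begin
      (1ℂ - q ^ n * q) * conv f g (suc n)
        ≈⟨ ring 3 (λ p q c → (⟪ 1ℚ ⟫ ⊖ p ⊗ q) ⊗ c ⩵ c ⊖ (q ⊗ p) ⊗ c) ≈-refl (q ^ n) q (conv f g (suc n)) ⟩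
      conv f g (suc n) - q ^ suc n * conv f g (suc n)
        ≈⟨ -‿cong (conv-cong {g = g} (λ i → split (q ^ i) (f i)) (λ _ → ≈-refl) (suc n)) (conv-^ q f g (suc n)) ⟩
      conv (λ i → δ f i + θ f i) g (suc n) - conv (θ f) (θ g) (suc n)
        ≈⟨ -‿cong (conv-+ˡ (δ f) (θ f) g (suc n)) ≈-refl ⟩
      conv (δ f) g (suc n) + conv (θ f) g (suc n) - conv (θ f) (θ g) (suc n)
        ≈⟨ -‿cong (+-cong ≈-refl
             (≈-trans (conv-cong {θ f} (λ _ → ≈-refl) (λ j → split (q ^ j) (g j)) (suc n))
               (conv-+ʳ (θ f) (δ g) (θ g) (suc n)))) ≈-refl ⟩
      conv (δ f) g (suc n) + (conv (θ f) (δ g) (suc n) + conv (θ f) (θ g) (suc n)) - conv (θ f) (θ g) (suc n)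
        ≈⟨ ring 3 (λ a b c → a ⊕ (b ⊕ c) ⊖ c ⩵ a ⊕ b) ≈-refl
             (conv (δ f) g (suc n)) (conv (θ f) (δ g) (suc n)) (conv (θ f) (θ g) (suc n)) ⟩
      conv (δ f) g (suc n) + conv (θ f) (δ g) (suc n)
        ≈⟨ +-cong (conv-sucˡ (δ f) g n) ≈-refl ⟩
      conv (λ i → δ f (suc i)) g n + δ f 0 * g (suc n) + (θ f (suc n) * δ g 0 + conv (θ f) (λ j → δ g (suc j)) n)
        -- Both end terms contain the weight 1 - q⁰ = 1 - 1 and vanish.
        ≈⟨ ring 6 (λ a b c d u v → a ⊕ (⟪ 1ℚ ⟫ ⊖ ⟪ 1ℚ ⟫) ⊗ u ⊗ c ⊕ (d ⊗ ((⟪ 1ℚ ⟫ ⊖ ⟪ 1ℚ ⟫) ⊗ v) ⊕ b) ⩵ a ⊕ b) ≈-refl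
             (conv (λ i → δ f (suc i)) g n) (conv (θ f) (λ j → δ g (suc j)) n) (g (suc n)) (θ f (suc n)) (f 0) (g 0) ⟩
      conv (λ i → δ f (suc i)) g n + conv (θ f) (λ j → δ g (suc j)) n
        ≈⟨ +-cong (conv-cong {g = g} (λ i → ≈-trans (swap i (f (suc i))) (hf i)) (λ _ → ≈-refl) n)
                  (conv-cong {θ f} (λ _ → ≈-refl) (λ j → ≈-trans (swap j (g (suc j))) (hg j)) n) ⟩
      conv f′ g n + conv (θ f) g′ n ∎
      where
      open ≈-Reasoning
      δ θ : (ℕ → ℂ) → ℕ → ℂ
      δ f i = (1ℂ - q ^ i) * f i
      θ f i = q ^ i * f i
      split : ∀ p a → a ≈ (1ℂ - p) * a + p * a
      split = ring 2 (λ p a → a ⩵ (⟪ 1ℚ ⟫ ⊖ p) ⊗ a ⊕ p ⊗ a) ≈-refl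
      swap : ∀ i a → (1ℂ - q ^ suc i) * a ≈ (1ℂ - q ^ i * q) * a
      swap i a = ring 3 (λ q p a → (⟪ 1ℚ ⟫ ⊖ q ⊗ p) ⊗ a ⩵ (⟪ 1ℚ ⟫ ⊖ p ⊗ q) ⊗ a) ≈-refl q (q ^ i) a

-- Euler's series and infinite products

module QSeries (q : ℂ) (∣q∣<1 : ∣ q ∣ <ᵣ 1ᵣ) where

  φ κ : ℕ → ℂ
  φ = qPoch q q
  κ n = inverse (φ n) (qPoch-q-nonZero q ∣q∣<1 n)

  -- The terms of Euler's series ∑ tⁿ/(q;q)ₙ = 1/(t;q)_∞.
  e : ℂ → ℕ → ℂ
  e t n = t ^ n * κ n

  opaque
    κφ : ∀ n → κ n * φ n ≈ 1ℂ
    κφ n = inverse-* (φ n) (qPoch-q-nonZero q ∣q∣<1 n)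

    κ₀ : κ 0 ≈ 1ℂ
    κ₀ = ≈-trans (ring 1 (λ a → a ⩵ a ⊗ ⟪ 1ℚ ⟫) ≈-refl (κ 0)) (κφ 0)

    κ-suc : ∀ n → κ n ≈ κ (suc n) * (1ℂ - q ^ n * q)
    κ-suc n = inverse-unique (κφ n)
      (≈-trans (ring 3 (λ k u p → k ⊗ u ⊗ p ⩵ k ⊗ (p ⊗ u)) ≈-refl (κ (suc n)) (1ℂ - q ^ n * q) (φ n)) (κφ (suc n)))

    q^n*a-small : ∀ a {ε} → 0ℚ ℚ.< ε → Eventually λ n → q ^ n * a ≼ ε
    q^n*a-small a {ε} 0<ε =
      let r , 0<r , r<1 , q≼r = radius<1 q ∣q∣<1
          A , 0<A , a≼A       = bounded-ℂ a
          N , h               = *↑-small (ℚₚ.<⇒≤ 0<A) (ℚₚ.<⇒≤ 0<r) r<1 0<ε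
      in N , λ n le → ≼-mono (ℚₚ.<⇒≤ (subst (ℚ._< ε) (ℚₚ.*-comm A (r ↑ n)) (h n le))) (≼-* (≼-^ n q≼r) a≼A)

    -- The ratios 1 - qⁿ a tend to 1, so their modulus is eventually at most 1 + (σ - 1) = σ.
    qPoch-subexponential : ∀ a → Subexponential (qPoch a q)
    qPoch-subexponential a σ 1<σ =
      let N , h = q^n*a-small a (0<ᵈ 1<σ)
      in O-ratio (qPoch a q) (λ n → 1ℂ - q ^ n * a) (ℚₚ.<-trans 0<1 1<σ) (λ n → ≈-refl)
           (N , λ n le → subst (1ℂ - q ^ n * a ≼_) (p+d 1ℚ σ) (≼-sub 1≼1 (h n le)))

    -- The ratio v (n+1)/v n is written without division as `v (suc n) * qPoch a q n`. It is inverse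
    -- to 1 - qⁿ a, whose modulus is eventually at least 1/σ; the local `κ` is this 1/σ.
    inverse-subexponential : ∀ a (v : ℕ → ℂ) → (∀ n → v n * qPoch a q n ≈ 1ℂ) → Subexponential v
    inverse-subexponential a v e σ 1<σ =
      let κ , 0<κ , σκ = divide 0<σ 0<1
          κ<1   = subst₂ ℚ._<_ (ℚₚ.*-identityʳ κ) (trans (ℚₚ.*-comm κ σ) σκ) (*-mono-< 0<κ 1<σ)
          N , h = q^n*a-small a (0<ᵈ κ<1)
      in O-ratio v (λ n → v (suc n) * qPoch a q n) 0<σ
           (λ n → ≈-trans (ring 1 (λ w → w ⩵ ⟪ 1ℚ ⟫ ⊗ w) ≈-refl (v (suc n)))
             (≈-trans (*-cong (≈-sym (e n)) ≈-refl)
               (ring 3 (λ v p w → v ⊗ p ⊗ w ⩵ v ⊗ (w ⊗ p)) ≈-refl (v n) (qPoch a q n) (v (suc n)))))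
           (N , λ n le → ≼-inverse {v (suc n) * qPoch a q n} {1ℂ - q ^ n * a} {1ℚ ℚ.- (1ℚ ℚ.- κ)} {σ} (ℚₚ.<⇒≤ 0<σ)
             (trans (cong (σ ℚ.*_) (solve 1 (λ κ → con 1ℚ :- (con 1ℚ :- κ) := κ) refl κ)) σκ)
             (≈-trans (ring 3 (λ w p u → w ⊗ p ⊗ u ⩵ w ⊗ (p ⊗ u)) ≈-refl (v (suc n)) (qPoch a q n) (1ℂ - q ^ n * a)) (e (suc n)))
             (1-z-lower (≤-by (ℚₚ.<⇒≤ 0<κ) (solve 1 (λ κ → κ := con 1ℚ :- (con 1ℚ :- κ)) refl κ)) (h n le)))
      where
      0<σ : 0ℚ ℚ.< σ
      0<σ = ℚₚ.<-trans 0<1 1<σ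

    ^-geometric : ∀ {t} → ∣ t ∣ <ᵣ 1ᵣ → Geometric (t ^_)
    ^-geometric {t} h = let r , 0<r , r<1 , t≼r = radius<1 t h in geometric 0<r r<1 (O-pow t≼r)

    e-geometric : ∀ {t} → ∣ t ∣ <ᵣ 1ᵣ → Geometric (e t)
    e-geometric {t} h = Geometric-cong (λ n → ring 2 (λ a b → a ⊗ b ⩵ b ⊗ a) ≈-refl (κ n) (t ^ n))
      (Subexponential-*-Geometric (inverse-subexponential q κ κφ) (^-geometric h))

    e-cong : ∀ {t t′} → t ≈ t′ → ∀ n → e t n ≈ e t′ n
    e-cong h n = *-cong (^-cong h n) ≈-refl

    e-scale : ∀ s t n → s ^ n * e t n ≈ e (s * t) n
    e-scale s t n = ≈-trans (ring 3 (λ a b k → a ⊗ (b ⊗ k) ⩵ a ⊗ b ⊗ k) ≈-refl (s ^ n) (t ^ n) (κ n))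
      (*-cong (≈-sym (^-* s t n)) ≈-refl)

    e₀ : ∀ t → e t 0 ≈ 1ℂ
    e₀ t = ≈-trans (ring 1 (λ a → ⟪ 1ℚ ⟫ ⊗ a ⩵ a) ≈-refl (κ 0)) κ₀

    e-leibniz : ∀ t n → (1ℂ - q ^ n * q) * e t (suc n) ≈ t * e t n
    e-leibniz t n = ≈-trans
      (ring 4 (λ u t T k → u ⊗ (t ⊗ T ⊗ k) ⩵ t ⊗ (T ⊗ (k ⊗ u))) ≈-refl (1ℂ - q ^ n * q) t (t ^ n) (κ (suc n)))
      (*-cong ≈-refl (*-cong ≈-refl (≈-sym (κ-suc n))))

    -- The functional equation E(q t) = (1 - t) E(t) of Euler's series E, coefficient by
    -- coefficient. Iterated l times it gives `Sums-e-shift`.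
    e-difference : ∀ t n → e (q * t) (suc n) ≈ e t (suc n) - t * e t n
    e-difference t n = begin
      e (q * t) (suc n)                                     ≈⟨ ≈-sym (e-scale q t (suc n)) ⟩
      q ^ suc n * e t (suc n)                               ≈⟨ ring 3 (λ q p a → q ⊗ p ⊗ a ⩵ a ⊖ (⟪ 1ℚ ⟫ ⊖ p ⊗ q) ⊗ a)
                                                                 ≈-refl q (q ^ n) (e t (suc n)) ⟩
      e t (suc n) - (1ℂ - q ^ n * q) * e t (suc n)          ≈⟨ -‿cong ≈-refl (e-leibniz t n) ⟩
      e t (suc n) - t * e t n                               ∎
      where open ≈-Reasoning

    Sums-e-shift : ∀ t {S} → Sums (e t) S → ∀ l → Sums (e (q ^ l * t)) (qPoch t q l * S)
    Sums-e-shift t {S} F zero    = Sums-resp (one S) (Sums-cong (e-cong (one t)) F)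
      where
      one : ∀ a → a ≈ 1ℂ * a
      one = ring 1 (λ a → a ⩵ ⟪ 1ℚ ⟫ ⊗ a) ≈-refl
    Sums-e-shift t {S} F (suc l) = Sums-resp
      (ring 3 (λ u P S → u ⊗ (P ⊗ S) ⩵ (P ⊗ u) ⊗ S) ≈-refl (1ℂ - q ^ l * t) (qPoch t q l) S)
      (Sums-cong (e-cong (ring 3 (λ q p t → q ⊗ (p ⊗ t) ⩵ q ⊗ p ⊗ t) ≈-refl q (q ^ l) t))
        (Sums-difference (e (q ^ l * t)) (e (q * (q ^ l * t))) (q ^ l * t) ≈-refl (e-difference (q ^ l * t))
          (Sums-e-shift t F l)))

    -- qPoch t q l * S is the sum of e (q ^ l * t), which is 1 + O(q ^ l).
    qPoch-Sums-e : ∀ t → ∣ t ∣ <ᵣ 1ᵣ → ∀ {S} → Sums (e t) S → Geometric (λ l → qPoch t q l * S - 1ℂ)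
    qPoch-Sums-e t ∣t∣<1 {S} F =
      let r , 0<r , r<1 , q≼r = radius<1 q ∣q∣<1
          geometric 0<ρ ρ<1 (O-by C 0≤C h) = Geometric-drop {e t} 1 (e-geometric ∣t∣<1)
          v , 0<v , [1-ρ]v = divide (0<ᵈ ρ<1) 0<1
      in geometric 0<r r<1 (O-by (C ℚ.* v ℚ.+ 1ℚ) (0≤+ (0≤* 0≤C (ℚₚ.<⇒≤ 0<v)) 0≤1)
           (near 0<r r<1 q≼r 0<ρ 0≤C (ℚₚ.<⇒≤ 0<v) (trans (ℚₚ.*-comm v _) [1-ρ]v) h))
      where
      near : ∀ {r C ρ v} → 0ℚ ℚ.< r → r ℚ.< 1ℚ → q ≼ r → 0ℚ ℚ.< ρ → 0ℚ ℚ.≤ C → 0ℚ ℚ.≤ v → v ℚ.* (1ℚ ℚ.- ρ) ≡ 1ℚ →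
        (∀ i → e t (suc i) ≼ C ℚ.* ρ ↑ i) → ∀ l → qPoch t q l * S - 1ℂ ≼ (C ℚ.* v ℚ.+ 1ℚ) ℚ.* r ↑ l
      near {r} {C} {ρ} {v} 0<r r<1 q≼r 0<ρ 0≤C 0≤v v[1-ρ] h l =
        let geometric 0<σ σ<1 (O-by D 0≤D g) = Sums-e-shift t F l
            -- The series is cut where its partial sum is within r ↑ l of the limit, which accounts
            -- for the summand 1 in the constant. The terms before the cut, other than the initial
            -- 1, are bounded uniformly in M.
            M , small = *↑-small 0≤D (ℚₚ.<⇒≤ 0<σ) σ<1 (↑-pos l 0<r)
            small′    = ℚₚ.<⇒≤ (small (suc M) (ℕₚ.n≤1+n M))
        in ≼-cong (combine M) (subst (∑ M tail - (∑ (suc M) (e w) - qPoch t q l * S) ≼_)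
             (rearrange (r ↑ l) C v) (≼-sub (∑-≼ {tail} {r ↑ l ℚ.* C} {ρ} {v} (0≤* (↑-nonNeg l (ℚₚ.<⇒≤ 0<r)) 0≤C) 0<ρ 0≤v v[1-ρ] tail≼ M)
               (≼-mono small′ (g (suc M)))))
        where
        w : ℂ
        w = q ^ l * t
        tail : ℕ → ℂ
        tail i = e w (suc i)
        rearrange : ∀ P C v → (P ℚ.* C) ℚ.* v ℚ.+ P ≡ (C ℚ.* v ℚ.+ 1ℚ) ℚ.* P
        rearrange = solve 3 (λ P C v → (P :* C) :* v :+ P := (C :* v :+ con 1ℚ) :* P) refl

        tail≼ : ∀ i → tail i ≼ r ↑ l ℚ.* C ℚ.* ρ ↑ i
        -- Of the i + 1 factors q ^ l one is kept, to yield r ↑ l; the others are bounded by 1.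
        tail≼ i = ≼-cong
          (≈-trans (ring 3 (λ p P a → p ⊗ (P ⊗ a) ⩵ p ⊗ P ⊗ a) ≈-refl (q ^ l) ((q ^ l) ^ i) (e t (suc i)))
            (e-scale (q ^ l) t (suc i)))
          (subst (q ^ l * ((q ^ l) ^ i * e t (suc i)) ≼_)
            (trans (cong (r ↑ l ℚ.*_) (ℚₚ.*-identityˡ (C ℚ.* ρ ↑ i))) (sym (ℚₚ.*-assoc (r ↑ l) C (ρ ↑ i))))
            (≼-* (≼-^ l q≼r) (≼-* (≼-mono (↑-≤1 i (↑-nonNeg l (ℚₚ.<⇒≤ 0<r)) (↑-≤1 l (ℚₚ.<⇒≤ 0<r) (ℚₚ.<⇒≤ r<1)))
              (≼-^ i (≼-^ l q≼r))) (h i))))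

        combine : ∀ M → ∑ M tail - (∑ (suc M) (e w) - qPoch t q l * S) ≈ qPoch t q l * S - 1ℂ
        combine M = ≈-trans
          (-‿cong ≈-refl (-‿cong (≈-trans (∑-split (e w) 1 M) (+-cong (+-cong ≈-refl (e₀ w)) ≈-refl)) ≈-refl))
          (ring 2 (λ a P → a ⊖ (⟪ 0ℚ ⟫ ⊕ ⟪ 1ℚ ⟫ ⊕ a ⊖ P) ⩵ P ⊖ ⟪ 1ℚ ⟫) ≈-refl (∑ M tail) (qPoch t q l * S))

    -- For some N the product `qPoch t q N * S` lies at distance less than 1 from 1, so it is
    -- nonzero and so is its factor S.
    Sums-e-nonZero : ∀ t → ∣ t ∣ <ᵣ 1ᵣ → ∀ {S} → Sums (e t) S → NonZero S
    Sums-e-nonZero t ∣t∣<1 {S} F =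
      let geometric {ρ} 0<ρ ρ<1 (O-by C 0≤C h) = qPoch-Sums-e t ∣t∣<1 F
          N , small = *↑-small {C} {ρ} 0≤C (ℚₚ.<⇒≤ 0<ρ) ρ<1 0<1
      in nonZero-factor {S} {qPoch t q N} (nonZero-from-1 {S * qPoch t q N} {C ℚ.* ρ ↑ N} (small N ℕₚ.≤-refl)
           (≼-cong (flip (qPoch t q N)) (≼-neg (h N))))
      where
      flip : ∀ Q → -ℂ (Q * S - 1ℂ) ≈ 1ℂ - S * Q
      flip Q = ≈-trans (neg-sub (Q * S) 1ℂ)
        (ring 2 (λ Q S → ⟪ 1ℚ ⟫ ⊖ Q ⊗ S ⩵ ⟪ 1ℚ ⟫ ⊖ S ⊗ Q) ≈-refl Q S)

    qPoch-limit : ∀ t → ∣ t ∣ <ᵣ 1ᵣ → ∀ {S P} → Sums (e t) S → P * S ≈ 1ℂ → Geometric (λ N → qPoch t q N - P)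
    qPoch-limit t ∣t∣<1 {S} {P} F PS = Geometric-cong
      (λ N → begin
        P * (qPoch t q N * S - 1ℂ)
          ≈⟨ ring 3 (λ P Q S → P ⊗ (Q ⊗ S ⊖ ⟪ 1ℚ ⟫) ⩵ Q ⊗ (P ⊗ S) ⊖ P) ≈-refl P (qPoch t q N) S ⟩
        qPoch t q N * (P * S) - P
          ≈⟨ -‿cong (*-cong ≈-refl PS) ≈-refl ⟩
        qPoch t q N * 1ℂ - P
          ≈⟨ ring 2 (λ Q P → Q ⊗ ⟪ 1ℚ ⟫ ⊖ P ⩵ Q ⊖ P) ≈-refl (qPoch t q N) P ⟩
        qPoch t q N - P ∎)
      (Geometric-scale P (qPoch-Sums-e t ∣t∣<1 F))
      where open ≈-Reasoning

    euler : ∀ t → ∣ t ∣ <ᵣ 1ᵣ → ∃[ S ] ∃[ P ] (Sums (e t) S × P * S ≈ 1ℂ)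
    euler t ∣t∣<1 =
      let S , F = summable (e-geometric ∣t∣<1)
          S≢0   = Sums-e-nonZero t ∣t∣<1 F
      in S , inverse S S≢0 , F , inverse-* S S≢0

  -- The q-binomial theorem, and Hahn polynomials as Cauchy products

  opaque
    qPoch-one : ∀ n → qPoch 1ℂ q (suc n) ≈ 0ℂ
    qPoch-one n = ≈-trans (qPoch-first q 1ℂ n)
      (ring 1 (λ P → (⟪ 1ℚ ⟫ ⊖ ⟪ 1ℚ ⟫) ⊗ P ⩵ ⟪ 0ℚ ⟫) ≈-refl (qPoch (q * 1ℂ) q n))

    -- This is F(a) = (1 - a t) F(q a) for F(a) = ∑ (a;q)ₙ tⁿ/(q;q)ₙ, coefficient by coefficient. It
    -- rests on 1 - a = (1 - q^(n+1) a) - a (1 - q^(n+1)).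
    q-binomial-difference : ∀ a t n →
      qPoch a q (suc n) * e t (suc n) ≈ qPoch (q * a) q (suc n) * e t (suc n) - (a * t) * (qPoch (q * a) q n * e t n)
    q-binomial-difference a t n = begin
      qPoch a q (suc n) * (t * t ^ n * κ (suc n))
        ≈⟨ *-cong (qPoch-first q a n) ≈-refl ⟩
      (1ℂ - a) * Q * (t * t ^ n * κ (suc n))
        ≈⟨ ring 7 (λ a q p t T k Q → (⟪ 1ℚ ⟫ ⊖ a) ⊗ Q ⊗ (t ⊗ T ⊗ k) ⩵
             Q ⊗ (⟪ 1ℚ ⟫ ⊖ p ⊗ (q ⊗ a)) ⊗ (t ⊗ T ⊗ k) ⊖ (a ⊗ t) ⊗ (Q ⊗ (T ⊗ (k ⊗ (⟪ 1ℚ ⟫ ⊖ p ⊗ q)))))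
             ≈-refl a q (q ^ n) t (t ^ n) (κ (suc n)) Q ⟩
      Q * (1ℂ - q ^ n * (q * a)) * (t * t ^ n * κ (suc n)) - (a * t) * (Q * (t ^ n * (κ (suc n) * (1ℂ - q ^ n * q))))
        ≈⟨ -‿cong ≈-refl (*-cong ≈-refl (*-cong ≈-refl (*-cong ≈-refl (≈-sym (κ-suc n))))) ⟩
      Q * (1ℂ - q ^ n * (q * a)) * (t * t ^ n * κ (suc n)) - (a * t) * (Q * (t ^ n * κ n)) ∎
      where
      open ≈-Reasoning
      Q : ℂ
      Q = qPoch (q * a) q n

    zero-geometric : Geometric (λ _ → 0ℂ)
    zero-geometric = geometric 0<½ ½<1 (O-by 0ℚ ℚₚ.≤-refl (λ n → 0≼ (0≤* ℚₚ.≤-refl (↑-nonNeg n (ℚₚ.<⇒≤ 0<½)))))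
      where
      ½<1 : ½ ℚ.< 1ℚ
      ½<1 = <-by {½} {1ℚ} 0<½ refl

    Sums-single : ∀ {f} → (∀ n → f (suc n) ≈ 0ℂ) → Sums f (f 0)
    Sums-single {f} h = Geometric-cons (Geometric-cong (λ N → ≈-sym (value N)) zero-geometric)
      where
      value : ∀ N → ∑ (suc N) f - f 0 ≈ 0ℂ
      value zero    = ring 1 (λ a → ⟪ 0ℚ ⟫ ⊕ a ⊖ a ⩵ ⟪ 0ℚ ⟫) ≈-refl (f 0)
      value (suc N) = ≈-trans (-‿cong (+-cong ≈-refl (h N)) ≈-refl)
        (≈-trans (ring 2 (λ a b → a ⊕ ⟪ 0ℚ ⟫ ⊖ b ⩵ a ⊖ b) ≈-refl (∑ (suc N) f) (f 0)) (value N))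

    -- For K = 0 all terms after the first contain (1;q) and vanish. Passing from q^K to q^(K+1)
    -- divides the sum by 1 - q^K t, the last factor of (t;q)_{K+1}. The value is any inverse w of
    -- the product, so a caller may supply it in factored form; in the step, w u inverts (t;q)_K and
    -- w P inverts u.
    q-binomial : ∀ t → ∣ t ∣ <ᵣ 1ᵣ → ∀ K {w} → w * qPoch t q K ≈ 1ℂ → Sums (λ i → qPoch (q ^ K) q i * e t i) w
    q-binomial t ∣t∣<1 zero    {w} h = Sums-resp
      (≈-trans (*-cong ≈-refl (e₀ t)) (≈-sym (≈-trans (ring 1 (λ w → w ⩵ w ⊗ ⟪ 1ℚ ⟫) ≈-refl w)
        (≈-trans h (ring 0 (⟪ 1ℚ ⟫ ⩵ ⟪ 1ℚ ⟫ ⊗ ⟪ 1ℚ ⟫) ≈-refl)))))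
      (Sums-single {λ i → qPoch 1ℂ q i * e t i} (λ n → ≈-trans (*-cong (qPoch-one n) ≈-refl)
        (ring 1 (λ a → ⟪ 0ℚ ⟫ ⊗ a ⩵ ⟪ 0ℚ ⟫) ≈-refl (e t (suc n)))))
    q-binomial t ∣t∣<1 (suc K) {w} h = Sums-resp
      (≈-trans (ring 3 (λ w P u → w ⊗ P ⊗ (w ⊗ u) ⩵ w ⊗ (w ⊗ (P ⊗ u))) ≈-refl w P u)
        (≈-trans (*-cong ≈-refl h) (ring 1 (λ w → w ⊗ ⟪ 1ℚ ⟫ ⩵ w) ≈-refl w)))
      (Sums-undifference (λ i → qPoch (q ^ suc K) q i * e t i) (λ i → qPoch (q ^ K) q i * e t i) (q ^ K * t)
        ≈-refl (q-binomial-difference (q ^ K) t)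
        {v = w * P} (≈-trans (ring 3 (λ w P u → w ⊗ P ⊗ u ⩵ w ⊗ (P ⊗ u)) ≈-refl w P u) h)
        (Subexponential-*-Geometric (qPoch-subexponential (q ^ suc K)) (e-geometric ∣t∣<1))
        (q-binomial t ∣t∣<1 K {w * u} (≈-trans (ring 3 (λ w P u → w ⊗ u ⊗ P ⩵ w ⊗ (P ⊗ u)) ≈-refl w P u) h)))
      where
      P u : ℂ
      P = qPoch t q K
      u = 1ℂ - q ^ K * t

    qBinomial≈ : ∀ m j → qBinomial q ∣q∣<1 m j ≈ φ m * (κ j * κ (m ℕ.∸ j))
    qBinomial≈ m j = ≈-sym (/-unique
      (*-nonZero (φ j) (φ (m ℕ.∸ j)) (qPoch-q-nonZero q ∣q∣<1 j) (qPoch-q-nonZero q ∣q∣<1 (m ℕ.∸ j)))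
      (begin
        φ m * (κ j * κ i) * (φ j * φ i)
          ≈⟨ ring 5 (λ a b c d f → a ⊗ (b ⊗ c) ⊗ (d ⊗ f) ⩵ a ⊗ ((b ⊗ d) ⊗ (c ⊗ f))) ≈-refl
               (φ m) (κ j) (κ i) (φ j) (φ i) ⟩
        φ m * ((κ j * φ j) * (κ i * φ i))
          ≈⟨ *-cong ≈-refl (*-cong (κφ j) (κφ i)) ⟩
        φ m * (1ℂ * 1ℂ)
          ≈⟨ ring 1 (λ a → a ⊗ (⟪ 1ℚ ⟫ ⊗ ⟪ 1ℚ ⟫) ⩵ a) ≈-refl (φ m) ⟩
        φ m ∎))
      where
      open ≈-Reasoning
      i : ℕ
      i = m ℕ.∸ j

    Hahn-conv : ∀ α b x m → Hahn q ∣q∣<1 α b x m ≈ φ m * conv (e x) (λ j → qPoch α q j * e b j) m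
    Hahn-conv α b x m = begin
      Hahn q ∣q∣<1 α b x m
        ≈⟨ ∑-cong (λ j → ≈-trans (*-cong (*-cong (*-cong (qBinomial≈ m j) ≈-refl) ≈-refl) ≈-refl)
             (ring 6 (λ F k l c B X → F ⊗ (k ⊗ l) ⊗ c ⊗ B ⊗ X ⩵ F ⊗ ((X ⊗ l) ⊗ (c ⊗ (B ⊗ k)))) ≈-refl
               (φ m) (κ j) (κ (m ℕ.∸ j)) (qPoch α q j) (b ^ j) (x ^ (m ℕ.∸ j)))) (suc m) ⟩
      ∑ (suc m) (λ j → φ m * (e x (m ℕ.∸ j) * (qPoch α q j * e b j)))
        ≈⟨ ∑-scale (φ m) (λ j → e x (m ℕ.∸ j) * (qPoch α q j * e b j)) (suc m) ⟩
      φ m * ∑ (suc m) (λ j → e x (m ℕ.∸ j) * (qPoch α q j * e b j))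
        ≈⟨ *-cong ≈-refl (∑-∸-conv (e x) (λ j → qPoch α q j * e b j) m) ⟩
      φ m * conv (e x) (λ j → qPoch α q j * e b j) m ∎
      where open ≈-Reasoning

  -- The array `H` and the splitting of the index n + m

  module _ (c : ℕ → ℂ) (b x : ℂ) where

    -- H m l = ∑ⱼ [m, j] (qˡ x)^(m-j) bʲ c (l + j), with [m, j] the q-binomial coefficient; for c = (α;q) and l = 0 a Hahn polynomial.
    H : ℕ → ℕ → ℂ
    H zero    l = c l
    H (suc m) l = q ^ l * x * H m l + b * H m (suc l)

    opaque
      -- `conv-leibniz` reproduces the recursion of `H`: lowering the first factor gives q^l x times
      -- the entry (m, l), while lowering the second shifts c and turns q^l x into q^(l+1) x, giving
      -- b times the entry (m, l + 1).
      H-conv : ∀ m l → φ m * conv (e (q ^ l * x)) (λ j → c (l +ℕ j) * e b j) m ≈ H m l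
      H-conv zero    l = ≈-trans
        (*-cong ≈-refl (*-cong (e₀ (q ^ l * x)) (*-cong (≡⇒≈ (cong c (ℕₚ.+-identityʳ l))) (e₀ b))))
        (ring 1 (λ a → ⟪ 1ℚ ⟫ ⊗ (⟪ 1ℚ ⟫ ⊗ (a ⊗ ⟪ 1ℚ ⟫)) ⩵ a) ≈-refl (c l))
      H-conv (suc m) l = begin
        φ m * u * conv (e w) d (suc m)
          ≈⟨ ring 3 (λ F u C → F ⊗ u ⊗ C ⩵ F ⊗ (u ⊗ C)) ≈-refl (φ m) u (conv (e w) d (suc m)) ⟩
        φ m * (u * conv (e w) d (suc m))
          ≈⟨ *-cong ≈-refl (conv-leibniz q (e w) d (λ i → w * e w i) (λ j → b * d⁺ j) (e-leibniz w) d-leibniz m) ⟩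
        φ m * (conv (λ i → w * e w i) d m + conv (λ i → q ^ i * e w i) (λ j → b * d⁺ j) m)
          ≈⟨ *-cong ≈-refl (+-cong (conv-scaleˡ w (e w) d m)
               (≈-trans (conv-scaleʳ b (λ i → q ^ i * e w i) d⁺ m)
                 (*-cong ≈-refl (conv-cong {g = d⁺} (λ i → ≈-trans (e-scale q w i) (e-cong qw i)) (λ _ → ≈-refl) m)))) ⟩
        φ m * (w * conv (e w) d m + b * conv (e (q ^ suc l * x)) d⁺ m)
          ≈⟨ ring 5 (λ F w b C D → F ⊗ (w ⊗ C ⊕ b ⊗ D) ⩵ w ⊗ (F ⊗ C) ⊕ b ⊗ (F ⊗ D)) ≈-refl
               (φ m) w b (conv (e w) d m) (conv (e (q ^ suc l * x)) d⁺ m) ⟩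
        w * (φ m * conv (e w) d m) + b * (φ m * conv (e (q ^ suc l * x)) d⁺ m)
          ≈⟨ +-cong (*-cong ≈-refl (H-conv m l)) (*-cong ≈-refl (H-conv m (suc l))) ⟩
        w * H m l + b * H m (suc l) ∎
        where
        open ≈-Reasoning
        w u : ℂ
        w = q ^ l * x
        u = 1ℂ - q ^ m * q
        d d⁺ : ℕ → ℂ
        d j  = c (l +ℕ j) * e b j
        d⁺ j = c (suc l +ℕ j) * e b j
        qw : q * w ≈ q ^ suc l * x
        qw = ring 3 (λ q p x → q ⊗ (p ⊗ x) ⩵ q ⊗ p ⊗ x) ≈-refl q (q ^ l) x
        d-leibniz : ∀ n → (1ℂ - q ^ n * q) * d (suc n) ≈ b * d⁺ n
        d-leibniz n = ≈-trans (*-cong ≈-refl (*-cong (≡⇒≈ (cong c (ℕₚ.+-suc l n))) ≈-refl))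
          (≈-trans (ring 3 (λ u c a → u ⊗ (c ⊗ a) ⩵ c ⊗ (u ⊗ a)) ≈-refl (1ℂ - q ^ n * q) (c (suc l +ℕ n)) (e b (suc n)))
            (≈-trans (*-cong ≈-refl (e-leibniz b n))
              (ring 3 (λ b c a → c ⊗ (b ⊗ a) ⩵ b ⊗ (c ⊗ a)) ≈-refl b (c (suc l +ℕ n)) (e b n))))

      -- Induction on n with m free. The weight 1 - q^(n+1) turns the factor H m l into q^l x H m l
      -- + b H m (l + 1), which is H (suc m) l, so one unit moves from n to m.
      H-+ : ∀ n m → φ n * conv (λ l → e b l * H m l) (e x) n ≈ H (n +ℕ m) 0
      H-+ zero    m = ≈-trans (*-cong ≈-refl (*-cong (*-cong (e₀ b) ≈-refl) (e₀ x)))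
        (ring 1 (λ a → ⟪ 1ℚ ⟫ ⊗ (⟪ 1ℚ ⟫ ⊗ a ⊗ ⟪ 1ℚ ⟫) ⩵ a) ≈-refl (H m 0))
      H-+ (suc n) m = begin
        φ n * u * conv f (e x) (suc n)
          ≈⟨ ring 3 (λ F u C → F ⊗ u ⊗ C ⩵ F ⊗ (u ⊗ C)) ≈-refl (φ n) u (conv f (e x) (suc n)) ⟩
        φ n * (u * conv f (e x) (suc n))
          ≈⟨ *-cong ≈-refl (conv-leibniz q f (e x) f′ (λ j → x * e x j) f-leibniz (e-leibniz x) n) ⟩
        φ n * (conv f′ (e x) n + conv (λ i → q ^ i * f i) (λ j → x * e x j) n)
          ≈⟨ *-cong ≈-refl (+-cong ≈-refl (≈-trans (conv-scaleʳ x (λ i → q ^ i * f i) (e x) n)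
               (≈-sym (conv-scaleˡ x (λ i → q ^ i * f i) (e x) n)))) ⟩
        φ n * (conv f′ (e x) n + conv (λ i → x * (q ^ i * f i)) (e x) n)
          ≈⟨ *-cong ≈-refl (≈-sym (conv-+ˡ f′ (λ i → x * (q ^ i * f i)) (e x) n)) ⟩
        φ n * conv (λ i → f′ i + x * (q ^ i * f i)) (e x) n
          ≈⟨ *-cong ≈-refl (conv-cong {g = e x} (λ i →
               ring 6 (λ b E h⁺ x p h → b ⊗ E ⊗ h⁺ ⊕ x ⊗ (p ⊗ (E ⊗ h)) ⩵ E ⊗ (p ⊗ x ⊗ h ⊕ b ⊗ h⁺)) ≈-refl
                 b (e b i) (H m (suc i)) x (q ^ i) (H m i)) (λ _ → ≈-refl) n) ⟩
        φ n * conv (λ l → e b l * H (suc m) l) (e x) n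
          ≈⟨ H-+ n (suc m) ⟩
        H (n +ℕ suc m) 0
          ≈⟨ ≡⇒≈ (cong (λ k → H k 0) (ℕₚ.+-suc n m)) ⟩
        H (suc n +ℕ m) 0 ∎
        where
        open ≈-Reasoning
        u : ℂ
        u = 1ℂ - q ^ n * q
        f f′ : ℕ → ℂ
        f l  = e b l * H m l
        f′ l = b * e b l * H m (suc l)
        f-leibniz : ∀ n → (1ℂ - q ^ n * q) * f (suc n) ≈ f′ n
        f-leibniz n = ≈-trans
          (ring 3 (λ u a h → u ⊗ (a ⊗ h) ⩵ (u ⊗ a) ⊗ h) ≈-refl (1ℂ - q ^ n * q) (e b (suc n)) (H m (suc n)))
          (*-cong (e-leibniz b n) ≈-refl)

  opaque
    κ-/ : ∀ z n → z / φ n ⟨ qPoch-q-nonZero q ∣q∣<1 n ⟩ ≈ z * κ n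
    κ-/ z n = ≈-sym (/-unique (qPoch-q-nonZero q ∣q∣<1 n)
      (≈-trans (ring 3 (λ z k F → z ⊗ k ⊗ F ⩵ z ⊗ (k ⊗ F)) ≈-refl z (κ n) (φ n))
        (≈-trans (*-cong ≈-refl (κφ n)) (ring 1 (λ z → z ⊗ ⟪ 1ℚ ⟫ ⩵ z) ≈-refl z))))

    qPoch∞ : ∀ a P → Geometric (λ N → qPoch a q N - P) → HasqPoch∞ a q P
    qPoch∞ a P G = Geometric⇒⟶ (Geometric-cong
      (λ N → -‿cong (∏-cong (λ j → -‿cong ≈-refl (ring 2 (λ p a → p ⊗ a ⩵ a ⊗ p) ≈-refl (q ^ j) a)) N) ≈-refl) G)

    -- From (a;q)_{k+N} = (a;q)_k (q^k a;q)_N. It supplies the numerator of the theorem as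
    -- (bz;q)_∞/(bz;q)_k.
    qPoch-shift-limit : ∀ a k {P v} → v * qPoch a q k ≈ 1ℂ →
      Geometric (λ N → qPoch a q N - P) → Geometric (λ N → qPoch (q ^ k * a) q N - v * P)
    qPoch-shift-limit a k {P} {v} h G = Geometric-cong
      (λ N → begin
        v * (qPoch a q (k +ℕ N) - P)
          ≈⟨ *-cong ≈-refl (-‿cong (qPoch-split q a k N) ≈-refl) ⟩
        v * (qPoch a q k * qPoch (q ^ k * a) q N - P)
          ≈⟨ ring 4 (λ v A Q P → v ⊗ (A ⊗ Q ⊖ P) ⩵ v ⊗ A ⊗ Q ⊖ v ⊗ P) ≈-refl v (qPoch a q k) (qPoch (q ^ k * a) q N) P ⟩
        v * qPoch a q k * qPoch (q ^ k * a) q N - v * P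
          ≈⟨ -‿cong (*-cong h ≈-refl) ≈-refl ⟩
        1ℂ * qPoch (q ^ k * a) q N - v * P
          ≈⟨ ring 2 (λ Q R → ⟪ 1ℚ ⟫ ⊗ Q ⊖ R ⩵ Q ⊖ R) ≈-refl (qPoch (q ^ k * a) q N) (v * P) ⟩
        qPoch (q ^ k * a) q N - v * P ∎)
      (Geometric-scale v (Geometric-drop k G))
      where open ≈-Reasoning

  -- Summation over m

  module _ (k : ℕ) (b x z : ℂ) where

    c : ℕ → ℂ
    c = qPoch (q ^ k) q

    opaque
      -- Since (q^k;q)_{l+j} = (q^k;q)_l (q^(k+l);q)_j, the second factor of the Cauchy product is a
      -- q-binomial series with exponent K = k + l.
      H-sum : ∣ b * z ∣ <ᵣ 1ᵣ → ∀ {S} → Sums (e (x * z)) S → ∀ l {w} → w * qPoch (b * z) q (k +ℕ l) ≈ 1ℂ →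
        Sums (λ m → H c b x m l * e z m) ((qPoch (x * z) q l * S) * (c l * w))
      H-sum ∣bz∣<1 {S} F l {w} h = Sums-cong expand (Sums-conv (Sums-e-shift (x * z) F l) binomial)
        where
        open ≈-Reasoning
        u : ℂ
        u = q ^ l * x
        d : ℕ → ℂ
        d j = c (l +ℕ j) * e b j

        binomial : Sums (λ j → c (l +ℕ j) * e (b * z) j) (c l * w)
        binomial = Sums-cong
          (λ j → ≈-trans
            (ring 3 (λ C Q a → C ⊗ (Q ⊗ a) ⩵ C ⊗ Q ⊗ a) ≈-refl (c l) (qPoch (q ^ (k +ℕ l)) q j) (e (b * z) j))
            (*-cong (≈-trans
              (*-cong ≈-refl (qPoch-cong q (≈-trans (^-+ q k l) (ring 2 (λ a b → a ⊗ b ⩵ b ⊗ a) ≈-refl (q ^ k) (q ^ l))) j))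
              (≈-sym (qPoch-split q (q ^ k) l j))) ≈-refl))
          (Sums-scale (c l) (q-binomial (b * z) ∣bz∣<1 (k +ℕ l) h))

        expand : ∀ m → conv (e (q ^ l * (x * z))) (λ j → c (l +ℕ j) * e (b * z) j) m ≈ H c b x m l * e z m
        expand m = begin
          conv (e (q ^ l * (x * z))) (λ j → c (l +ℕ j) * e (b * z) j) m
            ≈⟨ conv-cong
                 (λ i → ≈-trans
                   (e-cong (ring 3 (λ p x z → p ⊗ (x ⊗ z) ⩵ z ⊗ (p ⊗ x)) ≈-refl (q ^ l) x z) i)
                   (≈-sym (e-scale z u i)))
                 (λ j → ≈-trans
                   (*-cong ≈-refl (≈-trans (e-cong (ring 2 (λ b z → b ⊗ z ⩵ z ⊗ b) ≈-refl b z) j) (≈-sym (e-scale z b j))))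
                   (ring 3 (λ C Z a → C ⊗ (Z ⊗ a) ⩵ Z ⊗ (C ⊗ a)) ≈-refl (c (l +ℕ j)) (z ^ j) (e b j))) m ⟩
          conv (λ i → z ^ i * e u i) (λ j → z ^ j * d j) m
            ≈⟨ ≈-sym (conv-^ z (e u) d m) ⟩
          z ^ m * conv (e u) d m
            ≈⟨ ring 2 (λ Z C → Z ⊗ C ⩵ Z ⊗ C ⊗ ⟪ 1ℚ ⟫) ≈-refl (z ^ m) (conv (e u) d m) ⟩
          z ^ m * conv (e u) d m * 1ℂ
            ≈⟨ *-cong ≈-refl (≈-sym (κφ m)) ⟩
          z ^ m * conv (e u) d m * (κ m * φ m)
            ≈⟨ ring 4 (λ Z C K F → Z ⊗ C ⊗ (K ⊗ F) ⩵ F ⊗ C ⊗ (Z ⊗ K)) ≈-refl (z ^ m) (conv (e u) d m) (κ m) (φ m) ⟩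
          φ m * conv (e u) d m * e z m
            ≈⟨ *-cong (H-conv c b x m l) ≈-refl ⟩
          H c b x m l * e z m ∎

      Hahn-H : ∀ m → Hahn q ∣q∣<1 (q ^ k) b x m ≈ H c b x m 0
      Hahn-H m = ≈-trans (Hahn-conv (q ^ k) b x m) (≈-trans
        (*-cong ≈-refl (conv-cong {g = λ j → c j * e b j}
          (e-cong (ring 1 (λ x → x ⩵ ⟪ 1ℚ ⟫ ⊗ x) ≈-refl x)) (λ _ → ≈-refl) m))
        (H-conv c b x m 0))

      summand : ∀ y n m →
        Hahn q ∣q∣<1 (q ^ k) b x (n +ℕ m)
          * (y ^ n / φ n ⟨ qPoch-q-nonZero q ∣q∣<1 n ⟩) * (z ^ m / φ m ⟨ qPoch-q-nonZero q ∣q∣<1 m ⟩)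
        ≈ y ^ n * conv (λ l → e b l * (H c b x m l * e z m)) (e x) n
      summand y n m = begin
        Hahn q ∣q∣<1 (q ^ k) b x (n +ℕ m)
          * (y ^ n / φ n ⟨ qPoch-q-nonZero q ∣q∣<1 n ⟩) * (z ^ m / φ m ⟨ qPoch-q-nonZero q ∣q∣<1 m ⟩)
          ≈⟨ *-cong (*-cong (≈-trans (Hahn-H (n +ℕ m)) (≈-sym (H-+ c b x n m))) (κ-/ (y ^ n) n)) (κ-/ (z ^ m) m) ⟩
        φ n * C * (y ^ n * κ n) * e z m
          ≈⟨ ring 5 (λ F C Y K E → F ⊗ C ⊗ (Y ⊗ K) ⊗ E ⩵ Y ⊗ (E ⊗ C) ⊗ (K ⊗ F)) ≈-refl (φ n) C (y ^ n) (κ n) (e z m) ⟩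
        y ^ n * (e z m * C) * (κ n * φ n)
          ≈⟨ *-cong ≈-refl (κφ n) ⟩
        y ^ n * (e z m * C) * 1ℂ
          ≈⟨ ring 2 (λ Y C → Y ⊗ C ⊗ ⟪ 1ℚ ⟫ ⩵ Y ⊗ C) ≈-refl (y ^ n) (e z m * C) ⟩
        y ^ n * (e z m * C)
          ≈⟨ *-cong ≈-refl (≈-sym (conv-scaleˡ (e z m) (λ l → e b l * H c b x m l) (e x) n)) ⟩
        y ^ n * conv (λ l → e z m * (e b l * H c b x m l)) (e x) n
          ≈⟨ *-cong ≈-refl (conv-cong {g = e x}
               (λ l → ring 3 (λ E B h → E ⊗ (B ⊗ h) ⩵ B ⊗ (h ⊗ E)) ≈-refl (e z m) (e b l) (H c b x m l)) (λ _ → ≈-refl) n) ⟩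
        y ^ n * conv (λ l → e b l * (H c b x m l * e z m)) (e x) n ∎
        where
        open ≈-Reasoning
        C : ℂ
        C = conv (λ l → e b l * H c b x m l) (e x) n

  -- The ₂φ₁ series

  module _ (a₁ a₂ b₁ : ℂ) (b₁≢0 : ∀ l → NonZero (qPoch b₁ q l)) (w : ℂ) where

    -- Definitionally the local `term` of `Has₂φ₁`, which cannot be named from outside.
    ₂φ₁-term : ℕ → ℂ
    ₂φ₁-term l = qPoch a₁ q l * qPoch a₂ q l / (qPoch q q l * qPoch b₁ q l)
      ⟨ *-nonZero (qPoch q q l) (qPoch b₁ q l) (qPoch-q-nonZero q ∣q∣<1 l) (b₁≢0 l) ⟩ * w ^ l

    opaque
      ₂φ₁-term≈ : ∀ l {v} → v * qPoch b₁ q l ≈ 1ℂ → ₂φ₁-term l ≈ qPoch a₁ q l * qPoch a₂ q l * (κ l * v) * w ^ l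
      ₂φ₁-term≈ l {v} h = *-cong (≈-sym (/-unique
        (*-nonZero (qPoch q q l) (qPoch b₁ q l) (qPoch-q-nonZero q ∣q∣<1 l) (b₁≢0 l))
        (≈-trans (ring 5 (λ N k v F B → N ⊗ (k ⊗ v) ⊗ (F ⊗ B) ⩵ N ⊗ ((k ⊗ F) ⊗ (v ⊗ B))) ≈-refl
                   (qPoch a₁ q l * qPoch a₂ q l) (κ l) v (φ l) (qPoch b₁ q l))
          (≈-trans (*-cong ≈-refl (*-cong (κφ l) h))
            (ring 1 (λ N → N ⊗ (⟪ 1ℚ ⟫ ⊗ ⟪ 1ℚ ⟫) ⩵ N) ≈-refl (qPoch a₁ q l * qPoch a₂ q l)))))) ≈-refl

      ₂φ₁-geometric : ∣ w ∣ <ᵣ 1ᵣ → Geometric ₂φ₁-term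
      ₂φ₁-geometric ∣w∣<1 = Geometric-cong
        (λ l → ≈-trans (ring 5 (λ a b k v W → a ⊗ (b ⊗ (k ⊗ (v ⊗ W))) ⩵ a ⊗ b ⊗ (k ⊗ v) ⊗ W) ≈-refl
            (qPoch a₁ q l) (qPoch a₂ q l) (κ l) (v l) (w ^ l))
          (≈-sym (₂φ₁-term≈ l (v-inverse l))))
        (Subexponential-*-Geometric (qPoch-subexponential a₁)
          (Subexponential-*-Geometric (qPoch-subexponential a₂)
            (Subexponential-*-Geometric (inverse-subexponential q κ κφ)
              (Subexponential-*-Geometric (inverse-subexponential b₁ v v-inverse) (^-geometric ∣w∣<1)))))
        where
        v : ℕ → ℂ
        v l = inverse (qPoch b₁ q l) (b₁≢0 l)
        v-inverse : ∀ l → v l * qPoch b₁ q l ≈ 1ℂ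
        v-inverse l = inverse-* (qPoch b₁ q l) (b₁≢0 l)

  module _ (k : ℕ) (b x y z S v₀ : ℂ) (v : ℕ → ℂ) where

    -- `v₀ * v l` is to be the inverse of (bz;q)_{k+l}, split so that `v l` belongs to the lower
    -- parameter q^k bz of the ₂φ₁ and `v₀` is a constant.
    H-sums row-sums : ℕ → ℂ
    H-sums l = (qPoch (x * z) q l * S) * (c k b x z l * (v₀ * v l))
    row-sums n = y ^ n * conv (λ l → e b l * H-sums l) (e x) n

    module _ (v₀-inverse : v₀ * qPoch (b * z) q k ≈ 1ℂ) (v-inverse : ∀ l → v l * qPoch (q ^ k * (b * z)) q l ≈ 1ℂ) where

      opaque
        row-sum : ∣ b * z ∣ <ᵣ 1ᵣ → Sums (e (x * z)) S → ∀ n →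
          Sums (λ m → Hahn q ∣q∣<1 (q ^ k) b x (n +ℕ m)
            * (y ^ n / φ n ⟨ qPoch-q-nonZero q ∣q∣<1 n ⟩) * (z ^ m / φ m ⟨ qPoch-q-nonZero q ∣q∣<1 m ⟩)) (row-sums n)
        row-sum ∣bz∣<1 F n = Sums-cong (λ m → ≈-sym (summand k b x z y n m)) (Sums-scale (y ^ n)
          (conv-Sums (λ l m → e b l * (H (c k b x z) b x m l * e z m)) (λ l → e b l * H-sums l) (e x)
            (λ l → Sums-scale (e b l) (H-sum k b x z ∣bz∣<1 F l (≈-trans (*-cong ≈-refl (qPoch-split q (b * z) k l))
              (≈-trans (ring 4 (λ v₀ v P Q → v₀ ⊗ v ⊗ (P ⊗ Q) ⩵ (v₀ ⊗ P) ⊗ (v ⊗ Q)) ≈-refl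
                  v₀ (v l) (qPoch (b * z) q k) (qPoch (q ^ k * (b * z)) q l))
                (≈-trans (*-cong v₀-inverse (v-inverse l)) (ring 0 (⟪ 1ℚ ⟫ ⊗ ⟪ 1ℚ ⟫ ⩵ ⟪ 1ℚ ⟫) ≈-refl)))))) n))

        -- By `conv-^` the power yⁿ is shared between the factors of the Cauchy product: yˡ goes to
        -- the terms in b, which become S v₀ times those of the ₂φ₁, and the rest turns `e x` into
        -- `e (x * y)`.
        total-sum : ∀ {T F} b₁≢0 → Sums (e (x * y)) T →
          Sums (₂φ₁-term (q ^ k) (x * z) (q ^ k * (b * z)) b₁≢0 (b * y)) F → Sums row-sums (S * v₀ * F * T)
        total-sum b₁≢0 E Φ = Sums-cong
          (λ n → ≈-trans
            (conv-cong
              (λ l → begin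
                S * v₀ * term l
                  ≈⟨ *-cong ≈-refl (₂φ₁-term≈ (q ^ k) (x * z) (q ^ k * (b * z)) b₁≢0 (b * y) l (v-inverse l)) ⟩
                S * v₀ * (c k b x z l * qPoch (x * z) q l * (κ l * v l) * (b * y) ^ l)
                  ≈⟨ *-cong ≈-refl (*-cong ≈-refl (^-* b y l)) ⟩
                S * v₀ * (c k b x z l * qPoch (x * z) q l * (κ l * v l) * (b ^ l * y ^ l))
                  ≈⟨ ring 6 (λ S v₀ P K v N → S ⊗ v₀ ⊗ (P ⊗ (K ⊗ v) ⊗ N) ⩵ (P ⊗ S ⊗ (v₀ ⊗ v)) ⊗ (K ⊗ N)) ≈-refl
                       S v₀ (c k b x z l * qPoch (x * z) q l) (κ l) (v l) (b ^ l * y ^ l) ⟩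
                c k b x z l * qPoch (x * z) q l * S * (v₀ * v l) * (κ l * (b ^ l * y ^ l))
                  ≈⟨ *-cong (ring 4 (λ C X S V → C ⊗ X ⊗ S ⊗ V ⩵ X ⊗ S ⊗ (C ⊗ V)) ≈-refl
                               (c k b x z l) (qPoch (x * z) q l) S (v₀ * v l))
                            (ring 3 (λ K B Y → K ⊗ (B ⊗ Y) ⩵ Y ⊗ (B ⊗ K)) ≈-refl (κ l) (b ^ l) (y ^ l)) ⟩
                H-sums l * (y ^ l * e b l)
                  ≈⟨ ring 3 (λ h Y E → h ⊗ (Y ⊗ E) ⩵ Y ⊗ (E ⊗ h)) ≈-refl (H-sums l) (y ^ l) (e b l) ⟩
                y ^ l * (e b l * H-sums l) ∎)
              (λ i → ≈-trans (e-cong (ring 2 (λ x y → x ⊗ y ⩵ y ⊗ x) ≈-refl x y) i) (≈-sym (e-scale y x i))) n)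
            (≈-sym (conv-^ y (λ l → e b l * H-sums l) (e x) n)))
          (Sums-conv (Sums-scale (S * v₀) Φ) E)
          where
          open ≈-Reasoning
          term : ℕ → ℂ
          term = ₂φ₁-term (q ^ k) (x * z) (q ^ k * (b * z)) b₁≢0 (b * y)

-- The closed form

opaque
  Sums⇒HasSum : ∀ f S → Sums f S → HasSum f S
  Sums⇒HasSum f S F = Geometric⇒⟶ {λ N → ∑ N f} {S} F

  -- T and S are the inverses of B and C, and the numerator (q^k bz;q)_∞ has the form v D, so D
  -- cancels against the denominator.
  quotient : ∀ {B C D S T v} F (BCD≢0 : NonZero (B * C * D)) → B * T ≈ 1ℂ → C * S ≈ 1ℂ →
    S * v * F * T ≈ (v * D) / (B * C * D) ⟨ BCD≢0 ⟩ * F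
  quotient {B} {C} {D} {S} {T} {v} F BCD≢0 BT CS = ≈-trans
    (ring 4 (λ S v F T → S ⊗ v ⊗ F ⊗ T ⩵ S ⊗ T ⊗ v ⊗ F) ≈-refl S v F T)
    (*-cong (/-unique BCD≢0 (≈-trans
      (ring 6 (λ S T v B C D → S ⊗ T ⊗ v ⊗ (B ⊗ C ⊗ D) ⩵ v ⊗ D ⊗ ((B ⊗ T) ⊗ (C ⊗ S))) ≈-refl S T v B C D)
      (≈-trans (*-cong ≈-refl (*-cong BT CS)) (ring 2 (λ v D → v ⊗ D ⊗ (⟪ 1ℚ ⟫ ⊗ ⟪ 1ℚ ⟫) ⩵ v ⊗ D) ≈-refl v D)))) ≈-refl)

theorem13 : (q : ℂ) (∣q∣<1 : ∣ q ∣ <ᵣ 1ᵣ) (k : ℕ) (b x y z : ℂ) →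
    ∣ x * y ∣ <ᵣ 1ᵣ → ∣ x * z ∣ <ᵣ 1ᵣ → ∣ b * y ∣ <ᵣ 1ᵣ → (∣bz∣<1 : ∣ b * z ∣ <ᵣ 1ᵣ) →
    ∃[ A ] ∃[ B ] ∃[ C ] ∃[ D ] ∃[ F ] Σ (NonZero (B * C * D)) λ BCD≢0 →
    HasqPoch∞ (q ^ k * (b * z)) q A ×
    HasqPoch∞ (x * y) q B ×
    HasqPoch∞ (x * z) q C ×
    HasqPoch∞ (b * z) q D ×
    Has₂φ₁ q ∣q∣<1 (q ^ k) (x * z) (q ^ k * (b * z))
    (qPoch-nonZero (q ^ k * (b * z)) q ∣q∣<1 (∣q^k*c∣<1 q (b * z) ∣q∣<1 ∣bz∣<1 k))
    (b * y) F ×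
    HasDoubleSum
    (λ n m → Hahn q ∣q∣<1 (q ^ k) b x (n +ℕ m)
    * (y ^ n / qPoch q q n ⟨ qPoch-q-nonZero q ∣q∣<1 n ⟩)
    * (z ^ m / qPoch q q m ⟨ qPoch-q-nonZero q ∣q∣<1 m ⟩))
    (A / (B * C * D) ⟨ BCD≢0 ⟩ * F)
theorem13 q ∣q∣<1 k b x y z ∣xy∣<1 ∣xz∣<1 ∣by∣<1 ∣bz∣<1 =
  v₀ * D , B , C , D , F , BCD≢0 ,
  qPoch∞ (q ^ k * (b * z)) (v₀ * D) (qPoch-shift-limit (b * z) k v₀-inverse D-limit) ,
  qPoch∞ (x * y) B (qPoch-limit (x * y) ∣xy∣<1 ET BT) ,
  qPoch∞ (x * z) C (qPoch-limit (x * z) ∣xz∣<1 ES CS) ,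
  qPoch∞ (b * z) D D-limit ,
  Sums⇒HasSum (₂φ₁-term (q ^ k) (x * z) (q ^ k * (b * z)) b₁≢0 (b * y)) F Φ ,
  row-sums k b x y z S v₀ v ,
  (λ n → Sums⇒HasSum _ (row-sums k b x y z S v₀ v n) (row-sum k b x y z S v₀ v v₀-inverse v-inverse ∣bz∣<1 ES n)) ,
  Sums⇒HasSum (row-sums k b x y z S v₀ v) ((v₀ * D) / (B * C * D) ⟨ BCD≢0 ⟩ * F)
    (Sums-resp (quotient F BCD≢0 BT CS) (total-sum k b x y z S v₀ v v₀-inverse v-inverse b₁≢0 ET Φ))
  where
  open QSeries q ∣q∣<1

  b₁≢0 : ∀ l → NonZero (qPoch (q ^ k * (b * z)) q l)
  b₁≢0 = qPoch-nonZero (q ^ k * (b * z)) q ∣q∣<1 (∣q^k*c∣<1 q (b * z) ∣q∣<1 ∣bz∣<1 k)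

  bz≢0 : NonZero (qPoch (b * z) q k)
  bz≢0 = qPoch-nonZero (b * z) q ∣q∣<1 ∣bz∣<1 k

  v₀ : ℂ
  v₀ = inverse (qPoch (b * z) q k) bz≢0
  v : ℕ → ℂ
  v l = inverse (qPoch (q ^ k * (b * z)) q l) (b₁≢0 l)

  v₀-inverse : v₀ * qPoch (b * z) q k ≈ 1ℂ
  v₀-inverse = inverse-* (qPoch (b * z) q k) bz≢0
  v-inverse : ∀ l → v l * qPoch (q ^ k * (b * z)) q l ≈ 1ℂ
  v-inverse l = inverse-* (qPoch (q ^ k * (b * z)) q l) (b₁≢0 l)

  T B S C R D F : ℂ
  T = proj₁ (euler (x * y) ∣xy∣<1)
  B = proj₁ (proj₂ (euler (x * y) ∣xy∣<1))
  S = proj₁ (euler (x * z) ∣xz∣<1)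
  C = proj₁ (proj₂ (euler (x * z) ∣xz∣<1))
  R = proj₁ (euler (b * z) ∣bz∣<1)
  D = proj₁ (proj₂ (euler (b * z) ∣bz∣<1))
  F = proj₁ (summable (₂φ₁-geometric (q ^ k) (x * z) (q ^ k * (b * z)) b₁≢0 (b * y) ∣by∣<1))

  ET : Sums (e (x * y)) T
  ET = proj₁ (proj₂ (proj₂ (euler (x * y) ∣xy∣<1)))
  BT : B * T ≈ 1ℂ
  BT = proj₂ (proj₂ (proj₂ (euler (x * y) ∣xy∣<1)))
  ES : Sums (e (x * z)) S
  ES = proj₁ (proj₂ (proj₂ (euler (x * z) ∣xz∣<1)))
  CS : C * S ≈ 1ℂ
  CS = proj₂ (proj₂ (proj₂ (euler (x * z) ∣xz∣<1)))
  ER : Sums (e (b * z)) R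
  ER = proj₁ (proj₂ (proj₂ (euler (b * z) ∣bz∣<1)))
  DR : D * R ≈ 1ℂ
  DR = proj₂ (proj₂ (proj₂ (euler (b * z) ∣bz∣<1)))
  Φ : Sums (₂φ₁-term (q ^ k) (x * z) (q ^ k * (b * z)) b₁≢0 (b * y)) F
  Φ = proj₂ (summable (₂φ₁-geometric (q ^ k) (x * z) (q ^ k * (b * z)) b₁≢0 (b * y) ∣by∣<1))

  D-limit : Geometric (λ N → qPoch (b * z) q N - D)
  D-limit = qPoch-limit (b * z) ∣bz∣<1 ER DR
  BCD≢0 : NonZero (B * C * D)
  BCD≢0 = *-nonZero (B * C) D (*-nonZero B C (nonZero-unit BT) (nonZero-unit CS)) (nonZero-unit DR)
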